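{- For all $\varepsilon,\alpha\in(0,1]$ there is $c_0>0$ such that for every $0<c\leq c_0$ there is $n_0$ such that the following holds for all $n\geq n_0$. Let $D$ be an $n$-vertex digraph with $\delta^0(D)\geq(1/2+\alpha)n$ and let $v\in V(D)$. Let $T$ be an oriented tree with at most $(1-\varepsilon)n$ vertices and $\Delta^\pm(T)\leq cn/\log n$, and let $t\in V(T)$. Then $D$ contains a copy of $T$ in which $t$ is copied to $v$.
   Context: Digraphs have edges that are ordered pairs of distinct vertices; $\delta^0(D)$ is the minimum over all vertices of the minimum of the in-degree and out-degree. An oriented tree is a tree with each edge given a direction; $\Delta^\pm(T)$ is the maximum degree of its underlying undirected tree. A copy of $T$ in $D$ is an injective map $V(T)\to V(D)$ mapping each directed edge of $T$ to an edge of $D$ with the same direction; "$t$ is copied to $v$" means $t$ is mapped to $v$. -}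

module Defs where

open import Data.Nat as ℕ using (ℕ; _^_)
open import Data.Integer as ℤ using (ℤ; +_)
open import Data.Rational as ℚ using (ℚ; ↥_; ↧ₙ_; _/_)
open import Data.Bool using (Bool; true; false; T; _∨_; if_then_else_)
open import Data.Fin using (Fin)
open import Data.List using (List; []; _∷_; _++_; [_]; map; allFin; length)
open import Data.Nat.ListAction using (sum)
open import Data.List.Relation.Unary.Linked using (Linked)
open import Data.List.Relation.Unary.Unique.Propositional using (Unique)
open import Data.Product using (Σ; _×_; ∃)
open import Relation.Binary.PropositionalEquality using (_≡_)
open import Relation.Nullary using (¬_)
open import Function.Definitions using (Injective)

ℕtoℚ : ℕ → ℚ
ℕtoℚ n = (+ n) / 1

countTrue : ∀ {n} → (Fin n → Bool) → ℕ
countTrue {n} f = sum (map (λ j → if f j then 1 else 0) (allFin n))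

record Digraph (n : ℕ) : Set where
  field
    adj       : Fin n → Fin n → Bool
    loopless  : ∀ i → adj i i ≡ false

outdeg : ∀ {n} → Digraph n → Fin n → ℕ
outdeg D i = countTrue (λ j → Digraph.adj D i j)

indeg : ∀ {n} → Digraph n → Fin n → ℕ
indeg D i = countTrue (λ j → Digraph.adj D j i)

MinSemiDegreeAtLeast : ∀ {n} → Digraph n → ℚ → Set
MinSemiDegreeAtLeast D x =
  ∀ i → (x ℚ.≤ ℕtoℚ (outdeg D i)) × (x ℚ.≤ ℕtoℚ (indeg D i))

record OrientedGraph (m : ℕ) : Set where
  field
    arc        : Fin m → Fin m → Bool
    loopless   : ∀ i → arc i i ≡ false
    antisym    : ∀ i j → T (arc i j) → ¬ T (arc j i)

module _ {m : ℕ} (G : OrientedGraph m) where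
  open OrientedGraph G

  UAdj : Fin m → Fin m → Set
  UAdj a b = T (arc a b ∨ arc b a)

  udeg : Fin m → ℕ
  udeg a = countTrue (λ b → arc a b ∨ arc b a)

  data Reach (u : Fin m) : Fin m → Set where
    here : Reach u u
    step : ∀ {v w} → Reach u v → UAdj v w → Reach u w

  Connected : Set
  Connected = ∀ u w → Reach u w

  HasCycle : Set
  HasCycle = Σ (Fin m) λ x → Σ (List (Fin m)) λ xs →
    (2 ℕ.≤ length xs) × Unique (x ∷ xs) × Linked UAdj (x ∷ xs ++ [ x ])

  IsTree : Set
  IsTree = Connected × ¬ HasCycle

record OrientedTree (m : ℕ) : Set where
  field
    graph  : OrientedGraph m
    isTree : IsTree graph

-- "Δ ≤ c n / log n" (log base 2), for c = p/q > 0, written exactly in ℕ as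
--   n ^ (Δ * q) ≤ 2 ^ (p * n)
LogBound : ℕ → ℚ → ℕ → Set
LogBound Δ c n = n ^ (Δ ℕ.* ↧ₙ c) ℕ.≤ 2 ^ (ℤ.∣ ↥ c ∣ ℕ.* n)

MaxDegBound : ∀ {m} → OrientedTree m → ℚ → ℕ → Set
MaxDegBound Tr c n = ∀ a → LogBound (udeg (OrientedTree.graph Tr) a) c n

CopyWith : ∀ {m n} → OrientedTree m → Fin m → Digraph n → Fin n → Set
CopyWith {m} {n} Tr t D v = Σ (Fin m → Fin n) λ φ →
  Injective _≡_ _≡_ φ ×
  (∀ a b → T (OrientedGraph.arc (OrientedTree.graph Tr) a b) → T (Digraph.adj D (φ a) (φ b))) ×
  φ t ≡ v

-- Root T at t and cut it bottom-up into components: a root together with at most a constant times Δ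
-- vertices below it, all but O(m/K) vertices of T being non-roots. The components are embedded one
-- after another, parents first, into the set U of unused vertices of D.
-- For each of the 2n sets S = N⁺(u), N⁻(u) put x(S) = |U| + |U ∖ S|. While the moment Φ = ∑ x(S)^M,
-- M ≈ C log n, is not much larger than (|U|/n)^M times its initial value, all x(S)/|U| are below
-- 3/2 - α/4, so D[U] and the edges into U keep minimum semidegree (1/2 + α/4)|U|. The change of Φ is
-- to first order a linear cost in the vertices that a component uses, and Δ ≤ cn/log n makes the
-- second-order terms negligible. So it suffices to embed a component, for any cost function on U,
-- at a cost close to the average one.
-- D[U] has an r-regular spanning subgraph with r linear in |U|, and the random walk along it preserves
-- the uniform distribution; by Markov's inequality the trees of bounded size below the root of a
-- component can then be placed greedily at nearly their average cost. The root is chosen such that its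
-- out-children have room on the cheapest spots, in which case its in-children have room below the
-- median, or vice versa: the better of the two choices costs at most the average.

module Submission where

open import Defs
open import Data.Product using (Σ; ∃; _×_; _,_; proj₁; proj₂)

-- A vertex sees only slightly more than half of `U` in either direction, and that may be the
-- expensive half. Hence the children of an arbitrary root cannot be placed at average cost, and the
-- root itself is confined to a neighbourhood of its parent. The price of a root is therefore
-- bounded only by `C` times the average, which is affordable because roots are rare. Counting |U|
-- into x(S) keeps x(S) between |U| and 2|U|. Removing a component then changes it by a small
-- relative amount, even after raising to the power M; the part of U outside S alone could be tiny.
-- The moment takes the place of a concentration bound for random choices: there are 2n sets, and M
-- is so large that 2n is at most (1 + 1/ρ)^M, so a single large x(S) already shows in the sum. All
-- estimates are inequalities between natural numbers. The unit fractions 1/p and 1/e stand in for α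
-- and ε, and 1/E is the relative error allowed in one step.

module Embedding where

  import Algebra.Properties.Semiring.Sum as SumProps
  open import Data.Bool using (Bool; true; false; _∧_; _∨_; not; if_then_else_; T)
  import Data.Bool as B
  open import Data.Bool.Properties using (∧-zeroʳ; ∧-identityʳ; ∨-zeroʳ; T-≡; T-∨)
  open import Data.Empty using (⊥; ⊥-elim)
  open import Data.Fin using (Fin; zero; suc; splitAt; _↑ˡ_; _↑ʳ_)
  import Data.Fin as F
  open import Data.Fin.Properties using (any?; injective⇒≤; splitAt-↑ˡ; splitAt-↑ʳ)
  open import Data.Integer as ℤ using (+[1+_]; -[1+_]; +0)
  import Data.Integer.Properties as ℤₚ
  open import Data.List using (List; []; _∷_; [_]; length; map; _++_; tabulate; lookup)
  open import Data.List.Membership.Propositional using (_∈_; _∉_)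
  open import Data.List.Membership.Propositional.Properties using (∈-++⁺ˡ; ∈-++⁺ʳ; ∈-++⁻; ∈-map⁺)
  open import Data.List.Properties using (map-tabulate; map-++; map-∘; length-++; length-map; ++-identityʳ)
  open import Data.List.Relation.Unary.All using (All; []; _∷_)
  import Data.List.Relation.Unary.All as All
  import Data.List.Relation.Unary.All.Properties as AllP
  open import Data.List.Relation.Unary.AllPairs using ([]; _∷_)
  open import Data.List.Relation.Unary.Any using (here; there; index)
  open import Data.List.Relation.Unary.Any.Properties using (lookup-index)
  open import Data.List.Relation.Unary.Linked using (Linked; [-]; _∷_)
  open import Data.List.Relation.Unary.Unique.Propositional using (Unique)
  import Data.List.Relation.Unary.Unique.Propositional.Properties as UniqP
  open import Data.Nat
  open import Data.Nat.DivMod using (m/n*n≤m; m≡m%n+[m/n]*n; m%n<n; m≥n⇒m/n>0; /-monoˡ-≤; m*n/n≡m)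
  open import Data.Nat.ListAction using (sum)
  open import Data.Nat.ListAction.Properties using (sum-++)
  open import Data.Nat.Properties
  open import Data.Nat.Tactic.RingSolver using (solve-∀)
  open import Data.Rational as ℚ using (ℚ; mkℚ; ½; 0ℚ; 1ℚ; ↧ₙ_; toℚᵘ; fromℚᵘ)
  import Data.Rational.Properties as ℚₚ
  open import Data.Rational.Unnormalised as ℚᵘ using (ℚᵘ; mkℚᵘ)
  import Data.Rational.Unnormalised.Properties as ℚᵘₚ
  open import Data.Sum using (_⊎_; inj₁; inj₂; [_,_]′)
  open import Data.Unit using (⊤; tt)
  open import Function using (_∘_; id)
  open import Function.Bundles using (Equivalence)
  open import Relation.Binary.PropositionalEquality hiding ([_])
  open import Relation.Nullary using (¬_; yes; no; does; contradiction)
  open import Relation.Nullary.Decidable using (_×-dec_)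

  open SumProps +-*-semiring
    using (∑-distrib-+; ∑-comm; sum-cong-≗; *-distribˡ-sum) renaming (sum to ∑)

  -- Counting by sums over finite sets.

  ⟦_⟧ : Bool → ℕ
  ⟦ b ⟧ = if b then 1 else 0

  ⟦⟧≤1 : ∀ b → ⟦ b ⟧ ≤ 1
  ⟦⟧≤1 true = ≤-refl
  ⟦⟧≤1 false = z≤n

  ⟦⟧≡0 : ∀ {b} → (b ≡ true → ⊥) → ⟦ b ⟧ ≡ 0
  ⟦⟧≡0 {true} h = ⊥-elim (h refl)
  ⟦⟧≡0 {false} _ = refl

  true≢false : ∀ {b} → b ≡ true → b ≡ false → ⊥
  true≢false refl ()

  *-pos : ∀ {a b} → 1 ≤ a → 1 ≤ b → 1 ≤ a * b
  *-pos = *-mono-≤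

  countTrue≡∑ : ∀ {n} (f : Fin n → Bool) → countTrue f ≡ ∑ (λ i → ⟦ f i ⟧)
  countTrue≡∑ f = trans (cong sum (map-tabulate id (λ j → ⟦ f j ⟧))) (go (λ j → ⟦ f j ⟧))
    where
    go : ∀ {n} (g : Fin n → ℕ) → sum (tabulate g) ≡ ∑ g
    go {zero} g = refl
    go {suc n} g = cong (g zero +_) (go (g ∘ suc))

  ∑-mono : ∀ {n} {f g : Fin n → ℕ} → (∀ i → f i ≤ g i) → ∑ f ≤ ∑ g
  ∑-mono {zero} p = z≤n
  ∑-mono {suc n} p = +-mono-≤ (p zero) (∑-mono (p ∘ suc))

  ∑-const : ∀ {n} c → ∑ {n} (λ _ → c) ≡ n * c
  ∑-const {zero} c = refl
  ∑-const {suc n} c = cong (c +_) (∑-const {n} c)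

  ∑-zero : ∀ {n} → ∑ {n} (λ _ → 0) ≡ 0
  ∑-zero {n} = trans (∑-const {n} 0) (*-zeroʳ n)

  ≤∑ : ∀ {n} (f : Fin n → ℕ) i → f i ≤ ∑ f
  ≤∑ f zero = m≤m+n _ _
  ≤∑ f (suc i) = ≤-trans (≤∑ (f ∘ suc) i) (m≤n+m _ _)

  ∑<∑⇒∃ : ∀ {n} {f g : Fin n → ℕ} → ∑ f < ∑ g → ∃ λ i → f i < g i
  ∑<∑⇒∃ {suc n} {f} {g} lt with f zero <? g zero
  ... | yes p = zero , p
  ... | no ¬p with ∑<∑⇒∃ {n} {f ∘ suc} {g ∘ suc}
                    (+-cancelˡ-< (g zero) _ _ (≤-<-trans (+-monoˡ-≤ _ (≮⇒≥ ¬p)) lt))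
  ... | i , q = suc i , q

  ∑-*ˡ : ∀ {n} c (f : Fin n → ℕ) → ∑ (λ i → c * f i) ≡ c * ∑ f
  ∑-*ˡ c f = sym (*-distribˡ-sum c f)

  ∑-*ʳ : ∀ {n} c (f : Fin n → ℕ) → ∑ (λ i → f i * c) ≡ ∑ f * c
  ∑-*ʳ c f = trans (sum-cong-≗ (λ i → *-comm (f i) c)) (trans (∑-*ˡ c f) (*-comm c _))

  δ : ∀ {n} → Fin n → Fin n → Bool
  δ i j = does (i F.≟ j)

  δ-refl : ∀ {n} (i : Fin n) → δ i i ≡ true
  δ-refl i with i F.≟ i
  ... | yes _ = refl
  ... | no ¬p = contradiction refl ¬p

  ∑-δ : ∀ {n} (i : Fin n) (f : Fin n → ℕ) → ∑ (λ j → ⟦ δ i j ⟧ * f j) ≡ f i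
  ∑-δ {suc n} zero f = trans (cong₂ _+_ (+-identityʳ (f zero)) (∑-zero {n})) (+-identityʳ _)
  ∑-δ {suc n} (suc i) f = ∑-δ i (f ∘ suc)

  ⟦∧⟧ : ∀ a b → ⟦ a ∧ b ⟧ ≡ ⟦ a ⟧ * ⟦ b ⟧
  ⟦∧⟧ true true = refl
  ⟦∧⟧ true false = refl
  ⟦∧⟧ false b = refl

  mult : ∀ {n} → List (Fin n) → Fin n → ℕ
  mult L u = sum (map (λ l → ⟦ δ l u ⟧) L)

  sum-by-∑ : ∀ {n} (L : List (Fin n)) (f : Fin n → ℕ) →
    sum (map f L) ≡ ∑ (λ u → mult L u * f u)
  sum-by-∑ {n} [] f = sym (∑-zero {n})
  sum-by-∑ (l ∷ L) f = begin
    f l + sum (map f L) ≡⟨ cong₂ _+_ (sym (∑-δ l f)) (sum-by-∑ L f) ⟩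
    ∑ (λ u → ⟦ δ l u ⟧ * f u) + ∑ (λ u → μ u * f u) ≡⟨ sym (∑-distrib-+ (λ u → ⟦ δ l u ⟧ * f u) _) ⟩
    ∑ (λ u → ⟦ δ l u ⟧ * f u + μ u * f u) ≡⟨ sum-cong-≗ (λ u → sym (*-distribʳ-+ (f u) ⟦ δ l u ⟧ (μ u))) ⟩
    ∑ (λ u → (⟦ δ l u ⟧ + μ u) * f u) ∎
    where
    open ≡-Reasoning
    μ = mult L

  ∑-mult : ∀ {n} (L : List (Fin n)) → ∑ (mult L) ≡ length L
  ∑-mult L = trans (sum-cong-≗ (λ u → sym (*-identityʳ (mult L u)))) (trans (sym (sum-by-∑ L (λ _ → 1))) (go L))
    where
    go : ∀ {A : Set} (L : List A) → sum (map (λ _ → 1) L) ≡ length L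
    go [] = refl
    go (_ ∷ L) = cong suc (go L)

  -- Regular spanning subgraphs

  module _ {n : ℕ} where

    Matrix : Set
    Matrix = Fin n → Fin n → Bool

    row col : Matrix → Fin n → ℕ
    row R u = ∑ (λ w → ⟦ R u w ⟧)
    col R w = ∑ (λ u → ⟦ R u w ⟧)

    _⊆ᴹ_ : Matrix → Matrix → Set
    R ⊆ᴹ E = ∀ u w → R u w ≡ true → E u w ≡ true

    -- Phrased as an equation between counts, so that row and column sums follow by linearity.
    -- Deleting an entry is the same relation read backwards.
    record Adds (u w : Fin n) (R R′ : Matrix) : Set where
      constructor adds
      field adds-at : ∀ i j → ⟦ R′ i j ⟧ ≡ ⟦ R i j ⟧ + ⟦ δ u i ⟧ * ⟦ δ w j ⟧

    set : Fin n → Fin n → Bool → Matrix → Matrix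
    set u w b R i j = if δ u i ∧ δ w j then b else R i j

    set-here : ∀ u w b R → set u w b R u w ≡ b
    set-here u w b R rewrite δ-refl u | δ-refl w = refl

    set-elsewhere : ∀ u w b R i j → (i ≡ u → j ≡ w → ⊥) → set u w b R i j ≡ R i j
    set-elsewhere u w b R i j h with u F.≟ i | w F.≟ j
    ... | no _ | _ = refl
    ... | yes _ | no _ = refl
    ... | yes p | yes q = ⊥-elim (h (sym p) (sym q))

    set-true : ∀ u w R → R u w ≡ false → Adds u w R (set u w true R)
    set-true u w R e = adds go
      where
      go : ∀ i j → ⟦ set u w true R i j ⟧ ≡ ⟦ R i j ⟧ + ⟦ δ u i ⟧ * ⟦ δ w j ⟧
      go i j with u F.≟ i | w F.≟ j
      ... | no _ | _ = sym (+-identityʳ _)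
      ... | yes _ | no _ = sym (+-identityʳ _)
      ... | yes refl | yes refl rewrite e = refl

    set-false : ∀ u w R → R u w ≡ true → Adds u w (set u w false R) R
    set-false u w R e = adds go
      where
      go : ∀ i j → ⟦ R i j ⟧ ≡ ⟦ set u w false R i j ⟧ + ⟦ δ u i ⟧ * ⟦ δ w j ⟧
      go i j with u F.≟ i | w F.≟ j
      ... | no _ | _ = sym (+-identityʳ _)
      ... | yes _ | no _ = sym (+-identityʳ _)
      ... | yes refl | yes refl rewrite e = refl

    Adds-row : ∀ {u w R R′} → Adds u w R R′ → ∀ i → row R′ i ≡ row R i + ⟦ δ u i ⟧
    Adds-row {u} {w} {R} {R′} (adds ad) i = begin
      row R′ i ≡⟨ sum-cong-≗ (ad i) ⟩
      ∑ (λ j → ⟦ R i j ⟧ + ⟦ δ u i ⟧ * ⟦ δ w j ⟧) ≡⟨ ∑-distrib-+ (λ j → ⟦ R i j ⟧) _ ⟩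
      row R i + ∑ (λ j → ⟦ δ u i ⟧ * ⟦ δ w j ⟧) ≡⟨ cong (row R i +_) (sum-cong-≗ (λ j → *-comm ⟦ δ u i ⟧ ⟦ δ w j ⟧)) ⟩
      row R i + ∑ (λ j → ⟦ δ w j ⟧ * ⟦ δ u i ⟧) ≡⟨ cong (row R i +_) (∑-δ w (λ _ → ⟦ δ u i ⟧)) ⟩
      row R i + ⟦ δ u i ⟧ ∎
      where open ≡-Reasoning

    Adds-col : ∀ {u w R R′} → Adds u w R R′ → ∀ j → col R′ j ≡ col R j + ⟦ δ w j ⟧
    Adds-col {u} {w} {R} {R′} (adds ad) j = begin
      col R′ j ≡⟨ sum-cong-≗ (λ i → ad i j) ⟩
      ∑ (λ i → ⟦ R i j ⟧ + ⟦ δ u i ⟧ * ⟦ δ w j ⟧) ≡⟨ ∑-distrib-+ (λ i → ⟦ R i j ⟧) _ ⟩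
      col R j + ∑ (λ i → ⟦ δ u i ⟧ * ⟦ δ w j ⟧) ≡⟨ cong (col R j +_) (∑-δ u (λ _ → ⟦ δ w j ⟧)) ⟩
      col R j + ⟦ δ w j ⟧ ∎
      where open ≡-Reasoning

    edges : Matrix → ℕ
    edges R = ∑ (row R)

    edges-col : ∀ R → edges R ≡ ∑ (col R)
    edges-col R = ∑-comm (λ u w → ⟦ R u w ⟧)

    module Factor (U : Fin n → Bool) (E : Matrix) (r : ℕ)
      (E⊆U : ∀ u w → E u w ≡ true → U u ≡ true × U w ≡ true)
      (rowE : ∀ u → U u ≡ true → ∑ (λ i → ⟦ U i ⟧) + 2 * r ≤ 2 * row E u)
      (colE : ∀ w → U w ≡ true → ∑ (λ i → ⟦ U i ⟧) + 2 * r ≤ 2 * col E w)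
      where

      N : ℕ
      N = ∑ (λ i → ⟦ U i ⟧)

      Sub : Matrix → Set
      Sub R = R ⊆ᴹ E × (∀ u → row R u ≤ r) × (∀ w → col R w ≤ r)

      bump : ∀ u (f f′ : Fin n → ℕ) → (∀ i → f i ≤ r) → f u < r → (∀ i → f′ i ≡ f i + ⟦ δ u i ⟧) → ∀ i → f′ i ≤ r
      bump u f f′ f≤ fu<r eq i rewrite eq i with u F.≟ i
      ... | yes refl = subst (_≤ r) (+-comm 1 (f i)) fu<r
      ... | no _ = subst (_≤ r) (sym (+-identityʳ (f i))) (f≤ i)

      ∑-bump : ∀ u (f f′ : Fin n → ℕ) → (∀ i → f′ i ≡ f i + ⟦ δ u i ⟧) → ∑ f′ ≡ suc (∑ f)
      ∑-bump u f f′ eq = trans (sum-cong-≗ eq) (trans (∑-distrib-+ f _) (trans (cong (∑ f +_)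
        (trans (sum-cong-≗ (λ i → sym (*-identityʳ ⟦ δ u i ⟧))) (∑-δ u (λ _ → 1)))) (+-comm (∑ f) 1)))

      done : ∀ {R R′ u w} → Sub R → R′ ⊆ᴹ E → row R u < r → col R w < r →
        (∀ i → row R′ i ≡ row R i + ⟦ δ u i ⟧) → (∀ j → col R′ j ≡ col R j + ⟦ δ w j ⟧) →
        Σ Matrix λ R′ → Sub R′ × edges R′ ≡ suc (edges R)
      done {R} {R′} {u} {w} (_ , r≤ , c≤) R′⊆ ru cw re ce =
        R′ , (R′⊆ , bump u (row R) (row R′) r≤ ru re , bump w (col R) (col R′) c≤ cw ce) , ∑-bump u (row R) (row R′) re

      set-true-⊆ : ∀ R u w → R ⊆ᴹ E → E u w ≡ true → set u w true R ⊆ᴹ E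
      set-true-⊆ R u w R⊆ e i j p with u F.≟ i | w F.≟ j
      ... | no _ | _ = R⊆ i j p
      ... | yes _ | no _ = R⊆ i j p
      ... | yes refl | yes refl = e

      set-false-⊆ : ∀ R u w → R ⊆ᴹ E → set u w false R ⊆ᴹ E
      set-false-⊆ R u w R⊆ i j p with u F.≟ i | w F.≟ j
      ... | no _ | _ = R⊆ i j p
      ... | yes _ | no _ = R⊆ i j p
      set-false-⊆ R u w R⊆ i j () | yes refl | yes refl

      add : ∀ {R u w} → Sub R → E u w ≡ true → R u w ≡ false → row R u < r → col R w < r →
        Σ Matrix λ R′ → Sub R′ × edges R′ ≡ suc (edges R)
      add {R} {u} {w} s@(R⊆ , _) e f ru cw = done {R} {_} {u} {w} s (set-true-⊆ R u w R⊆ e) ru cw (Adds-row ad) (Adds-col ad)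
        where ad = set-true u w R f

      exchange : ∀ {R u w a b} → Sub R → E u b ≡ true → R u b ≡ false → E a w ≡ true → R a w ≡ false →
        R a b ≡ true → row R u < r → col R w < r → a ≢ u →
        Σ Matrix λ R′ → Sub R′ × edges R′ ≡ suc (edges R)
      exchange {R} {u} {w} {a} {b} s@(R⊆ , _) Eub Rub Eaw Raw Rab ru cw a≢u =
        done {R} {_} {u} {w} s (set-true-⊆ R₂ a w (set-true-⊆ R₁ u b (set-false-⊆ R a b R⊆) Eub) Eaw) ru cw rows cols
        where
        R₁ = set a b false R
        ad₁ : Adds a b R₁ R
        ad₁ = set-false a b R Rab
        R₂ = set u b true R₁
        ad₂ : Adds u b R₁ R₂
        ad₂ = set-true u b R₁ (trans (set-elsewhere a b false R u b (λ p _ → a≢u (sym p))) Rub)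
        R₃ = set a w true R₂
        R₁aw : R₁ a w ≡ false
        R₁aw with w F.≟ b
        ... | yes refl = set-here a b false R
        ... | no ne = trans (set-elsewhere a b false R a w (λ _ q → ne q)) Raw
        ad₃ : Adds a w R₂ R₃
        ad₃ = set-true a w R₂ (trans (set-elsewhere u b true R₁ a w (λ p _ → a≢u p)) R₁aw)
        rows : ∀ i → row R₃ i ≡ row R i + ⟦ δ u i ⟧
        rows i = begin
          row R₃ i ≡⟨ Adds-row ad₃ i ⟩
          row R₂ i + ⟦ δ a i ⟧ ≡⟨ cong (_+ ⟦ δ a i ⟧) (Adds-row ad₂ i) ⟩
          row R₁ i + ⟦ δ u i ⟧ + ⟦ δ a i ⟧ ≡⟨ lem (row R₁ i) ⟦ δ u i ⟧ ⟦ δ a i ⟧ ⟩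
          row R₁ i + ⟦ δ a i ⟧ + ⟦ δ u i ⟧ ≡⟨ cong (_+ ⟦ δ u i ⟧) (sym (Adds-row ad₁ i)) ⟩
          row R i + ⟦ δ u i ⟧ ∎
          where
          open ≡-Reasoning
          lem : ∀ x y z → x + y + z ≡ x + z + y
          lem = solve-∀
        cols : ∀ j → col R₃ j ≡ col R j + ⟦ δ w j ⟧
        cols j = begin
          col R₃ j ≡⟨ Adds-col ad₃ j ⟩
          col R₂ j + ⟦ δ w j ⟧ ≡⟨ cong (_+ ⟦ δ w j ⟧) (Adds-col ad₂ j) ⟩
          col R₁ j + ⟦ δ b j ⟧ + ⟦ δ w j ⟧ ≡⟨ cong (_+ ⟦ δ w j ⟧) (sym (Adds-col ad₁ j)) ⟩
          col R j + ⟦ δ w j ⟧ ∎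
          where open ≡-Reasoning

      deficient : ∀ (f : Fin n → ℕ) → ∑ f < r * N → ∃ λ u → U u ≡ true × f u < r
      deficient f lt with ∑<∑⇒∃ (subst (∑ f <_) (sym (∑-*ˡ r (λ i → ⟦ U i ⟧))) lt)
      ... | u , q with U u in eq
      ...   | true = u , eq , subst (f u <_) (*-identityʳ r) q
      ...   | false = contradiction (subst (f u <_) (*-zeroʳ r) q) λ ()

      -- The margin `2 * r` in the degree hypothesis pays for the at most `r` neighbours already
      -- used by `R`; half of `U` stays free.
      large : ∀ (e q : Fin n → Bool) → N + 2 * r ≤ 2 * ∑ (λ i → ⟦ e i ⟧) → ∑ (λ i → ⟦ q i ⟧) ≤ r →
        N ≤ 2 * ∑ (λ i → ⟦ e i ∧ not (q i) ⟧)
      large e q h q≤ = +-cancelʳ-≤ (2 * r) N _ (begin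
        N + 2 * r ≤⟨ h ⟩
        2 * ∑ (λ i → ⟦ e i ⟧) ≤⟨ *-monoʳ-≤ 2 (∑-mono (λ i → pt (e i) (q i))) ⟩
        2 * ∑ (λ i → ⟦ e i ∧ not (q i) ⟧ + ⟦ q i ⟧) ≡⟨ cong (2 *_) (∑-distrib-+ (λ i → ⟦ e i ∧ not (q i) ⟧) _) ⟩
        2 * (∑ (λ i → ⟦ e i ∧ not (q i) ⟧) + ∑ (λ i → ⟦ q i ⟧)) ≡⟨ *-distribˡ-+ 2 (∑ (λ i → ⟦ e i ∧ not (q i) ⟧)) _ ⟩
        2 * ∑ (λ i → ⟦ e i ∧ not (q i) ⟧) + 2 * ∑ (λ i → ⟦ q i ⟧) ≤⟨ +-monoʳ-≤ (2 * ∑ (λ i → ⟦ e i ∧ not (q i) ⟧)) (*-monoʳ-≤ 2 q≤) ⟩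
        2 * ∑ (λ i → ⟦ e i ∧ not (q i) ⟧) + 2 * r ∎)
        where
        open ≤-Reasoning
        pt : ∀ a b → ⟦ a ⟧ ≤ ⟦ a ∧ not b ⟧ + ⟦ b ⟧
        pt true true = ≤-refl
        pt true false = ≤-refl
        pt false b = z≤n

      ∧-split : ∀ {a b} → a ∧ not b ≡ true → a ≡ true × b ≡ false
      ∧-split {true} {false} _ = refl , refl

      saturated : ∀ (A : Fin n → Bool) (f : Fin n → ℕ) → (∀ a → A a ≡ true → r ≤ f a) →
        r * ∑ (λ a → ⟦ A a ⟧) ≤ ∑ (λ a → ⟦ A a ⟧ * f a)
      saturated A f h = subst (_≤ ∑ (λ a → ⟦ A a ⟧ * f a)) (∑-*ˡ r (λ a → ⟦ A a ⟧)) (∑-mono pt)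
        where
        pt : ∀ a → r * ⟦ A a ⟧ ≤ ⟦ A a ⟧ * f a
        pt a with A a in eq
        ... | true = subst₂ _≤_ (sym (*-identityʳ r)) (sym (+-identityʳ (f a))) (h a eq)
        ... | false = ≤-reflexive (*-zeroʳ r)

      -- |A| + |B| ≥ N, while every row in A and every column in B carries r edges of R, which has fewer
      -- than rN edges: some edge is counted twice.
      crossing : ∀ (A B : Fin n → Bool) (R : Matrix) → edges R < r * N →
        N ≤ 2 * ∑ (λ a → ⟦ A a ⟧) → N ≤ 2 * ∑ (λ b → ⟦ B b ⟧) →
        (∀ a → A a ≡ true → r ≤ row R a) → (∀ b → B b ≡ true → r ≤ col R b) →
        ∃ λ a → ∃ λ b → A a ≡ true × B b ≡ true × R a b ≡ true
      crossing A B R lt hA hB fA fB = find (∑<∑⇒∃ outer)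
        where
        wt : Fin n → Fin n → ℕ
        wt a b = ⟦ A a ⟧ * ⟦ R a b ⟧ + ⟦ B b ⟧ * ⟦ R a b ⟧
        weigh : ∑ (λ a → ∑ (wt a)) ≡ ∑ (λ a → ⟦ A a ⟧ * row R a) + ∑ (λ b → ⟦ B b ⟧ * col R b)
        weigh = begin
          ∑ (λ a → ∑ (wt a)) ≡⟨ sum-cong-≗ (λ a → ∑-distrib-+ (λ b → ⟦ A a ⟧ * ⟦ R a b ⟧) _) ⟩
          ∑ (λ a → ∑ (λ b → ⟦ A a ⟧ * ⟦ R a b ⟧) + ∑ (λ b → ⟦ B b ⟧ * ⟦ R a b ⟧)) ≡⟨ ∑-distrib-+ (λ a → ∑ (λ b → ⟦ A a ⟧ * ⟦ R a b ⟧)) _ ⟩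
          ∑ (λ a → ∑ (λ b → ⟦ A a ⟧ * ⟦ R a b ⟧)) + ∑ (λ a → ∑ (λ b → ⟦ B b ⟧ * ⟦ R a b ⟧))
            ≡⟨ cong₂ _+_ (sum-cong-≗ (λ a → ∑-*ˡ ⟦ A a ⟧ (λ b → ⟦ R a b ⟧)))
                         (trans (∑-comm (λ a b → ⟦ B b ⟧ * ⟦ R a b ⟧)) (sum-cong-≗ (λ b → ∑-*ˡ ⟦ B b ⟧ (λ a → ⟦ R a b ⟧)))) ⟩
          ∑ (λ a → ⟦ A a ⟧ * row R a) + ∑ (λ b → ⟦ B b ⟧ * col R b) ∎
          where open ≡-Reasoning
        both : N ≤ ∑ (λ a → ⟦ A a ⟧) + ∑ (λ b → ⟦ B b ⟧)
        both = *-cancelˡ-≤ 2 (subst₂ _≤_ (lem N) (sym (*-distribˡ-+ 2 (∑ (λ a → ⟦ A a ⟧)) _)) (+-mono-≤ hA hB))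
          where
          lem : ∀ x → x + x ≡ 2 * x
          lem = solve-∀
        outer : edges R < ∑ (λ a → ∑ (wt a))
        outer = begin-strict
          edges R <⟨ lt ⟩
          r * N ≤⟨ *-monoʳ-≤ r both ⟩
          r * (∑ (λ a → ⟦ A a ⟧) + ∑ (λ b → ⟦ B b ⟧)) ≡⟨ *-distribˡ-+ r (∑ (λ a → ⟦ A a ⟧)) _ ⟩
          r * ∑ (λ a → ⟦ A a ⟧) + r * ∑ (λ b → ⟦ B b ⟧) ≤⟨ +-mono-≤ (saturated A (row R) fA) (saturated B (col R) fB) ⟩
          ∑ (λ a → ⟦ A a ⟧ * row R a) + ∑ (λ b → ⟦ B b ⟧ * col R b) ≡⟨ sym weigh ⟩
          ∑ (λ a → ∑ (wt a)) ∎
          where open ≤-Reasoning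
        find : (∃ λ a → row R a < ∑ (wt a)) → _
        find (a , lt′) with ∑<∑⇒∃ lt′
        ... | b , q = a , b , dec (A a) (B b) (R a b) q
          where
          dec : ∀ x y z → ⟦ z ⟧ < ⟦ x ⟧ * ⟦ z ⟧ + ⟦ y ⟧ * ⟦ z ⟧ → x ≡ true × y ≡ true × z ≡ true
          dec true true true _ = refl , refl , refl
          dec true false true (s≤s ())
          dec false true true (s≤s ())
          dec true true false ()
          dec true false false ()
          dec false true false ()
          dec false false false ()

      -- An alternating path with at most three edges always suffices. If no free neighbour of a
      -- deficient row `u` or column `w` is itself deficient, `crossing` gives an edge (a , b) of
      -- `R` between the free neighbours of `w` and those of `u`. Trading it for (u , b) and (a , w)
      -- leaves the degrees of `a` and `b` alone and raises those of `u` and `w`.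
      augment : ∀ R → Sub R → edges R < r * N → Σ Matrix λ R′ → Sub R′ × edges R′ ≡ suc (edges R)
      augment R s@(R⊆ , r≤ , c≤) lt
        with deficient (row R) lt | deficient (col R) (subst (_< r * N) (edges-col R) lt)
      ... | u , Uu , ru | w , Uw , cw
        with any? (λ b → ((E u b ∧ not (R u b)) B.≟ true) ×-dec (col R b <? r))
      ... | yes (b , e , cb) = add s (proj₁ (∧-split e)) (proj₂ (∧-split e)) ru cb
      ... | no ¬b with any? (λ a → ((E a w ∧ not (R a w)) B.≟ true) ×-dec (row R a <? r))
      ...   | yes (a , e , ra) = add s (proj₁ (∧-split e)) (proj₂ (∧-split e)) ra cw
      ...   | no ¬a with crossing (λ a → E a w ∧ not (R a w)) (λ b → E u b ∧ not (R u b)) R lt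
                         (large (λ a → E a w) (λ a → R a w) (colE w Uw) (c≤ w))
                         (large (E u) (R u) (rowE u Uu) (r≤ u))
                         (λ a e → ≮⇒≥ (λ q → ¬a (a , e , q)))
                         (λ b e → ≮⇒≥ (λ q → ¬b (b , e , q)))
      ...     | a , b , Aa , Bb , Rab =
                exchange s (proj₁ (∧-split Bb)) (proj₂ (∧-split Bb)) (proj₁ (∧-split Aa)) (proj₂ (∧-split Aa)) Rab ru cw
                  (λ { refl → ¬a (a , Aa , ru) })

      saturate : ∀ fuel R → Sub R → r * N ≤ fuel + edges R → Σ Matrix λ R′ → Sub R′ × r * N ≤ edges R′
      saturate zero R s le = R , s , le
      saturate (suc fuel) R s le with edges R <? r * N
      ... | no ≥ = R , s , ≮⇒≥ ≥
      ... | yes lt with augment R s lt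
      ...   | R′ , s′ , eq = saturate fuel R′ s′ (subst (r * N ≤_) (trans (sym (+-suc fuel (edges R))) (cong (fuel +_) (sym eq))) le)

      -- `r * N` is the largest possible total, so a single value below `r` would make the total too
      -- small.
      tight : ∀ (f : Fin n → ℕ) → (∀ u → f u ≤ r) → (∀ u → U u ≡ false → f u ≡ 0) → r * N ≤ ∑ f →
        ∀ u → U u ≡ true → f u ≡ r
      tight f f≤ f0 le u Uu with f u ≟ r
      ... | yes eq = eq
      ... | no ne = contradiction le (<⇒≱ strict)
        where
        fu<r : f u < r
        fu<r = ≤∧≢⇒< (f≤ u) ne
        pt : ∀ i → f i + ⟦ δ u i ⟧ ≤ r * ⟦ U i ⟧
        pt i with u F.≟ i
        ... | yes refl rewrite Uu = subst₂ _≤_ (+-comm 1 (f u)) (sym (*-identityʳ r)) fu<r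
        ... | no _ with U i in eq
        ...   | true = subst₂ _≤_ (sym (+-identityʳ (f i))) (sym (*-identityʳ r)) (f≤ i)
        ...   | false rewrite f0 i eq = z≤n
        strict : ∑ f < r * N
        strict = begin-strict
          ∑ f <⟨ n<1+n (∑ f) ⟩
          suc (∑ f) ≡⟨ sym (∑-bump u f (λ i → f i + ⟦ δ u i ⟧) (λ _ → refl)) ⟩
          ∑ (λ i → f i + ⟦ δ u i ⟧) ≤⟨ ∑-mono pt ⟩
          ∑ (λ i → r * ⟦ U i ⟧) ≡⟨ ∑-*ˡ r (λ i → ⟦ U i ⟧) ⟩
          r * N ∎
          where open ≤-Reasoning

      regular-factor : Σ Matrix λ R → R ⊆ᴹ E ×
        (∀ u → U u ≡ true → row R u ≡ r) × (∀ w → U w ≡ true → col R w ≡ r)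
      regular-factor with saturate (r * N) (λ _ _ → false)
                            ((λ _ _ ()) , (λ _ → subst (_≤ r) (sym (∑-zero {n})) z≤n) , (λ _ → subst (_≤ r) (sym (∑-zero {n})) z≤n))
                            (m≤m+n (r * N) _)
      ... | R , (R⊆ , r≤ , c≤) , le = R , R⊆
        , tight (row R) r≤ (λ u Uu → trans (sum-cong-≗ (λ w → ⟦⟧≡0 (λ p → true≢false (proj₁ (E⊆U u w (R⊆ u w p))) Uu))) (∑-zero {n})) le
        , tight (col R) c≤ (λ w Uw → trans (sum-cong-≗ (λ u → ⟦⟧≡0 (λ p → true≢false (proj₂ (E⊆U u w (R⊆ u w p))) Uw))) (∑-zero {n}))
            (subst (r * N ≤_) (edges-col R) le)

  -- Forests and the embedding of small trees

  ∈⇒mult : ∀ {n} {u : Fin n} (L : List (Fin n)) → u ∈ L → 1 ≤ mult L u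
  ∈⇒mult {u = u} (_ ∷ L) (here refl) rewrite δ-refl u = s≤s z≤n
  ∈⇒mult (l ∷ L) (there p) = ≤-trans (∈⇒mult L p) (m≤n+m _ _)

  -- Markov: fewer than a 1/(θ+1) share of S is used up, while at least that share is within a factor
  -- (θ+1)/θ of the average of F over S.
  cheap-spot : ∀ {n} θ (S : Fin n → Bool) (F : Fin n → ℕ) (used : List (Fin n)) σ →
    ∑ (λ u → ⟦ S u ⟧) ≡ σ → suc θ * length used < σ →
    ∃ λ u → S u ≡ true × u ∉ used × σ * θ * F u ≤ suc θ * ∑ (λ u → ⟦ S u ⟧ * F u)
  cheap-spot {n} θ S F used σ Sσ lt = go (∑<∑⇒∃ sums)
    where
    ΣF = ∑ (λ u → ⟦ S u ⟧ * F u)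
    V = suc (suc θ * ΣF)
    f g : Fin n → ℕ
    f u = ⟦ S u ⟧ * F u * (σ * θ) + mult used u * V
    g u = ⟦ S u ⟧ * V
    sums : ∑ f < ∑ g
    sums = begin-strict
      ∑ f ≡⟨ ∑-distrib-+ (λ u → ⟦ S u ⟧ * F u * (σ * θ)) _ ⟩
      ∑ (λ u → ⟦ S u ⟧ * F u * (σ * θ)) + ∑ (λ u → mult used u * V)
        ≡⟨ cong₂ _+_ (∑-*ʳ (σ * θ) (λ u → ⟦ S u ⟧ * F u)) (trans (∑-*ʳ V (mult used)) (cong (_* V) (∑-mult used))) ⟩
      ΣF * (σ * θ) + length used * V ≡⟨ lem₁ ΣF σ θ (length used) ⟩
      σ * θ * ΣF + (length used + (suc θ * length used) * ΣF) <⟨ +-monoʳ-< (σ * θ * ΣF)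
          (+-mono-<-≤ (≤-<-trans (m≤m+n _ _) lt) (*-monoˡ-≤ ΣF (<⇒≤ lt))) ⟩
      σ * θ * ΣF + (σ + σ * ΣF) ≡⟨ lem₂ σ θ ΣF ⟩
      σ * V ≡⟨ cong (_* V) (sym Sσ) ⟩
      ∑ (λ u → ⟦ S u ⟧) * V ≡⟨ sym (∑-*ʳ V (λ u → ⟦ S u ⟧)) ⟩
      ∑ g ∎
      where
      open ≤-Reasoning
      lem₁ : ∀ ΣF σ θ l → ΣF * (σ * θ) + l * suc (suc θ * ΣF) ≡ σ * θ * ΣF + (l + (suc θ * l) * ΣF)
      lem₁ = solve-∀
      lem₂ : ∀ σ θ ΣF → σ * θ * ΣF + (σ + σ * ΣF) ≡ σ * suc (suc θ * ΣF)
      lem₂ = solve-∀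
    go : (∃ λ u → f u < g u) → _
    go (u , q) with S u in Su
    ... | false = contradiction q λ ()
    ... | true = u , Su , not-used , ≤-pred (begin-strict
        σ * θ * F u ≡⟨ lem σ θ (F u) ⟩
        1 * F u * (σ * θ) ≤⟨ m≤m+n _ _ ⟩
        1 * F u * (σ * θ) + mult used u * V <⟨ q ⟩
        1 * V ≡⟨ +-identityʳ V ⟩
        V ∎)
      where
      open ≤-Reasoning
      lem : ∀ s t x → s * t * x ≡ 1 * x * (s * t)
      lem = solve-∀
      not-used : u ∉ used
      not-used u∈ = <⇒≱ q (begin
        1 * V ≤⟨ *-monoˡ-≤ V (∈⇒mult used u∈) ⟩
        mult used u * V ≤⟨ m≤n+m _ _ ⟩
        1 * F u * (σ * θ) + mult used u * V ∎)

  -- First-child/next-sibling encoding of the trees hanging from a common parent. The first flag is the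
  -- direction of the edge to the parent (true: away from it), the second marks the roots at which the
  -- embedding is interrupted.
  data Forest (A : Set) : Set where
    ∅  : Forest A
    br : (dir cut : Bool) (label : A) (children siblings : Forest A) → Forest A

  module _ {A : Set} where

    size residual cuts width : Forest A → ℕ
    size ∅ = 0
    size (br _ _ _ ch sib) = suc (size ch + size sib)
    residual ∅ = 0
    residual (br _ true _ ch sib) = residual sib
    residual (br _ false _ ch sib) = suc (residual ch + residual sib)
    cuts ∅ = 0
    cuts (br _ true _ ch sib) = suc (cuts ch + cuts sib)
    cuts (br _ false _ ch sib) = cuts ch + cuts sib
    width ∅ = 0
    width (br _ _ _ ch sib) = suc (width sib)

    -- The bound `h` does double duty: as a bound on the uncut vertices below each root it is also a
    -- bound on the depth, which is what the recursion of `cc` along the random walk needs.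
    Light : ℕ → Forest A → Set
    Light h ∅ = ⊤
    Light h (br _ true _ ch sib) = Light h sib
    Light h (br _ false _ ch sib) = residual ch ≤ h × Light h sib

    Light-residual : ∀ {h} X → residual X ≤ suc h → Light h X
    Light-residual ∅ le = tt
    Light-residual (br _ true _ ch sib) le = Light-residual sib le
    Light-residual (br _ false _ ch sib) (s≤s le) =
      ≤-trans (m≤m+n _ _) le , Light-residual sib (≤-trans (≤-trans (m≤n+m _ _) le) (n≤1+n _))

    -- Each root drops out of its own count, so the bound falls by one from level to level. For `h`
    -- = 0 nothing uncut is left and any bound holds.
    Light-pred : ∀ h X → residual X ≤ h → Light (pred h) X
    Light-pred zero X le = Light-residual X (≤-trans le z≤n)
    Light-pred (suc h) X le = Light-residual X le

    Good : ℕ → ℕ → Forest A → Set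
    Good K Δ ∅ = ⊤
    Good K Δ (br _ c _ ch sib) = (c ≡ false → residual ch ≤ K) × width ch ≤ Δ × Good K Δ ch × Good K Δ sib

    Good-Light : ∀ {K Δ} X → Good K Δ X → Light K X
    Good-Light ∅ _ = tt
    Good-Light (br _ true _ ch sib) (_ , _ , _ , gs) = Good-Light sib gs
    Good-Light (br _ false _ ch sib) (k , _ , _ , gs) = k refl , Good-Light sib gs

    Light-bound : ∀ {K} X → Light K X → residual X ≤ suc K * width X
    Light-bound ∅ _ = z≤n
    Light-bound {K} (br _ true _ ch sib) ls =
      ≤-trans (Light-bound sib ls) (*-monoʳ-≤ (suc K) (n≤1+n (width sib)))
    Light-bound {K} (br _ false _ ch sib) (l , ls) =
      subst (suc (residual ch + residual sib) ≤_) (sym (*-suc (suc K) (width sib)))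
        (s≤s (+-mono-≤ l (Light-bound sib ls)))

  -- Partial embeddings and the random walk along the regular factor.

  module Placing {A : Set} {n : ℕ} (Adj : Bool → Fin n → Fin n → Set) where

    -- A tree waiting to be embedded, whose parent already sits at the vertex `parent`.
    record Item : Set where
      constructor item
      field
        dir      : Bool
        parent   : Fin n
        label    : A
        children : Forest A

    sizeᴵ cutsᴵ : List Item → ℕ
    sizeᴵ [] = 0
    sizeᴵ (i ∷ Q) = suc (size (Item.children i)) + sizeᴵ Q
    cutsᴵ [] = 0
    cutsᴵ (i ∷ Q) = suc (cuts (Item.children i)) + cutsᴵ Q

    sizeᴵ-++ : ∀ Q Q′ → sizeᴵ (Q ++ Q′) ≡ sizeᴵ Q + sizeᴵ Q′
    sizeᴵ-++ [] Q′ = refl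
    sizeᴵ-++ (i ∷ Q) Q′ = trans (cong (suc (size (Item.children i)) +_) (sizeᴵ-++ Q Q′)) (sym (+-assoc (suc (size (Item.children i))) (sizeᴵ Q) _))

    cutsᴵ-++ : ∀ Q Q′ → cutsᴵ (Q ++ Q′) ≡ cutsᴵ Q + cutsᴵ Q′
    cutsᴵ-++ [] Q′ = refl
    cutsᴵ-++ (i ∷ Q) Q′ = trans (cong (suc (cuts (Item.children i)) +_) (cutsᴵ-++ Q Q′)) (sym (+-assoc (suc (cuts (Item.children i))) (cutsᴵ Q) _))

    Goodᴵ : ℕ → ℕ → Item → Set
    Goodᴵ K Δ i = width (Item.children i) ≤ Δ × Good K Δ (Item.children i)

    Assignment : Set
    Assignment = List (A × Fin n)

    locs : Assignment → List (Fin n)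
    locs = map proj₂

    -- The assignment is treated as a relation throughout; that it is the graph of a function comes
    -- out only at the end, by counting its entries.
    Sat : Assignment → Fin n → Forest A → Set
    Sat P u ∅ = ⊤
    Sat P u (br d _ w ch sib) = (∃ λ u′ → (w , u′) ∈ P × Adj d u u′ × Sat P u′ ch) × Sat P u sib

    Satᴵ : Assignment → Item → Set
    Satᴵ P (item d u w ch) = ∃ λ u′ → (w , u′) ∈ P × Adj d u u′ × Sat P u′ ch

    Sat-mono : ∀ {P P′ u} X → (∀ {x} → x ∈ P → x ∈ P′) → Sat P u X → Sat P′ u X
    Sat-mono ∅ s _ = tt
    Sat-mono (br d _ w ch sib) s ((u′ , m , a , c) , r) = (u′ , s m , a , Sat-mono ch s c) , Sat-mono sib s r

    Satᴵ-mono : ∀ {P P′} i → (∀ {x} → x ∈ P → x ∈ P′) → Satᴵ P i → Satᴵ P′ i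
    Satᴵ-mono i s (u′ , m , a , c) = u′ , s m , a , Sat-mono (Item.children i) s c

    -- `P` places the uncut vertices reachable from the top, and `Q` collects the trees below that
    -- begin with a cut root. Since these are embedded later, `sat` is a promise for every extension
    -- `P′` of `P` that also takes care of `Q`.
    record Placed (K Δ : ℕ) (U : Fin n → Bool) (X : Forest A) (u : Fin n) (used : List (Fin n)) : Set where
      field
        P : Assignment
        Q : List Item
        unique : Unique (locs P)
        fresh : ∀ {x} → x ∈ locs P → x ∉ used × U x ≡ true
        lengthP : length P ≡ residual X
        sizeQ : sizeᴵ Q + residual X ≡ size X
        cutsQ : cutsᴵ Q ≡ cuts X
        goodQ : All (Goodᴵ K Δ) Q
        sat : ∀ P′ → (∀ {x} → x ∈ P → x ∈ P′) → All (Satᴵ P′) Q → Sat P′ u X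

    module Light-part (K Δ : ℕ) (U : Fin n → Bool) (R : Bool → Fin n → Fin n → Bool) (r θ : ℕ) (g : Fin n → ℕ)
      (R-adj : ∀ d u w → R d u w ≡ true → Adj d u w × U w ≡ true)
      (R-row : ∀ d u → U u ≡ true → ∑ (λ w → ⟦ R d u w ⟧) ≡ r)
      (R-col : ∀ d w → ∑ (λ u → ⟦ R d u w ⟧) ≤ r * ⟦ U w ⟧)
      where

      open Placed

      same : Bool → Bool → ℕ
      same true true = 1
      same false false = 1
      same _ _ = 0

      -- rʰ times the expected cost, under the random walk along R, of the residual trees of X hung in
      -- direction d from one parent when their roots sit at u (fc), or when that parent sits at u (cc).
      fc : ℕ → Bool → Forest A → Fin n → ℕ
      cc : ℕ → Forest A → Fin n → ℕ
      fc h d ∅ u = 0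
      fc h d (br d′ true w ch sib) u = fc h d sib u
      fc h d (br d′ false w ch sib) u = same d d′ * (r ^ h * g u + cc h ch u) + fc h d sib u
      cc zero X u = 0
      cc (suc h) X u = ∑ (λ w → ⟦ R true u w ⟧ * fc h true X w) + ∑ (λ w → ⟦ R false u w ⟧ * fc h false X w)

      total : ℕ → Forest A → (Bool → Fin n → Bool) → ℕ
      total h X S = ∑ (λ w → ⟦ S true w ⟧ * fc h true X w) + ∑ (λ w → ⟦ S false w ⟧ * fc h false X w)

      total-light : ∀ h d w ch sib S → total h (br d false w ch sib) S
        ≡ ∑ (λ u → ⟦ S d u ⟧ * (r ^ h * g u + cc h ch u)) + total h sib S
      total-light h d w ch sib S = trans (cong₂ _+_ (part true) (part false))
        (trans (select d (sums true) (sums false) (∑ (λ u → ⟦ S true u ⟧ * fc h true sib u)) _) (cong (_+ total h sib S) (chosen d)))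
        where
        f = λ u → r ^ h * g u + cc h ch u
        sums : Bool → ℕ
        sums e = ∑ (λ u → ⟦ S e u ⟧ * f u)
        part : ∀ e → ∑ (λ u → ⟦ S e u ⟧ * (same e d * f u + fc h e sib u)) ≡ same e d * sums e + ∑ (λ u → ⟦ S e u ⟧ * fc h e sib u)
        part e = trans (sum-cong-≗ (λ u → lem ⟦ S e u ⟧ (same e d) (f u) (fc h e sib u)))
          (trans (∑-distrib-+ (λ u → same e d * (⟦ S e u ⟧ * f u)) _) (cong (_+ _) (∑-*ˡ (same e d) (λ u → ⟦ S e u ⟧ * f u))))
          where
          lem : ∀ a s b c → a * (s * b + c) ≡ s * (a * b) + a * c
          lem = solve-∀
        chosen : ∀ d → (if d then sums true else sums false) ≡ sums d
        chosen true = refl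
        chosen false = refl
        select : ∀ d a b x y → same true d * a + x + (same false d * b + y) ≡ (if d then a else b) + (x + y)
        select true a b x y = trans (cong (λ z → z + x + y) (+-identityʳ a)) (+-assoc a x y)
        select false a b x y = trans (cong (λ z → x + (z + y)) (+-identityʳ b)) (lem x b y)
          where
          lem : ∀ x b y → x + (b + y) ≡ b + (x + y)
          lem = solve-∀

      G : ℕ
      G = ∑ (λ u → ⟦ U u ⟧ * g u)

      -- Column sums of `R` are at most `r`, so a step of the walk from the uniform distribution on
      -- `U` stays uniform. Each uncut vertex therefore contributes `G`, multiplied by the `r ^ h`
      -- possible walks. There is only an inequality because vertices deeper than `h` levels are
      -- dropped.
      total-residual : ∀ h X → total h X (λ _ → U) ≤ r ^ h * residual X * G
      cc-residual : ∀ h X → ∑ (λ u → ⟦ U u ⟧ * cc h X u) ≤ r ^ h * residual X * G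
      total-residual h ∅ = ≤-trans (≤-reflexive (cong₂ _+_ z z)) z≤n
        where
        z : ∑ (λ u → ⟦ U u ⟧ * 0) ≡ 0
        z = trans (sum-cong-≗ (λ u → *-zeroʳ ⟦ U u ⟧)) (∑-zero {n})
      total-residual h (br d true w ch sib) = total-residual h sib
      total-residual h (br d false w ch sib) = begin
        total h (br d false w ch sib) (λ _ → U) ≡⟨ total-light h d w ch sib (λ _ → U) ⟩
        ∑ (λ u → ⟦ U u ⟧ * (r ^ h * g u + cc h ch u)) + total h sib (λ _ → U)
          ≡⟨ cong (_+ total h sib (λ _ → U)) (trans (sum-cong-≗ (λ u → lem ⟦ U u ⟧ (r ^ h) (g u) (cc h ch u)))
               (∑-distrib-+ (λ u → r ^ h * (⟦ U u ⟧ * g u)) _)) ⟩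
        ∑ (λ u → r ^ h * (⟦ U u ⟧ * g u)) + ∑ (λ u → ⟦ U u ⟧ * cc h ch u) + total h sib (λ _ → U)
          ≡⟨ cong (λ z → z + ∑ (λ u → ⟦ U u ⟧ * cc h ch u) + total h sib (λ _ → U)) (∑-*ˡ (r ^ h) (λ u → ⟦ U u ⟧ * g u)) ⟩
        r ^ h * G + ∑ (λ u → ⟦ U u ⟧ * cc h ch u) + total h sib (λ _ → U)
          ≤⟨ +-mono-≤ (+-monoʳ-≤ (r ^ h * G) (cc-residual h ch)) (total-residual h sib) ⟩
        r ^ h * G + r ^ h * residual ch * G + r ^ h * residual sib * G ≡⟨ lem′ (r ^ h) G (residual ch) (residual sib) ⟩
        r ^ h * suc (residual ch + residual sib) * G ∎
        where
        open ≤-Reasoning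
        lem : ∀ a b c e → a * (b * c + e) ≡ b * (a * c) + a * e
        lem = solve-∀
        lem′ : ∀ a G x y → a * G + a * x * G + a * y * G ≡ a * suc (x + y) * G
        lem′ = solve-∀
      cc-residual zero X = ≤-trans (≤-reflexive (trans (sum-cong-≗ (λ u → *-zeroʳ ⟦ U u ⟧)) (∑-zero {n}))) z≤n
      cc-residual (suc h) X = begin
        ∑ (λ u → ⟦ U u ⟧ * cc (suc h) X u) ≤⟨ ∑-mono (λ u → *-monoˡ-≤ (cc (suc h) X u) (⟦⟧≤1 (U u))) ⟩
        ∑ (λ u → 1 * cc (suc h) X u) ≡⟨ sum-cong-≗ (λ u → *-identityˡ (cc (suc h) X u)) ⟩
        ∑ (cc (suc h) X) ≡⟨ ∑-distrib-+ (λ u → ∑ (λ w → ⟦ R true u w ⟧ * fc h true X w)) _ ⟩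
        ∑ (λ u → ∑ (λ w → ⟦ R true u w ⟧ * fc h true X w)) + ∑ (λ u → ∑ (λ w → ⟦ R false u w ⟧ * fc h false X w))
          ≤⟨ +-mono-≤ (swapped true) (swapped false) ⟩
        r * ∑ (λ w → ⟦ U w ⟧ * fc h true X w) + r * ∑ (λ w → ⟦ U w ⟧ * fc h false X w)
          ≡⟨ sym (*-distribˡ-+ r (∑ (λ w → ⟦ U w ⟧ * fc h true X w)) _) ⟩
        r * total h X (λ _ → U) ≤⟨ *-monoʳ-≤ r (total-residual h X) ⟩
        r * (r ^ h * residual X * G) ≡⟨ lem r (r ^ h) (residual X) G ⟩
        r ^ suc h * residual X * G ∎
        where
        open ≤-Reasoning
        lem : ∀ r a x G → r * (a * x * G) ≡ r * a * x * G
        lem = solve-∀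
        swapped : ∀ d → ∑ (λ u → ∑ (λ w → ⟦ R d u w ⟧ * fc h d X w)) ≤ r * ∑ (λ w → ⟦ U w ⟧ * fc h d X w)
        swapped d = begin
          ∑ (λ u → ∑ (λ w → ⟦ R d u w ⟧ * fc h d X w)) ≡⟨ ∑-comm (λ u w → ⟦ R d u w ⟧ * fc h d X w) ⟩
          ∑ (λ w → ∑ (λ u → ⟦ R d u w ⟧ * fc h d X w)) ≡⟨ sum-cong-≗ (λ w → ∑-*ʳ (fc h d X w) (λ u → ⟦ R d u w ⟧)) ⟩
          ∑ (λ w → ∑ (λ u → ⟦ R d u w ⟧) * fc h d X w) ≤⟨ ∑-mono (λ w → *-monoˡ-≤ (fc h d X w) (R-col d w)) ⟩
          ∑ (λ w → r * ⟦ U w ⟧ * fc h d X w) ≡⟨ sum-cong-≗ (λ w → *-assoc r ⟦ U w ⟧ _) ⟩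
          ∑ (λ w → r * (⟦ U w ⟧ * fc h d X w)) ≡⟨ ∑-*ˡ r (λ w → ⟦ U w ⟧ * fc h d X w) ⟩
          r * ∑ (λ w → ⟦ U w ⟧ * fc h d X w) ∎

      cost : Assignment → ℕ
      cost P = sum (map (λ p → g (proj₂ p)) P)

      cost-++ : ∀ P P′ → cost (P ++ P′) ≡ cost P + cost P′
      cost-++ P P′ = trans (cong sum (map-++ (λ p → g (proj₂ p)) P P′)) (sum-++ (map (λ p → g (proj₂ p)) P) _)

      join : ∀ {d w ch sib u u′ used} → Adj d u u′ → U u′ ≡ true → u′ ∉ used →
        (p : Placed K Δ U ch u′ (u′ ∷ used)) → Placed K Δ U sib u (locs (P p) ++ u′ ∷ used) →
        Placed K Δ U (br d false w ch sib) u used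
      join {d} {w} {ch} {sib} {u} {u′} {used} a Uu′ u′∉ p q = record
        { P = (w , u′) ∷ P p ++ P q
        ; Q = Q p ++ Q q
        ; unique = AllP.¬Any⇒All¬ _ u′-fresh ∷ subst Unique (sym map-eq) (UniqP.++⁺ (unique p) (unique q)
            (λ (x∈p , x∈q) → proj₁ (fresh q x∈q) (∈-++⁺ˡ x∈p)))
        ; fresh = λ { (here refl) → u′∉ , Uu′ ; (there x∈) → fresh′ (∈-++⁻ (locs (P p)) (subst (_ ∈_) map-eq x∈)) }
        ; lengthP = cong suc (trans (length-++ (P p)) (cong₂ _+_ (lengthP p) (lengthP q)))
        ; sizeQ = sizes
        ; cutsQ = trans (cutsᴵ-++ (Q p) (Q q)) (cong₂ _+_ (cutsQ p) (cutsQ q))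
        ; goodQ = AllP.++⁺ (goodQ p) (goodQ q)
        ; sat = λ P′ s al → (u′ , s (here refl) , a , sat p P′ (s ∘ there ∘ ∈-++⁺ˡ) (AllP.++⁻ˡ (Q p) al))
                          , sat q P′ (s ∘ there ∘ ∈-++⁺ʳ (P p)) (AllP.++⁻ʳ (Q p) al)
        }
        where
        map-eq : locs (P p ++ P q) ≡ locs (P p) ++ locs (P q)
        map-eq = map-++ proj₂ (P p) (P q)
        split : ∀ {x} → x ∈ locs (P p) ⊎ x ∈ locs (P q) → x ≢ u′ × x ∉ used × U x ≡ true
        split (inj₁ i) = (λ e → proj₁ (fresh p i) (here e)) , (λ i′ → proj₁ (fresh p i) (there i′)) , proj₂ (fresh p i)
        split (inj₂ i) = (λ e → proj₁ (fresh q i) (∈-++⁺ʳ (locs (P p)) (here e)))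
                       , (λ i′ → proj₁ (fresh q i) (∈-++⁺ʳ (locs (P p)) (there i′))) , proj₂ (fresh q i)
        fresh′ : ∀ {x} → x ∈ locs (P p) ⊎ x ∈ locs (P q) → x ∉ used × U x ≡ true
        fresh′ i = proj₂ (split i)
        u′-fresh : u′ ∉ locs (P p ++ P q)
        u′-fresh i = proj₁ (split (∈-++⁻ (locs (P p)) (subst (u′ ∈_) map-eq i))) refl
        sizes : sizeᴵ (Q p ++ Q q) + suc (residual ch + residual sib) ≡ suc (size ch + size sib)
        sizes = begin
          sizeᴵ (Q p ++ Q q) + suc (residual ch + residual sib) ≡⟨ cong (_+ suc (residual ch + residual sib)) (sizeᴵ-++ (Q p) (Q q)) ⟩
          sizeᴵ (Q p) + sizeᴵ (Q q) + suc (residual ch + residual sib) ≡⟨ lem (sizeᴵ (Q p)) (sizeᴵ (Q q)) (residual ch) (residual sib) ⟩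
          suc ((sizeᴵ (Q p) + residual ch) + (sizeᴵ (Q q) + residual sib)) ≡⟨ cong suc (cong₂ _+_ (sizeQ p) (sizeQ q)) ⟩
          suc (size ch + size sib) ∎
          where
          open ≡-Reasoning
          lem : ∀ a b x y → a + b + suc (x + y) ≡ suc ((a + x) + (b + y))
          lem = solve-∀

      room-child : ∀ {b u′} (used : List (Fin n)) (ch sib : Forest A) →
        suc θ * (length used + suc (residual ch + residual sib)) ≤ b → suc θ * (length (_∷_ {A = Fin n} u′ used) + residual ch) ≤ b
      room-child used ch sib = ≤-trans (*-monoʳ-≤ (suc θ) (≤-trans (≤-reflexive (sym (+-suc (length used) (residual ch))))
        (+-monoʳ-≤ (length used) (s≤s (m≤m+n (residual ch) (residual sib))))))

      room-sib : ∀ {b ch u′} (used : List (Fin n)) (sib : Forest A) (p : Placed K Δ U ch u′ (u′ ∷ used)) →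
        suc θ * (length used + suc (residual ch + residual sib)) ≤ b →
        suc θ * (length (locs (P p) ++ u′ ∷ used) + residual sib) ≤ b
      room-sib {b} {ch} used sib p = subst (λ z → suc θ * z ≤ b) (sym (trans (cong (_+ residual sib) (trans (length-++ (locs (P p)))
        (cong (_+ suc (length used)) (trans (length-map proj₂ (P p)) (lengthP p))))) (lem (residual ch) (length used) (residual sib))))
        where
        lem : ∀ x l y → x + suc l + y ≡ l + suc (x + y)
        lem = solve-∀

      -- The method of conditional expectations. `cheap-spot` is applied to the price of a vertex
      -- plus the expected cost of all that hangs below it, so it loses a factor (θ+1)/θ once per
      -- level and not once per vertex. One level down the candidates become the `r` neighbours in
      -- `R`, and the expected cost below `u′` is by definition the `total` for these. The two size
      -- conditions keep the used vertices a small enough share of the candidates, at the top level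
      -- and below it.
      place : ∀ h X u S σ used → (∀ d → ∑ (λ w → ⟦ S d w ⟧) ≡ σ) →
        (∀ d w → S d w ≡ true → Adj d u w × U w ≡ true) → Light h X → Good K Δ X →
        suc θ * (length used + residual X) ≤ σ → suc θ * (length used + residual X) ≤ r →
        Σ (Placed K Δ U X u used) λ p → cost (P p) * (θ ^ suc h * r ^ h * σ) ≤ suc θ ^ suc h * total h X S
      place h ∅ u S σ used Sσ Sadj li go bσ br′ = record
        { P = [] ; Q = [] ; unique = [] ; fresh = λ () ; lengthP = refl ; sizeQ = refl ; cutsQ = refl
        ; goodQ = [] ; sat = λ _ _ _ → tt } , z≤n
      place h (br d true w ch sib) u S σ used Sσ Sadj li (_ , wi , gc , gs) bσ br′
        with place h sib u S σ used Sσ Sadj li gs bσ br′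
      ... | p , c = record
        { P = P p ; Q = item d u w ch ∷ Q p ; unique = unique p ; fresh = fresh p ; lengthP = lengthP p
        ; sizeQ = cong suc (trans (+-assoc (size ch) _ _) (cong (size ch +_) (sizeQ p)))
        ; cutsQ = cong (λ z → suc (cuts ch + z)) (cutsQ p)
        ; goodQ = (wi , gc) ∷ goodQ p
        ; sat = λ { P′ s (si ∷ al) → si , sat p P′ s al } } , c
      place h (br d false w ch sib) u S σ used Sσ Sadj (lc , ls) (_ , _ , gc , gs) bσ br′
        with cheap-spot θ (S d) (λ u → r ^ h * g u + cc h ch u) used σ (Sσ d)
               (<-≤-trans (*-monoʳ-< (suc θ) (m<m+n (length used) (s≤s z≤n))) bσ)
      ... | u′ , Su′ , u′∉ , cheap
        with place (pred h) ch u′ (λ d → R d u′) r (u′ ∷ used) (λ e → R-row e u′ (proj₂ (Sadj d u′ Su′)))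
               (λ d → R-adj d u′) (Light-pred h ch lc) gc
               (room-child {u′ = u′} used ch sib br′) (room-child {u′ = u′} used ch sib br′)
      ... | p , cp
        with place h sib u S σ (locs (P p) ++ u′ ∷ used) Sσ Sadj ls gs
               (room-sib used sib p bσ) (room-sib used sib p br′)
      ... | q , cq = join (proj₁ (Sadj d u′ Su′)) (proj₂ (Sadj d u′ Su′)) u′∉ p q , (begin
        (g u′ + cost (P p ++ P q)) * (θ ^ suc h * r ^ h * σ)
          ≡⟨ cong (λ z → (g u′ + z) * (θ ^ suc h * r ^ h * σ)) (cost-++ (P p) (P q)) ⟩
        (g u′ + (cost (P p) + cost (P q))) * (θ ^ suc h * r ^ h * σ)
          ≡⟨ lem₁ (g u′) (cost (P p)) (cost (P q)) θ (θ ^ h) (r ^ h) σ ⟩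
        (g u′ * r ^ h * θ ^ h + cost (P p) * (θ ^ h * r ^ h)) * (σ * θ) + cost (P q) * (θ ^ suc h * r ^ h * σ)
          ≤⟨ +-mono-≤ (*-monoˡ-≤ (σ * θ) (+-mono-≤ (*-monoʳ-≤ (g u′ * r ^ h) (^-monoˡ-≤ h (n≤1+n θ))) (child h cp lc))) cq ⟩
        (g u′ * r ^ h * suc θ ^ h + suc θ ^ h * cc h ch u′) * (σ * θ) + suc θ ^ suc h * total h sib S
          ≡⟨ cong (_+ suc θ ^ suc h * total h sib S) (lem₂ (g u′) (r ^ h) (suc θ ^ h) (cc h ch u′) σ θ) ⟩
        suc θ ^ h * (σ * θ * (r ^ h * g u′ + cc h ch u′)) + suc θ ^ suc h * total h sib S
          ≤⟨ +-monoˡ-≤ _ (*-monoʳ-≤ (suc θ ^ h) cheap) ⟩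
        suc θ ^ h * (suc θ * ∑ (λ u → ⟦ S d u ⟧ * (r ^ h * g u + cc h ch u))) + suc θ ^ suc h * total h sib S
          ≡⟨ lem₃ (suc θ ^ h) (suc θ) (∑ (λ u → ⟦ S d u ⟧ * (r ^ h * g u + cc h ch u))) (total h sib S) ⟩
        suc θ ^ suc h * (∑ (λ u → ⟦ S d u ⟧ * (r ^ h * g u + cc h ch u)) + total h sib S)
          ≡⟨ cong (suc θ ^ suc h *_) (sym (total-light h d w ch sib S)) ⟩
        suc θ ^ suc h * total h (br d false w ch sib) S ∎)
        where
        open ≤-Reasoning
        lem₁ : ∀ a b c t th rh s → (a + (b + c)) * (t * th * rh * s) ≡ (a * rh * th + b * (th * rh)) * (s * t) + c * (t * th * rh * s)
        lem₁ = solve-∀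
        lem₂ : ∀ a rh th c s t → (a * rh * th + th * c) * (s * t) ≡ th * (s * t * (rh * a + c))
        lem₂ = solve-∀
        lem₃ : ∀ th t x y → th * (t * x) + t * th * y ≡ t * th * (x + y)
        lem₃ = solve-∀
        child : ∀ h → cost (P p) * (θ ^ suc (pred h) * r ^ pred h * r) ≤ suc θ ^ suc (pred h) * total (pred h) ch (λ d → R d u′) →
          residual ch ≤ h → cost (P p) * (θ ^ h * r ^ h) ≤ suc θ ^ h * cc h ch u′
        -- With `h` = 0 no uncut vertex lies below, so nothing was placed and the value 0 of
        -- `cc zero` is right.
        child zero _ l with P p | lengthP p
        ... | [] | _ = z≤n
        ... | _ ∷ _ | e = contradiction (subst (_≤ 0) (sym e) l) λ ()
        child (suc h) c _ = ≤-trans (≤-reflexive (lem (cost (P p)) θ (θ ^ h) (r ^ h) r)) c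
          where
          lem : ∀ c t th rh r → c * (t * th * (r * rh)) ≡ c * (t * th * rh * r)
          lem = solve-∀

  -- The root of a component

  card : ∀ {n} → (Fin n → Bool) → ℕ
  card S = ∑ (λ u → ⟦ S u ⟧)

  ∧-true : ∀ {a b} → a ∧ b ≡ true → a ≡ true × b ≡ true
  ∧-true {true} {true} _ = refl , refl

  <ᵇ-true : ∀ {x y} → (x <ᵇ y) ≡ true → x < y
  <ᵇ-true {x} {y} e = <ᵇ⇒< x y (subst T (sym e) tt)

  true-<ᵇ : ∀ {x y} → x < y → (x <ᵇ y) ≡ true
  true-<ᵇ {x} {y} lt with x <ᵇ y | <⇒<ᵇ lt
  ... | true | _ = refl

  false-<ᵇ : ∀ {x y} → (x <ᵇ y) ≡ false → y ≤ x
  false-<ᵇ {x} {y} e = ≮⇒≥ (λ lt → true≢false (true-<ᵇ lt) e)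

  trim : ∀ {n} (S : Fin n → Bool) τ → τ ≤ card S →
    Σ (Fin n → Bool) λ S′ → card S′ ≡ τ × (∀ u → S′ u ≡ true → S u ≡ true)
  trim {zero} S zero le = S , refl , λ ()
  trim {suc n} S zero le = (λ _ → false) , ∑-zero {suc n} , λ _ ()
  trim {suc n} S (suc τ) le with S zero in eq
  ... | true with trim (S ∘ suc) τ (≤-pred le)
  ...   | S′ , c , s = (λ { zero → true ; (suc i) → S′ i }) , cong suc c , λ { zero _ → eq ; (suc i) → s i }
  trim {suc n} S (suc τ) le | false with trim (S ∘ suc) (suc τ) le
  ...   | S′ , c , s = (λ { zero → false ; (suc i) → S′ i }) , c , λ { zero () ; (suc i) → s i }

  module Roots {n : ℕ} (U : Fin n → Bool) where

    N : ℕ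
    N = card U

    incl-excl : ∀ (p q : Fin n → Bool) → card (λ w → U w ∧ p w) + card (λ w → U w ∧ q w) ≤ N + card (λ w → (U w ∧ p w) ∧ q w)
    incl-excl p q = subst₂ _≤_ (∑-distrib-+ (λ w → ⟦ U w ∧ p w ⟧) _) (∑-distrib-+ (λ w → ⟦ U w ⟧) _) (∑-mono (λ w → pt (U w) (p w) (q w)))
      where
      pt : ∀ a b c → ⟦ a ∧ b ⟧ + ⟦ a ∧ c ⟧ ≤ ⟦ a ⟧ + ⟦ (a ∧ b) ∧ c ⟧
      pt true true true = ≤-refl
      pt true true false = ≤-refl
      pt true false true = ≤-refl
      pt true false false = z≤n
      pt false _ _ = z≤n

    module _ (F : Fin n → ℕ) where

      below : ℕ → ℕ
      below θ = card (λ w → U w ∧ (F w <ᵇ θ))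

      below-all : below (suc (∑ F)) ≡ N
      below-all = sum-cong-≗ (λ w → cong ⟦_⟧ (trans (cong (U w ∧_) (true-<ᵇ (s≤s (≤∑ F w)))) (∧-identityʳ (U w))))

      below-zero : below 0 ≡ 0
      below-zero = trans (sum-cong-≗ (λ w → cong ⟦_⟧ (∧-zeroʳ (U w)))) (∑-zero {n})

      below-mono : ∀ {a b} → a ≤ b → below a ≤ below b
      below-mono {a} {b} le = ∑-mono pt
        where
        pt : ∀ w → ⟦ U w ∧ (F w <ᵇ a) ⟧ ≤ ⟦ U w ∧ (F w <ᵇ b) ⟧
        pt w with U w | F w <ᵇ a in eq
        ... | false | _ = z≤n
        ... | true | false = z≤n
        ... | true | true rewrite true-<ᵇ (<-≤-trans (<ᵇ-true {F w} {a} eq) le) = ≤-refl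

      -- The number found is the `j`-th smallest value of `F` on `U`. The search descends from
      -- `suc (∑ F)`, which exceeds all values.
      threshold : ∀ j → 1 ≤ j → j ≤ N → ∃ λ θ → below θ < j × j ≤ below (suc θ)
      threshold j 1≤j j≤N = search (suc (∑ F)) (subst (j ≤_) (sym below-all) j≤N)
        where
        search : ∀ b → j ≤ below b → ∃ λ θ → below θ < j × j ≤ below (suc θ)
        search zero le = contradiction (≤-trans 1≤j (≤-trans le (≤-reflexive below-zero))) λ ()
        search (suc b) le with j ≤? below b
        ... | yes le′ = search b le′
        ... | no ¬le = b , ≰⇒> ¬le , le

      -- f₀ and f₁ are the k-th smallest value and the median of F.
      average-bound : ∀ {k c f₀ f₁} → N ≡ 2 * k + c → f₀ ≤ f₁ → below f₀ ≤ k → 2 * below f₁ ≤ N →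
        c * (f₀ + f₁) ≤ 2 * ∑ (λ w → ⟦ U w ⟧ * F w)
      average-bound {k} {c} {f₀} {f₁} N≡ f₀≤f₁ b₀ b₁ = subst (λ f → c * (f₀ + f) ≤ 2 * A) f₁≡ (+-cancelʳ-≤ (2 * (f₀ * k) + e * N) _ _ (begin
        c * (f₀ + (f₀ + e)) + (2 * (f₀ * k) + e * N) ≡⟨ cong (λ z → c * (f₀ + (f₀ + e)) + (2 * (f₀ * k) + e * z)) N≡ ⟩
        c * (f₀ + (f₀ + e)) + (2 * (f₀ * k) + e * (2 * k + c)) ≤⟨ m≤m+n _ (2 * k * f₀ + 2 * k * e) ⟩
        c * (f₀ + (f₀ + e)) + (2 * (f₀ * k) + e * (2 * k + c)) + (2 * k * f₀ + 2 * k * e) ≡⟨ lem c f₀ e k ⟩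
        2 * ((2 * k + c) * (f₀ + e)) ≡⟨ cong (λ z → 2 * (z * (f₀ + e))) (sym N≡) ⟩
        2 * (N * (f₀ + e)) ≤⟨ *-monoʳ-≤ 2 summed ⟩
        2 * (A + (f₀ * below f₀ + e * below f₁)) ≡⟨ lem₂ A f₀ (below f₀) e (below f₁) ⟩
        2 * A + (2 * (f₀ * below f₀) + e * (2 * below f₁)) ≤⟨ +-monoʳ-≤ (2 * A) (+-mono-≤ (*-monoʳ-≤ 2 (*-monoʳ-≤ f₀ b₀)) (*-monoʳ-≤ e b₁)) ⟩
        2 * A + (2 * (f₀ * k) + e * N) ∎))
        where
        open ≤-Reasoning
        e = f₁ ∸ f₀
        f₁≡ : f₀ + e ≡ f₁
        f₁≡ = m+[n∸m]≡n f₀≤f₁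
        A = ∑ (λ w → ⟦ U w ⟧ * F w)
        lem : ∀ c f e k → c * (f + (f + e)) + (2 * (f * k) + e * (2 * k + c)) + (2 * k * f + 2 * k * e) ≡ 2 * ((2 * k + c) * (f + e))
        lem = solve-∀
        lem₂ : ∀ A f x e y → 2 * (A + (f * x + e * y)) ≡ 2 * A + (2 * (f * x) + e * (2 * y))
        lem₂ = solve-∀
        -- A decomposition into two layers: `F w` is at least `f₀` unless it lies below `f₀`, and at
        -- least `e` more unless it lies below `f₁`.
        pt : ∀ w → ⟦ U w ⟧ * (f₀ + e) ≤ ⟦ U w ⟧ * F w + (f₀ * ⟦ U w ∧ (F w <ᵇ f₀) ⟧ + e * ⟦ U w ∧ (F w <ᵇ f₁) ⟧)
        pt w with U w | F w <ᵇ f₀ in eq₀ | F w <ᵇ f₁ in eq₁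
        ... | false | _ | _ = z≤n
        ... | true | true | true = ≤-trans (≤-reflexive (lem′ f₀ e)) (m≤n+m _ (1 * F w))
          where
          lem′ : ∀ a b → 1 * (a + b) ≡ a * 1 + b * 1
          lem′ = solve-∀
        ... | true | true | false = contradiction (≤-trans (≤-trans (<ᵇ-true {F w} eq₀) f₀≤f₁) (false-<ᵇ {F w} eq₁)) (<-irrefl refl)
        ... | true | false | true = subst (1 * (f₀ + e) ≤_) (lem′ (F w) f₀ e) (*-monoʳ-≤ 1 (+-monoˡ-≤ e (false-<ᵇ {F w} eq₀)))
          where
          lem′ : ∀ x a b → 1 * (x + b) ≡ 1 * x + (a * 0 + b * 1)
          lem′ = solve-∀
        ... | true | false | false = ≤-trans (*-monoʳ-≤ 1 (≤-trans (≤-reflexive f₁≡) (false-<ᵇ {F w} eq₁))) (m≤m+n _ _)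
        summed : N * (f₀ + e) ≤ A + (f₀ * below f₀ + e * below f₁)
        summed = begin
          N * (f₀ + e) ≡⟨ sym (∑-*ʳ (f₀ + e) (λ w → ⟦ U w ⟧)) ⟩
          ∑ (λ w → ⟦ U w ⟧ * (f₀ + e)) ≤⟨ ∑-mono pt ⟩
          ∑ (λ w → ⟦ U w ⟧ * F w + (f₀ * ⟦ U w ∧ (F w <ᵇ f₀) ⟧ + e * ⟦ U w ∧ (F w <ᵇ f₁) ⟧))
            ≡⟨ ∑-distrib-+ (λ w → ⟦ U w ⟧ * F w) _ ⟩
          A + ∑ (λ w → f₀ * ⟦ U w ∧ (F w <ᵇ f₀) ⟧ + e * ⟦ U w ∧ (F w <ᵇ f₁) ⟧)
            ≡⟨ cong (A +_) (trans (∑-distrib-+ (λ w → f₀ * ⟦ U w ∧ (F w <ᵇ f₀) ⟧) _)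
                 (cong₂ _+_ (∑-*ˡ f₀ (λ w → ⟦ U w ∧ (F w <ᵇ f₀) ⟧)) (∑-*ˡ e (λ w → ⟦ U w ∧ (F w <ᵇ f₁) ⟧)))) ⟩
          A + (f₀ * below f₀ + e * below f₁) ∎

    module Choice (Nb : Bool → Fin n → Fin n → Bool) (Nb-sym : ∀ d u w → Nb (not d) w u ≡ Nb d u w)
      (r : ℕ) (deg : ∀ d u → N + 2 * r ≤ 2 * card (λ w → U w ∧ Nb d u w)) where

      -- Two neighbourhoods of at least N/2 + r vertices each overlap in 2r. `Nb-sym` turns the
      -- reverse neighbours of `w` into the `y` from which `w` can be reached.
      common-out : ∀ d₀ x₀ d w → 2 * r ≤ card (λ y → (U y ∧ Nb d₀ x₀ y) ∧ Nb d y w)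
      common-out d₀ x₀ d w = *-cancelˡ-≤ 2 (+-cancelˡ-≤ (2 * N) _ _ (begin
        2 * N + 2 * (2 * r) ≡⟨ lem N r ⟩
        (N + 2 * r) + (N + 2 * r) ≤⟨ +-mono-≤ (deg d₀ x₀) (deg (not d) w) ⟩
        2 * card (λ y → U y ∧ Nb d₀ x₀ y) + 2 * card (λ y → U y ∧ Nb (not d) w y) ≡⟨ sym (*-distribˡ-+ 2 (card (λ y → U y ∧ Nb d₀ x₀ y)) _) ⟩
        2 * (card (λ y → U y ∧ Nb d₀ x₀ y) + card (λ y → U y ∧ Nb (not d) w y)) ≤⟨ *-monoʳ-≤ 2 (incl-excl (Nb d₀ x₀) (Nb (not d) w)) ⟩
        2 * (N + card (λ y → (U y ∧ Nb d₀ x₀ y) ∧ Nb (not d) w y)) ≡⟨ *-distribˡ-+ 2 N _ ⟩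
        2 * N + 2 * card (λ y → (U y ∧ Nb d₀ x₀ y) ∧ Nb (not d) w y)
          ≡⟨ cong (λ z → 2 * N + 2 * z) (sum-cong-≗ (λ y → cong (λ b → ⟦ (U y ∧ Nb d₀ x₀ y) ∧ b ⟧) (Nb-sym d y w))) ⟩
        2 * N + 2 * card (λ y → (U y ∧ Nb d₀ x₀ y) ∧ Nb d y w) ∎))
        where
        open ≤-Reasoning
        lem : ∀ N r → 2 * N + 2 * (2 * r) ≡ (N + 2 * r) + (N + 2 * r)
        lem = solve-∀

      -- This holds for every `y`: whichever root is chosen, it has `r` neighbours below the median.
      half-common : ∀ (p : Fin n → Bool) d y → N ≤ 2 * card (λ w → U w ∧ p w) → r ≤ card (λ w → (U w ∧ p w) ∧ Nb d y w)
      half-common p d y half = *-cancelˡ-≤ 2 (+-cancelˡ-≤ (2 * N) _ _ (begin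
        2 * N + 2 * r ≡⟨ lem N r ⟩
        N + (N + 2 * r) ≤⟨ +-mono-≤ half (deg d y) ⟩
        2 * card (λ w → U w ∧ p w) + 2 * card (λ w → U w ∧ Nb d y w) ≡⟨ sym (*-distribˡ-+ 2 (card (λ w → U w ∧ p w)) _) ⟩
        2 * (card (λ w → U w ∧ p w) + card (λ w → U w ∧ Nb d y w)) ≤⟨ *-monoʳ-≤ 2 (incl-excl p (Nb d y)) ⟩
        2 * (N + card (λ w → (U w ∧ p w) ∧ Nb d y w)) ≡⟨ *-distribˡ-+ 2 N _ ⟩
        2 * N + 2 * card (λ w → (U w ∧ p w) ∧ Nb d y w) ∎))
        where
        open ≤-Reasoning
        lem : ∀ N r → 2 * N + 2 * r ≡ N + (N + 2 * r)
        lem = solve-∀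

      module Cost (g : Fin n → ℕ) (k τ : ℕ) (1≤k : 1 ≤ k) (1≤r : 1 ≤ r) (Nτ≤rk : N * τ ≤ r * k) where

        G : ℕ
        G = ∑ (λ w → ⟦ U w ⟧ * g w)

        -- Double counting of pairs of a neighbour `y` of `x₀` and a cheap spot next to `y` gives at
        -- least 2rℓ of them. Weighted by `suc G`, one half pays for asking `τ` cheap neighbours of
        -- every `y`, as Nτ ≤ rk ≤ rℓ, and the other half pays for ℓ r `g y` summed over `U`. Some
        -- `y` has a count exceeding both charges together; since that count is at most ℓ, its price
        -- is at most G/r.
        low-root : ∀ (p : Fin n → Bool) d₀ x₀ d → k ≤ card (λ w → U w ∧ p w) →
          ∃ λ y → U y ≡ true × Nb d₀ x₀ y ≡ true × τ ≤ card (λ w → (U w ∧ p w) ∧ Nb d y w) × r * g y ≤ G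
        low-root p d₀ x₀ d k≤ = find (∑<∑⇒∃ {f = f} {g′} sums)
          where
          ℓ = card (λ w → U w ∧ p w)
          A : Fin n → Bool
          A y = U y ∧ Nb d₀ x₀ y
          c : Fin n → ℕ
          c y = card (λ w → (U w ∧ p w) ∧ Nb d y w)
          f g′ : Fin n → ℕ
          f y = ⟦ U y ⟧ * (τ * suc G) + ℓ * r * (⟦ U y ⟧ * g y)
          g′ y = ⟦ A y ⟧ * c y * suc G
          degrees : ∑ (λ y → ⟦ A y ⟧ * c y) ≡ ∑ (λ w → ⟦ U w ∧ p w ⟧ * card (λ y → A y ∧ Nb d y w))
          degrees = begin
            ∑ (λ y → ⟦ A y ⟧ * c y) ≡⟨ sum-cong-≗ (λ y → sym (∑-*ˡ ⟦ A y ⟧ (λ w → ⟦ (U w ∧ p w) ∧ Nb d y w ⟧))) ⟩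
            ∑ (λ y → ∑ (λ w → ⟦ A y ⟧ * ⟦ (U w ∧ p w) ∧ Nb d y w ⟧)) ≡⟨ ∑-comm (λ y w → ⟦ A y ⟧ * ⟦ (U w ∧ p w) ∧ Nb d y w ⟧) ⟩
            ∑ (λ w → ∑ (λ y → ⟦ A y ⟧ * ⟦ (U w ∧ p w) ∧ Nb d y w ⟧))
              ≡⟨ sum-cong-≗ (λ w → trans (sum-cong-≗ (λ y → pt (A y) (U w ∧ p w) (Nb d y w))) (∑-*ˡ ⟦ U w ∧ p w ⟧ (λ y → ⟦ A y ∧ Nb d y w ⟧))) ⟩
            ∑ (λ w → ⟦ U w ∧ p w ⟧ * card (λ y → A y ∧ Nb d y w)) ∎
            where
            open ≡-Reasoning
            pt : ∀ a b e → ⟦ a ⟧ * ⟦ b ∧ e ⟧ ≡ ⟦ b ⟧ * ⟦ a ∧ e ⟧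
            pt true true e = refl
            pt true false e = refl
            pt false true e = refl
            pt false false e = refl
          many : 2 * r * ℓ ≤ ∑ (λ y → ⟦ A y ⟧ * c y)
          many = begin
            2 * r * ℓ ≡⟨ sym (∑-*ˡ (2 * r) (λ w → ⟦ U w ∧ p w ⟧)) ⟩
            ∑ (λ w → 2 * r * ⟦ U w ∧ p w ⟧) ≡⟨ sum-cong-≗ (λ w → *-comm (2 * r) ⟦ U w ∧ p w ⟧) ⟩
            ∑ (λ w → ⟦ U w ∧ p w ⟧ * (2 * r)) ≤⟨ ∑-mono (λ w → *-monoʳ-≤ ⟦ U w ∧ p w ⟧ (common-out d₀ x₀ d w)) ⟩
            ∑ (λ w → ⟦ U w ∧ p w ⟧ * card (λ y → A y ∧ Nb d y w)) ≡⟨ sym degrees ⟩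
            ∑ (λ y → ⟦ A y ⟧ * c y) ∎
            where open ≤-Reasoning
          0<ℓr : 0 < ℓ * r
          0<ℓr = *-mono-≤ (≤-trans 1≤k k≤) 1≤r
          sums : ∑ f < ∑ g′
          sums = begin-strict
            ∑ f ≡⟨ trans (∑-distrib-+ (λ y → ⟦ U y ⟧ * (τ * suc G)) _) (cong₂ _+_ (∑-*ʳ (τ * suc G) (λ y → ⟦ U y ⟧)) (∑-*ˡ (ℓ * r) (λ y → ⟦ U y ⟧ * g y))) ⟩
            N * (τ * suc G) + ℓ * r * G ≡⟨ cong (_+ ℓ * r * G) (sym (*-assoc N τ (suc G))) ⟩
            N * τ * suc G + ℓ * r * G ≤⟨ +-monoˡ-≤ (ℓ * r * G) (*-monoˡ-≤ (suc G) (≤-trans Nτ≤rk (*-monoʳ-≤ r k≤))) ⟩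
            r * ℓ * suc G + ℓ * r * G <⟨ m<m+n _ 0<ℓr ⟩
            r * ℓ * suc G + ℓ * r * G + ℓ * r ≡⟨ lem r ℓ G ⟩
            2 * r * ℓ * suc G ≤⟨ *-monoˡ-≤ (suc G) many ⟩
            ∑ (λ y → ⟦ A y ⟧ * c y) * suc G ≡⟨ sym (∑-*ʳ (suc G) (λ y → ⟦ A y ⟧ * c y)) ⟩
            ∑ g′ ∎
            where
            open ≤-Reasoning
            lem : ∀ r l G → r * l * suc G + l * r * G + l * r ≡ 2 * r * l * suc G
            lem = solve-∀
          find : (∃ λ y → f y < g′ y) → _
          find (y , q) with U y in Uy | Nb d₀ x₀ y in Ny
          find (y , ()) | false | _
          find (y , ()) | true | false
          ... | true | true = y , Uy , Ny , many-low , cheap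
            where
            open ≤-Reasoning
            q′ : τ * suc G + ℓ * r * g y < c y * suc G
            q′ = subst₂ _<_ (lem₁ (τ * suc G) (ℓ * r) (g y)) (lem₂ (c y) (suc G)) q
              where
              lem₁ : ∀ a b x → 1 * a + b * (1 * x) ≡ a + b * x
              lem₁ = solve-∀
              lem₂ : ∀ a b → 1 * a * b ≡ a * b
              lem₂ = solve-∀
            many-low : τ ≤ c y
            many-low = *-cancelʳ-≤ τ (c y) (suc G) (<⇒≤ (≤-<-trans (m≤m+n _ _) q′))
            c≤ℓ : c y ≤ ℓ
            c≤ℓ = ∑-mono (λ w → pt (U w ∧ p w) (Nb d y w))
              where
              pt : ∀ a b → ⟦ a ∧ b ⟧ ≤ ⟦ a ⟧
              pt true b = ⟦⟧≤1 b
              pt false b = z≤n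
            cheap : r * g y ≤ G
            cheap = ≤-pred (*-cancelˡ-< ℓ _ _ (begin-strict
              ℓ * (r * g y) ≡⟨ sym (*-assoc ℓ r (g y)) ⟩
              ℓ * r * g y ≤⟨ m≤n+m _ _ ⟩
              τ * suc G + ℓ * r * g y <⟨ q′ ⟩
              c y * suc G ≤⟨ *-monoˡ-≤ (suc G) c≤ℓ ⟩
              ℓ * suc G ∎))

        record Root (F : Bool → Fin n → ℕ) (c : ℕ) (d₀ : Bool) (x₀ : Fin n) : Set where
          field
            y : Fin n
            y∈U : U y ≡ true
            y-adj : Nb d₀ x₀ y ≡ true
            y-cheap : r * g y ≤ G
            S : Bool → Fin n → Bool
            S-card : ∀ d → card (S d) ≡ τ
            S-adj : ∀ d w → S d w ≡ true → Nb d y w ≡ true × U w ≡ true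
            level : Bool → ℕ
            S-level : ∀ d w → S d w ≡ true → F d w ≤ level d
            level-bound : c * (level true + level false) ≤ ∑ (λ w → ⟦ U w ⟧ * F true w) + ∑ (λ w → ⟦ U w ⟧ * F false w)

        module Search (F : Bool → Fin n → ℕ) (c : ℕ) (τ≤r : τ ≤ r) where

          Avg : Bool → ℕ
          Avg d = ∑ (λ w → ⟦ U w ⟧ * F d w)

          record Levels (d : Bool) : Set where
            field
              f₀ f₁ : ℕ
              many : k ≤ card (λ w → U w ∧ (F d w <ᵇ suc f₀))
              half : N ≤ 2 * card (λ w → U w ∧ (F d w <ᵇ suc f₁))
              average : c * (f₀ + f₁) ≤ 2 * Avg d

          levels : N ≡ 2 * k + c → ∀ d → Levels d
          levels N≡ d = go (threshold (F d) k 1≤k (≤-trans k≤half (⌈n/2⌉≤n N)))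
                           (threshold (F d) ⌈ N /2⌉ (≤-trans 1≤k k≤half) (⌈n/2⌉≤n N))
            where
            N≤ : N ≤ 2 * ⌈ N /2⌉
            N≤ = subst₂ _≤_ (⌊n/2⌋+⌈n/2⌉≡n N) (cong (⌈ N /2⌉ +_) (sym (+-identityʳ _))) (+-monoˡ-≤ ⌈ N /2⌉ (⌊n/2⌋≤⌈n/2⌉ N))
            2⌊⌋≤N : 2 * ⌊ N /2⌋ ≤ N
            2⌊⌋≤N = subst₂ _≤_ (cong (⌊ N /2⌋ +_) (sym (+-identityʳ _))) (⌊n/2⌋+⌈n/2⌉≡n N) (+-monoʳ-≤ ⌊ N /2⌋ (⌊n/2⌋≤⌈n/2⌉ N))
            k≤half : k ≤ ⌈ N /2⌉
            k≤half = *-cancelˡ-≤ 2 (≤-trans (m≤m+n (2 * k) c) (≤-trans (≤-reflexive (sym N≡)) N≤))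
            go : (∃ λ θ → below (F d) θ < k × k ≤ below (F d) (suc θ)) →
                 (∃ λ θ → below (F d) θ < ⌈ N /2⌉ × ⌈ N /2⌉ ≤ below (F d) (suc θ)) → Levels d
            go (f₀ , lo₀ , hi₀) (f₁ , lo₁ , hi₁) = record
              { f₀ = f₀ ; f₁ = f₁ ; many = hi₀ ; half = ≤-trans N≤ (*-monoʳ-≤ 2 hi₁)
              ; average = average-bound (F d) N≡ (≮⇒≥ (λ lt → <⇒≱ (≤-<-trans (below-mono (F d) lt) lo₀) (≤-trans k≤half hi₁)))
                  -- Fewer than ⌈N/2⌉ spots lie below `f₁`, hence at most ⌊N/2⌋. So the rank ⌈N/2⌉
                  -- fits both requirements on a median, for odd `N` too.
                  (<⇒≤ lo₀) (≤-trans (*-monoʳ-≤ 2 (≤-pred (≤-trans lo₁ (⌊n/2⌋-mono (n≤1+n (suc N)))))) 2⌊⌋≤N) }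

          rooted : ∀ d₀ x₀ (level : Bool → ℕ) y → U y ≡ true → Nb d₀ x₀ y ≡ true → r * g y ≤ G →
            (∀ e → τ ≤ card (λ w → (U w ∧ (F e w <ᵇ suc (level e))) ∧ Nb e y w)) →
            c * (level true + level false) ≤ Avg true + Avg false →
            Root F c d₀ x₀
          rooted d₀ x₀ level y Uy Ny gy rich lb = record
            { y = y ; y∈U = Uy ; y-adj = Ny ; y-cheap = gy ; level = level ; level-bound = lb
            ; S = λ d → proj₁ (spots d)
            ; S-card = λ d → proj₁ (proj₂ (spots d))
            ; S-adj = λ d w e → let p , q = ∧-true {U w ∧ (F d w <ᵇ suc (level d))} {Nb d y w} (proj₂ (proj₂ (spots d)) w e) in q , proj₁ (∧-true p)
            ; S-level = λ d w e → ≤-pred (<ᵇ-true {F d w} (proj₂ (∧-true {U w} (proj₁ (∧-true {U w ∧ (F d w <ᵇ suc (level d))} {Nb d y w} (proj₂ (proj₂ (spots d)) w e)))))) }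
            where spots = λ e → trim _ τ (rich e)

          double : ∀ {a b a′ b′} → a + b′ ≤ a′ + b → c * (a + b) ≤ 2 * Avg true → c * (a′ + b′) ≤ 2 * Avg false →
            c * (a + b′) ≤ Avg true + Avg false
          double {a} {b} {a′} {b′} le p q = *-cancelˡ-≤ 2 (begin
            2 * (c * (a + b′)) ≡⟨ lem₁ c (a + b′) ⟩
            c * (a + b′ + (a + b′)) ≤⟨ *-monoʳ-≤ c (+-monoʳ-≤ (a + b′) le) ⟩
            c * (a + b′ + (a′ + b)) ≡⟨ lem₂ c a b a′ b′ ⟩
            c * (a + b) + c * (a′ + b′) ≤⟨ +-mono-≤ p q ⟩
            2 * Avg true + 2 * Avg false ≡⟨ sym (*-distribˡ-+ 2 (Avg true) (Avg false)) ⟩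
            2 * (Avg true + Avg false) ∎)
            where
            open ≤-Reasoning
            lem₁ : ∀ c x → 2 * (c * x) ≡ c * (x + x)
            lem₁ = solve-∀
            lem₂ : ∀ c a b x y → c * (a + y + (x + b)) ≡ c * (a + b) + c * (x + y)
            lem₂ = solve-∀

          Candidate : Bool → ℕ → Bool → Fin n → Set
          Candidate d f d₀ x₀ = ∃ λ y → U y ≡ true × Nb d₀ x₀ y ≡ true ×
            τ ≤ card (λ w → (U w ∧ (F d w <ᵇ suc f)) ∧ Nb d y w) × r * g y ≤ G

          -- For directions d ≠ e, a root with many d-neighbours among the k cheapest spots still has
          -- many e-neighbours below the median, and for one of the two choices of d the levels f₀ d + f₁ e
          -- are at most half of f₀ + f₁ summed over both directions.
          find-root : Levels true → Levels false → ∀ d₀ x₀ → Root F c d₀ x₀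
          find-root Lt Lf d₀ x₀ = [ favour-true , favour-false ]′ (≤-total (t.f₀ + f.f₁) (f.f₀ + t.f₁))
            where
            module t = Levels Lt
            module f = Levels Lf
            favour-true : t.f₀ + f.f₁ ≤ f.f₀ + t.f₁ → Root F c d₀ x₀
            favour-true le = go (low-root (λ w → F true w <ᵇ suc t.f₀) d₀ x₀ true t.many)
              where
              level : Bool → ℕ
              level true = t.f₀
              level false = f.f₁
              go : Candidate true t.f₀ d₀ x₀ → Root F c d₀ x₀
              go (y , Uy , Ny , rich , gy) = rooted d₀ x₀ level y Uy Ny gy
                (λ { true → rich ; false → ≤-trans τ≤r (half-common (λ w → F false w <ᵇ suc f.f₁) false y f.half) })
                (double {t.f₀} {t.f₁} {f.f₀} {f.f₁} le t.average f.average)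
            favour-false : f.f₀ + t.f₁ ≤ t.f₀ + f.f₁ → Root F c d₀ x₀
            favour-false le = go (low-root (λ w → F false w <ᵇ suc f.f₀) d₀ x₀ false f.many)
              where
              level : Bool → ℕ
              level true = t.f₁
              level false = f.f₀
              go : Candidate false f.f₀ d₀ x₀ → Root F c d₀ x₀
              go (y , Uy , Ny , rich , gy) = rooted d₀ x₀ level y Uy Ny gy
                (λ { false → rich ; true → ≤-trans τ≤r (half-common (λ w → F true w <ᵇ suc t.f₁) true y t.half) })
                (double {t.f₁} {t.f₀} {f.f₁} {f.f₀} (subst₂ _≤_ (+-comm f.f₀ t.f₁) (+-comm t.f₀ f.f₁) le)
                  (subst (λ z → c * z ≤ 2 * Avg true) (+-comm t.f₀ t.f₁) t.average)
                  (subst (λ z → c * z ≤ 2 * Avg false) (+-comm f.f₀ f.f₁) f.average))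

  -- (1 + P/c)^j ≤ 1/(1 - jP/c)
  ^-near : ∀ c P j s → c ≡ j * P + s → s * (c + P) ^ j ≤ c * c ^ j
  ^-near c P zero s e = ≤-reflexive (cong (_* 1) (sym e))
  ^-near c P (suc j) s e = begin
    s * ((c + P) * (c + P) ^ j) ≡⟨ lem₁ s c P ((c + P) ^ j) ⟩
    (s * (c + P)) * (c + P) ^ j ≤⟨ *-monoˡ-≤ ((c + P) ^ j) one-more ⟩
    c * (s + P) * (c + P) ^ j ≡⟨ *-assoc c (s + P) _ ⟩
    c * ((s + P) * (c + P) ^ j) ≤⟨ *-monoʳ-≤ c (^-near c P j (s + P) (trans e (lem₂ j P s))) ⟩
    c * (c * c ^ j) ∎
    where
    open ≤-Reasoning
    lem₁ : ∀ s c P x → s * ((c + P) * x) ≡ (s * (c + P)) * x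
    lem₁ = solve-∀
    lem₂ : ∀ j P s → suc j * P + s ≡ j * P + (s + P)
    lem₂ = solve-∀
    one-more : s * (c + P) ≤ c * (s + P)
    one-more = begin
      s * (c + P) ≡⟨ *-distribˡ-+ s c P ⟩
      s * c + s * P ≤⟨ +-mono-≤ (≤-reflexive (*-comm s c)) (*-monoˡ-≤ P (≤-trans (m≤n+m s (suc j * P)) (≤-reflexive (sym e)))) ⟩
      c * s + c * P ≡⟨ sym (*-distribˡ-+ c s P) ⟩
      c * (s + P) ∎

  -- (1 + P/c)^j ≤ 1 + 1/t
  ^-close : ∀ t c P j b → 1 ≤ c → b ≤ c + P → suc t * (j * P) ≤ c → t * b ^ j ≤ suc t * c ^ j
  ^-close t c@(suc _) P j b _ b≤ le = *-cancelˡ-≤ c (begin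
    c * (t * b ^ j) ≤⟨ *-monoʳ-≤ c (*-monoʳ-≤ t (^-monoˡ-≤ j b≤)) ⟩
    c * (t * (c + P) ^ j) ≡⟨ lem₁ c t ((c + P) ^ j) ⟩
    t * c * (c + P) ^ j ≤⟨ *-monoˡ-≤ ((c + P) ^ j) share ⟩
    suc t * s * (c + P) ^ j ≡⟨ *-assoc (suc t) s _ ⟩
    suc t * (s * (c + P) ^ j) ≤⟨ *-monoʳ-≤ (suc t) (^-near c P j s c≡) ⟩
    suc t * (c * c ^ j) ≡⟨ lem₂ (suc t) c (c ^ j) ⟩
    c * (suc t * c ^ j) ∎)
    where
    open ≤-Reasoning
    s = c ∸ j * P
    c≡ : c ≡ j * P + s
    c≡ = sym (m+[n∸m]≡n (≤-trans (m≤n*m (j * P) (suc t)) le))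
    lem₁ : ∀ c t x → c * (t * x) ≡ t * c * x
    lem₁ = solve-∀
    lem₂ : ∀ t c x → t * (c * x) ≡ c * (t * x)
    lem₂ = solve-∀
    share : t * c ≤ suc t * s
    share = +-cancelˡ-≤ c (t * c) (suc t * s) (begin
      c + t * c ≡⟨ cong (suc t *_) c≡ ⟩
      suc t * (j * P + s) ≡⟨ *-distribˡ-+ (suc t) (j * P) s ⟩
      suc t * (j * P) + suc t * s ≤⟨ +-monoˡ-≤ (suc t * s) le ⟩
      c + suc t * s ∎)

  -- Embedding one component at nearly average cost.

  module Component {A : Set} {n : ℕ} (Nb : Bool → Fin n → Fin n → Bool)
    (Nb-sym : ∀ d u w → Nb (not d) w u ≡ Nb d u w) (K Δ E C θ : ℕ) (θ≥ : suc E * suc K ≤ θ) where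

    Adj : Bool → Fin n → Fin n → Set
    Adj d u w = Nb d u w ≡ true

    open Placing {A} Adj public

    module _ (U : Fin n → Bool) (r k τ c : ℕ) (g : Fin n → ℕ)
      (1≤k : 1 ≤ k) (1≤τ : 1 ≤ τ) (τ≤r : τ ≤ r) (Nτ≤rk : card U * τ ≤ r * k) (N≡ : card U ≡ 2 * k + c)
      (k-small : k * (2 * E + 2) ≤ card U) (N≤Cr : card U ≤ C * r)
      (deg : ∀ d u → card U + 2 * r ≤ 2 * card (λ w → U w ∧ Nb d u w)) where

      N G : ℕ
      N = card U
      G = ∑ (λ u → ⟦ U u ⟧ * g u)

      cost : Assignment → ℕ
      cost P = sum (map (λ p → g (proj₂ p)) P)

      -- After division by E² the bound reads (1 + 1/E)² times the average cost of as many vertices,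
      -- plus `C` averages for the root. It is written as a main term plus an error because the main
      -- term has to cancel exactly in `Potential-step`.
      Embedding : Bool → Fin n → A → Forest A → Set
      Embedding d x w ch = Σ (Placed K Δ U (br d false w ch ∅) x []) λ p →
        E * E * (N * cost (Placed.P p)) ≤
          (E * E * suc (residual ch) + ((2 * E + 1) * suc (residual ch) + E * E * C)) * G

      1≤r : 1 ≤ r
      1≤r = ≤-trans 1≤τ τ≤r

      private
        E[_] : Fin n → Fin n → Bool
        E[ u ] w = U u ∧ (U w ∧ Nb true u w)

        row-E : ∀ u → U u ≡ true → N + 2 * r ≤ 2 * row E[_] u
        row-E u Uu rewrite Uu = deg true u

        col-E : ∀ w → U w ≡ true → N + 2 * r ≤ 2 * col E[_] w
        col-E w Uw = ≤-trans (deg false w) (≤-reflexive (cong (2 *_) (sum-cong-≗ (λ u → cong ⟦_⟧ (pt u)))))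
          where
          pt : ∀ u → U u ∧ Nb false w u ≡ E[ u ] w
          pt u rewrite Uw = cong (U u ∧_) (Nb-sym true u w)

      Factorᴿ : Set
      Factorᴿ = Σ Matrix λ R → R ⊆ᴹ E[_] × (∀ u → U u ≡ true → row R u ≡ r) × (∀ w → U w ≡ true → col R w ≡ r)

      factor : Factorᴿ
      factor = Factor.regular-factor U E[_] r
        (λ u w e → let p , q = ∧-true {U u} e in p , proj₁ (∧-true {U w} q)) row-E col-E

      -- One factor serves both directions, since the transpose of a regular matrix is regular.
      both : Matrix → Bool → Fin n → Fin n → Bool
      both R true u w = R u w
      both R false u w = R w u

      -- Two losses of a factor 1 + 1/E: one for having `c` in place of `N`, bounded by `k-small`,
      -- and one for the K + 1 levels of Markov steps, bounded by the size of `θ`.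
      light-error : ∀ res x → x * (θ ^ suc K * c) ≤ suc θ ^ suc K * (res * G) →
        E * E * (N * x) ≤ suc E * suc E * (res * G)
      light-error res x h = begin
        E * E * (N * x) ≡⟨ lem₁ E N x ⟩
        E * (N * E) * x ≤⟨ *-monoˡ-≤ x (*-monoʳ-≤ E shrink) ⟩
        E * (suc E * c) * x ≡⟨ lem₂ E c x ⟩
        suc E * (x * c * E) ≤⟨ *-monoʳ-≤ (suc E) (*-cancelˡ-≤ (θ ^ suc K) {{m^n≢0 θ (suc K)}} scaled) ⟩
        suc E * (suc E * (res * G)) ≡⟨ sym (*-assoc (suc E) (suc E) _) ⟩
        suc E * suc E * (res * G) ∎
        where
        open ≤-Reasoning
        1≤θ : 1 ≤ θ
        1≤θ = ≤-trans (s≤s z≤n) θ≥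
        instance
          θ≢0 : NonZero θ
          θ≢0 = >-nonZero 1≤θ
        lem₁ : ∀ E N x → E * E * (N * x) ≡ E * (N * E) * x
        lem₁ = solve-∀
        lem₂ : ∀ E c x → E * (suc E * c) * x ≡ suc E * (x * c * E)
        lem₂ = solve-∀
        shrink : N * E ≤ suc E * c
        shrink = +-cancelʳ-≤ N (N * E) (suc E * c) (begin
          N * E + N ≡⟨ lem N E ⟩
          suc E * N ≡⟨ cong (suc E *_) N≡ ⟩
          suc E * (2 * k + c) ≡⟨ lem′ E k c ⟩
          suc E * c + k * (2 * E + 2) ≤⟨ +-monoʳ-≤ (suc E * c) k-small ⟩
          suc E * c + N ∎)
          where
          lem : ∀ N E → N * E + N ≡ suc E * N
          lem = solve-∀
          lem′ : ∀ E k c → suc E * (2 * k + c) ≡ suc E * c + k * (2 * E + 2)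
          lem′ = solve-∀
        power : E * suc θ ^ suc K ≤ suc E * θ ^ suc K
        power = ^-close E θ 1 (suc K) (suc θ) 1≤θ (≤-reflexive (+-comm 1 θ))
          (≤-trans (≤-reflexive (cong (suc E *_) (*-identityʳ (suc K)))) θ≥)
        scaled : θ ^ suc K * (x * c * E) ≤ θ ^ suc K * (suc E * (res * G))
        scaled = begin
          θ ^ suc K * (x * c * E) ≡⟨ lem (θ ^ suc K) x c E ⟩
          E * (x * (θ ^ suc K * c)) ≤⟨ *-monoʳ-≤ E h ⟩
          E * (suc θ ^ suc K * (res * G)) ≡⟨ sym (*-assoc E (suc θ ^ suc K) _) ⟩
          E * suc θ ^ suc K * (res * G) ≤⟨ *-monoˡ-≤ (res * G) power ⟩
          suc E * θ ^ suc K * (res * G) ≡⟨ lem′ (suc E) (θ ^ suc K) (res * G) ⟩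
          θ ^ suc K * (suc E * (res * G)) ∎
          where
          lem : ∀ t x c E → t * (x * c * E) ≡ E * (x * (t * c))
          lem = solve-∀
          lem′ : ∀ e t x → e * t * x ≡ t * (e * x)
          lem′ = solve-∀

      combine : ∀ res gy x → r * gy ≤ G → E * E * (N * x) ≤ suc E * suc E * (res * G) →
        E * E * (N * (gy + x)) ≤ (E * E * suc res + ((2 * E + 1) * suc res + E * E * C)) * G
      combine res gy x rg lx = begin
        E * E * (N * (gy + x)) ≡⟨ lem₁ E N gy x ⟩
        E * E * (N * gy) + E * E * (N * x) ≤⟨ +-mono-≤ (*-monoʳ-≤ (E * E) root) lx ⟩
        E * E * (C * G) + suc E * suc E * (res * G) ≤⟨ m≤m+n _ (suc E * suc E * G) ⟩
        E * E * (C * G) + suc E * suc E * (res * G) + suc E * suc E * G ≡⟨ lem₂ E C G res ⟩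
        (E * E * suc res + ((2 * E + 1) * suc res + E * E * C)) * G ∎
        where
        open ≤-Reasoning
        lem₁ : ∀ E N a x → E * E * (N * (a + x)) ≡ E * E * (N * a) + E * E * (N * x)
        lem₁ = solve-∀
        lem₂ : ∀ E C G s → E * E * (C * G) + suc E * suc E * (s * G) + suc E * suc E * G
          ≡ (E * E * suc s + ((2 * E + 1) * suc s + E * E * C)) * G
        lem₂ = solve-∀
        root : N * gy ≤ C * G
        root = begin
          N * gy ≤⟨ *-monoˡ-≤ gy N≤Cr ⟩
          C * r * gy ≡⟨ *-assoc C r gy ⟩
          C * (r * gy) ≤⟨ *-monoʳ-≤ C rg ⟩
          C * G ∎

      module WithFactor (R : Matrix) (R⊆ : R ⊆ᴹ E[_]) (Rr : ∀ u → U u ≡ true → row R u ≡ r)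
        (Rc : ∀ w → U w ≡ true → col R w ≡ r) where

        both-adj : ∀ d u w → both R d u w ≡ true → Nb d u w ≡ true × U w ≡ true
        both-adj true u w e = let _ , q = ∧-true {U u} (R⊆ u w e) ; p , s = ∧-true {U w} q in s , p
        both-adj false u w e = let p , q = ∧-true {U w} (R⊆ w u e) ; _ , s = ∧-true {U u} q in trans (Nb-sym true w u) s , p

        both-row : ∀ d u → U u ≡ true → ∑ (λ w → ⟦ both R d u w ⟧) ≡ r
        both-row true = Rr
        both-row false = Rc

        both-col : ∀ d w → ∑ (λ u → ⟦ both R d u w ⟧) ≤ r * ⟦ U w ⟧
        both-col d w with U w in eq
        ... | true = ≤-reflexive (trans (col-at d) (sym (*-identityʳ r)))
          where
          col-at : ∀ d → ∑ (λ u → ⟦ both R d u w ⟧) ≡ r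
          col-at true = Rc w eq
          col-at false = Rr w eq
        ... | false = ≤-trans (≤-reflexive (trans (sum-cong-≗ (λ u → absent d u)) (∑-zero {n}))) z≤n
          where
          absent : ∀ d u → ⟦ both R d u w ⟧ ≡ 0
          absent d u = ⟦⟧≡0 (λ e → true≢false (proj₂ (both-adj d u w e)) eq)

        open Light-part K Δ U (both R) r θ g both-adj both-row both-col using (fc; total; total-residual; place; join)

        -- The root search is given, for each direction, the expected cost of all children in that
        -- direction together with their descendants, put at the same spot. One level per direction
        -- thus bounds every child at once, and the chosen sets `S` of `τ` spots have total cost at
        -- most `τ` times the levels, which `level-bound` compares with the average over `U`.
        component : ∀ d x w ch → Good K Δ ch → suc θ * suc (residual ch) ≤ τ → Embedding d x w ch
        component d x w ch good small = from-root (find-root (levels N≡ true) (levels N≡ false) d x)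
          where
          open Roots.Choice.Cost U Nb Nb-sym r deg g k τ 1≤k 1≤r Nτ≤rk using (Root)
          open Roots.Choice.Cost.Search U Nb Nb-sym r deg g k τ 1≤k 1≤r Nτ≤rk (λ e → fc K e ch) c τ≤r using (levels; find-root)
          from-root : Root (λ e → fc K e ch) c d x → Embedding d x w ch
          from-root ρ = finish (place K ch y S τ (y ∷ []) S-card S-adj (Good-Light ch good) good small (≤-trans small τ≤r))
            where
            open Root ρ
            finish : (Σ (Placed K Δ U ch y (y ∷ [])) λ p → cost (Placed.P p) * (θ ^ suc K * r ^ K * τ) ≤ suc θ ^ suc K * total K ch S) →
              Embedding d x w ch
            finish (p , cp) = join y-adj y∈U (λ ()) p nothing-left , bound
              where
              nothing-left : Placed K Δ U ∅ x (locs (Placed.P p) ++ y ∷ [])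
              nothing-left = record { P = [] ; Q = [] ; unique = [] ; fresh = λ () ; lengthP = refl ; sizeQ = refl
                ; cutsQ = refl ; goodQ = [] ; sat = λ _ _ _ → tt }
              c₁ = cost (Placed.P p)
              leveled : ∀ e → ∑ (λ u → ⟦ S e u ⟧ * fc K e ch u) ≤ τ * level e
              leveled e = ≤-trans (∑-mono pt) (≤-reflexive (trans (∑-*ʳ (level e) (λ u → ⟦ S e u ⟧)) (cong (_* level e) (S-card e))))
                where
                pt : ∀ u → ⟦ S e u ⟧ * fc K e ch u ≤ ⟦ S e u ⟧ * level e
                pt u with S e u in eq
                ... | true = *-monoʳ-≤ 1 (S-level e u eq)
                ... | false = z≤n
              averaged : c * total K ch S ≤ τ * (r ^ K * residual ch * G)
              averaged = begin
                c * total K ch S ≤⟨ *-monoʳ-≤ c (+-mono-≤ (leveled true) (leveled false)) ⟩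
                c * (τ * level true + τ * level false) ≡⟨ lem c τ (level true) (level false) ⟩
                τ * (c * (level true + level false)) ≤⟨ *-monoʳ-≤ τ level-bound ⟩
                τ * total K ch (λ _ → U) ≤⟨ *-monoʳ-≤ τ (total-residual K ch) ⟩
                τ * (r ^ K * residual ch * G) ∎
                where
                open ≤-Reasoning
                lem : ∀ c t a b → c * (t * a + t * b) ≡ t * (c * (a + b))
                lem = solve-∀
              light : c₁ * (θ ^ suc K * c) ≤ suc θ ^ suc K * (residual ch * G)
              light = *-cancelˡ-≤ (r ^ K * τ) {{>-nonZero (*-mono-≤ (m^n>0 r {{>-nonZero 1≤r}} K) 1≤τ)}} (begin
                r ^ K * τ * (c₁ * (θ ^ suc K * c)) ≡⟨ lem (r ^ K) τ c₁ (θ ^ suc K) c ⟩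
                c * (c₁ * (θ ^ suc K * r ^ K * τ)) ≤⟨ *-monoʳ-≤ c cp ⟩
                c * (suc θ ^ suc K * total K ch S) ≡⟨ lem′ c (suc θ ^ suc K) (total K ch S) ⟩
                suc θ ^ suc K * (c * total K ch S) ≤⟨ *-monoʳ-≤ (suc θ ^ suc K) averaged ⟩
                suc θ ^ suc K * (τ * (r ^ K * residual ch * G)) ≡⟨ lem″ (suc θ ^ suc K) τ (r ^ K) (residual ch) G ⟩
                r ^ K * τ * (suc θ ^ suc K * (residual ch * G)) ∎)
                where
                open ≤-Reasoning
                lem : ∀ rk τ x t c → rk * τ * (x * (t * c)) ≡ c * (x * (t * rk * τ))
                lem = solve-∀
                lem′ : ∀ c t x → c * (t * x) ≡ t * (c * x)
                lem′ = solve-∀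
                lem″ : ∀ t τ rk s G → t * (τ * (rk * s * G)) ≡ rk * τ * (t * (s * G))
                lem″ = solve-∀
              bound : E * E * (N * (g y + cost (Placed.P p ++ []))) ≤
                (E * E * suc (residual ch) + ((2 * E + 1) * suc (residual ch) + E * E * C)) * G
              bound = subst (λ P → E * E * (N * (g y + cost P)) ≤ (E * E * suc (residual ch) + ((2 * E + 1) * suc (residual ch) + E * E * C)) * G)
                (sym (++-identityʳ (Placed.P p))) (combine (residual ch) (g y) c₁ y-cheap (light-error (residual ch) c₁ light))

      embed-component : ∀ d x w ch → Good K Δ ch → suc θ * suc (residual ch) ≤ τ → Embedding d x w ch
      embed-component = from factor
        where
        from : Factorᴿ → ∀ d x w ch → Good K Δ ch → suc θ * suc (residual ch) ≤ τ → Embedding d x w ch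
        from (R , R⊆ , Rr , Rc) = WithFactor.component R R⊆ Rr Rc

  -- Growth of the potential

  square-sum : ∀ y z → 2 * (z * y) ≤ y * y + z * z
  square-sum zero z = ≤-trans (≤-reflexive (cong (2 *_) (*-zeroʳ z))) z≤n
  square-sum (suc y) zero = z≤n
  square-sum (suc y) (suc z) = subst₂ _≤_ (lem₁ y z) (lem₂ y z) (+-monoˡ-≤ (2 * (y + z) + 2) (square-sum y z))
    where
    lem₁ : ∀ y z → 2 * (z * y) + (2 * (y + z) + 2) ≡ 2 * (suc z * suc y)
    lem₁ = solve-∀
    lem₂ : ∀ y z → y * y + z * z + (2 * (y + z) + 2) ≡ suc y * suc y + suc z * suc z
    lem₂ = solve-∀

  -- The tangent inequality y^(j+1) ≥ z^(j+1) + (j+1) z^j (y - z), arranged without subtraction.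
  tangent : ∀ y z j → suc j * (z ^ j * y) ≤ y ^ suc j + j * z ^ suc j
  tangent y z zero = ≤-reflexive (lem y)
    where
    lem : ∀ y → 1 * (1 * y) ≡ y * 1 + 0
    lem = solve-∀
  tangent y z (suc j) = +-cancelʳ-≤ (suc j * (z ^ suc j * y) + j * (z ^ suc j * y)) _ _ (begin
    suc (suc j) * (z ^ suc j * y) + (suc j * (z ^ suc j * y) + j * (z ^ suc j * y)) ≡⟨ lem₁ j z (z ^ j) y ⟩
    suc j * (z ^ j * (2 * (z * y))) + suc j * (z ^ j * y) * z ≤⟨ +-mono-≤ (*-monoʳ-≤ (suc j) (*-monoʳ-≤ (z ^ j) (square-sum y z))) ≤-refl ⟩
    suc j * (z ^ j * (y * y + z * z)) + suc j * (z ^ j * y) * z ≡⟨ lem₂ j z (z ^ j) y ⟩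
    suc j * (z ^ j * y) * y + (suc j * (z * (z * z ^ j)) + suc j * (z ^ suc j * y))
      ≤⟨ +-monoˡ-≤ _ (*-monoˡ-≤ y (tangent y z j)) ⟩
    (y ^ suc j + j * z ^ suc j) * y + (suc j * (z * (z * z ^ j)) + suc j * (z ^ suc j * y)) ≡⟨ lem₃ j z (z ^ j) y (y ^ j) ⟩
    y ^ suc (suc j) + suc j * z ^ suc (suc j) + (suc j * (z ^ suc j * y) + j * (z ^ suc j * y)) ∎)
    where
    open ≤-Reasoning
    lem₁ : ∀ j z zj y → suc (suc j) * (z * zj * y) + (suc j * (z * zj * y) + j * (z * zj * y)) ≡ suc j * (zj * (2 * (z * y))) + suc j * (zj * y) * z
    lem₁ = solve-∀
    lem₂ : ∀ j z zj y → suc j * (zj * (y * y + z * z)) + suc j * (zj * y) * z ≡ suc j * (zj * y) * y + (suc j * (z * (z * zj)) + suc j * (z * zj * y))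
    lem₂ = solve-∀
    lem₃ : ∀ j z zj y yj → (y * yj + j * (z * zj)) * y + (suc j * (z * (z * zj)) + suc j * (z * zj * y))
      ≡ y * (y * yj) + suc j * (z * (z * zj)) + (suc j * (z * zj * y) + j * (z * zj * y))
    lem₃ = solve-∀

  bernoulli : ∀ z w j → z ^ j * (z + suc j * w) ≤ (z + w) ^ suc j
  bernoulli z w j = +-cancelʳ-≤ (j * z ^ suc j) _ _ (≤-trans (≤-reflexive (lem z w j (z ^ j))) (tangent (z + w) z j))
    where
    lem : ∀ z w j zj → zj * (z + suc j * w) + j * (z * zj) ≡ suc j * (zj * (z + w))
    lem = solve-∀

  ^-distrib : ∀ a b j → (a * b) ^ j ≡ a ^ j * b ^ j
  ^-distrib a b zero = refl
  ^-distrib a b (suc j) = trans (cong (a * b *_) (^-distrib a b j)) (lem a b (a ^ j) (b ^ j))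
    where
    lem : ∀ a b x y → a * b * (x * y) ≡ a * x * (b * y)
    lem = solve-∀

  -- With N = N′ + S unused vertices before the step, x = 2N - a and x′ = 2N′ - (a - l): the relation
  -- N x′ - N′ x = N l - S a cancels to first order when the cost ∑ x^(M-1) l is close to its average.
  module Potential-step {I : ℕ} (x a l x′ : Fin I → ℕ) (N N′ S D E C j : ℕ)
    (rel : ∀ i → N * x′ i + S * a i ≡ N′ * x i + N * l i)
    (a≤N : ∀ i → a i ≤ N) (N≤x : ∀ i → N ≤ x i) (N′≤x′ : ∀ i → N′ ≤ x′ i) (l≤S : ∀ i → l i ≤ S)
    (D≤N′ : D ≤ N′) (1≤N : 1 ≤ N) (1≤N′ : 1 ≤ N′) (small : suc E * (suc j * S) ≤ N′)
    (H : ℕ) (cheap : E * E * (N * ∑ (λ i → x i ^ j * l i)) ≤ (E * E * S + H) * ∑ (λ i → x i ^ j * a i))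
    where

    open ≤-Reasoning

    B W M : ℕ
    B = E * E * (E * suc E)
    W = (2 * E + 1) * (E * E * S) + suc E * suc E * H
    M = suc j

    Y Y′ : Fin I → ℕ
    Y i = N′ * x i
    Y′ i = N * x′ i

    -- Here the summand |U| in x pays off: `Y` and `Y′` are at least `N′ * N`, while a step moves
    -- them by at most `S * N`. By `small` the relative change stays below 1/E even for `j`-th
    -- powers.
    near : ∀ u v → 1 ≤ u → v ≤ u + S * N → N′ * N ≤ u → E * v ^ j ≤ suc E * u ^ j
    near u v 1≤u v≤ big = ^-close E u (S * N) j v 1≤u v≤ (begin
      suc E * (j * (S * N)) ≤⟨ *-monoʳ-≤ (suc E) (*-monoˡ-≤ (S * N) (n≤1+n j)) ⟩
      suc E * (suc j * (S * N)) ≡⟨ lem E j S N ⟩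
      suc E * (suc j * S) * N ≤⟨ *-monoˡ-≤ N small ⟩
      N′ * N ≤⟨ big ⟩
      u ∎)
      where
      lem : ∀ E j S N → suc E * (suc j * (S * N)) ≡ suc E * (suc j * S) * N
      lem = solve-∀

    NN≤Y : ∀ i → N′ * N ≤ Y i
    NN≤Y i = *-monoʳ-≤ N′ (N≤x i)

    NN≤Y′ : ∀ i → N′ * N ≤ Y′ i
    NN≤Y′ i = ≤-trans (≤-reflexive (*-comm N′ N)) (*-monoʳ-≤ N (N′≤x′ i))

    Y≤ : ∀ i → Y i ≤ Y′ i + S * N
    Y≤ i = ≤-trans (m≤m+n (Y i) (N * l i)) (≤-trans (≤-reflexive (sym (rel i))) (+-monoʳ-≤ (Y′ i) (*-monoʳ-≤ S (a≤N i))))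

    Y′≤ : ∀ i → Y′ i ≤ Y i + S * N
    Y′≤ i = ≤-trans (m≤m+n (Y′ i) (S * a i)) (≤-trans (≤-reflexive (rel i)) (+-monoʳ-≤ (Y i)
      (≤-trans (*-monoʳ-≤ N (l≤S i)) (≤-reflexive (*-comm N S)))))

    -- The tangent at the new point `Y′` gives Y′^M ≤ Y^M + M Y′^j (N l - S a). Then `near` replaces
    -- Y′^j by Y^j, downwards in the term with `a` and upwards in the term with `l`.
    pointwise : ∀ i → E * suc E * Y′ i ^ M + M * (E * E) * S * (Y i ^ j * a i)
      ≤ E * suc E * Y i ^ M + M * (suc E * suc E) * N * (Y i ^ j * l i)
    pointwise i = begin
      E * suc E * Z ^ M + M * (E * E) * S * (Y i ^ j * a i) ≡⟨ cong (E * suc E * Z ^ M +_) (lem₁ M E S (Y i ^ j) (a i)) ⟩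
      E * suc E * Z ^ M + M * (E * (E * Y i ^ j)) * q ≤⟨ +-monoʳ-≤ (E * suc E * Z ^ M) (*-monoˡ-≤ q (*-monoʳ-≤ M (*-monoʳ-≤ E
          (near Z (Y i) (≤-trans (*-mono-≤ 1≤N′ 1≤N) (NN≤Y′ i)) (Y≤ i) (NN≤Y′ i))))) ⟩
      E * suc E * Z ^ M + M * (E * (suc E * Z ^ j)) * q ≡⟨ lem₂ E (Z ^ M) M (Z ^ j) q ⟩
      E * suc E * (Z ^ M + M * (Z ^ j * q)) ≤⟨ *-monoʳ-≤ (E * suc E) convex ⟩
      E * suc E * (Y i ^ M + M * (Z ^ j * p)) ≡⟨ lem₃ E (Y i ^ M) M (Z ^ j) p ⟩
      E * suc E * Y i ^ M + M * (suc E * (E * Z ^ j)) * p ≤⟨ +-monoʳ-≤ (E * suc E * Y i ^ M) (*-monoˡ-≤ p (*-monoʳ-≤ M (*-monoʳ-≤ (suc E)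
          (near (Y i) Z (≤-trans (*-mono-≤ 1≤N′ 1≤N) (NN≤Y i)) (Y′≤ i) (NN≤Y i))))) ⟩
      E * suc E * Y i ^ M + M * (suc E * (suc E * Y i ^ j)) * p ≡⟨ cong (E * suc E * Y i ^ M +_) (lem₄ M (suc E) N (Y i ^ j) (l i)) ⟩
      E * suc E * Y i ^ M + M * (suc E * suc E) * N * (Y i ^ j * l i) ∎
      where
      Z = Y′ i
      p = N * l i
      q = S * a i
      lem₁ : ∀ M E S y a → M * (E * E) * S * (y * a) ≡ M * (E * (E * y)) * (S * a)
      lem₁ = solve-∀
      lem₂ : ∀ E zM M zj q → E * suc E * zM + M * (E * (suc E * zj)) * q ≡ E * suc E * (zM + M * (zj * q))
      lem₂ = solve-∀
      lem₃ : ∀ E yM M zj p → E * suc E * (yM + M * (zj * p)) ≡ E * suc E * yM + M * (suc E * (E * zj)) * p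
      lem₃ = solve-∀
      lem₄ : ∀ M E N y l → M * (E * (E * y)) * (N * l) ≡ M * (E * E) * N * (y * l)
      lem₄ = solve-∀
      convex : Z ^ M + M * (Z ^ j * q) ≤ Y i ^ M + M * (Z ^ j * p)
      convex = +-cancelʳ-≤ (j * Z ^ M) _ _ (begin
        Z ^ M + M * (Z ^ j * q) + j * Z ^ M ≡⟨ lem Z (Z ^ j) j q ⟩
        M * (Z ^ j * (Z + q)) ≡⟨ cong (λ w → M * (Z ^ j * w)) (rel i) ⟩
        M * (Z ^ j * (Y i + p)) ≡⟨ lem′ M (Z ^ j) (Y i) p ⟩
        M * (Z ^ j * Y i) + M * (Z ^ j * p) ≤⟨ +-monoˡ-≤ _ (tangent (Y i) Z j) ⟩
        Y i ^ M + j * Z ^ M + M * (Z ^ j * p) ≡⟨ lem″ (Y i ^ M) (j * Z ^ M) _ ⟩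
        Y i ^ M + M * (Z ^ j * p) + j * Z ^ M ∎)
        where
        lem : ∀ z zj j q → z * zj + suc j * (zj * q) + j * (z * zj) ≡ suc j * (zj * (z + q))
        lem = solve-∀
        lem′ : ∀ M z y p → M * (z * (y + p)) ≡ M * (z * y) + M * (z * p)
        lem′ = solve-∀
        lem″ : ∀ x y z → x + y + z ≡ x + z + y
        lem″ = solve-∀

    Φ Φ′ A L : ℕ
    Φ = ∑ (λ i → Y i ^ M)
    Φ′ = ∑ (λ i → Y′ i ^ M)
    A = ∑ (λ i → Y i ^ j * a i)
    L = ∑ (λ i → Y i ^ j * l i)

    summed : E * suc E * Φ′ + M * (E * E) * S * A ≤ E * suc E * Φ + M * (suc E * suc E) * N * L
    summed = subst₂ _≤_ (linear (E * suc E) (M * (E * E) * S) (λ i → Y′ i ^ M) (λ i → Y i ^ j * a i)) (linear (E * suc E) (M * (suc E * suc E) * N) (λ i → Y i ^ M) (λ i → Y i ^ j * l i)) (∑-mono pointwise)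
      where
      linear : ∀ b c (f g : Fin I → ℕ) → ∑ (λ i → b * f i + c * g i) ≡ b * ∑ f + c * ∑ g
      linear b c f g = trans (∑-distrib-+ (λ i → b * f i) _) (cong₂ _+_ (∑-*ˡ b f) (∑-*ˡ c g))

    scale : ∀ (f : Fin I → ℕ) → ∑ (λ i → Y i ^ j * f i) ≡ N′ ^ j * ∑ (λ i → x i ^ j * f i)
    scale f = trans (sum-cong-≗ (λ i → trans (cong (_* f i) (^-distrib N′ (x i) j)) (*-assoc (N′ ^ j) _ _)))
      (∑-*ˡ (N′ ^ j) (λ i → x i ^ j * f i))

    cheap-Y : E * E * (N * L) ≤ (E * E * S + H) * A
    cheap-Y = begin
      E * E * (N * L) ≡⟨ cong (λ z → E * E * (N * z)) (scale l) ⟩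
      E * E * (N * (N′ ^ j * ∑ (λ i → x i ^ j * l i))) ≡⟨ lem E N (N′ ^ j) _ ⟩
      N′ ^ j * (E * E * (N * ∑ (λ i → x i ^ j * l i))) ≤⟨ *-monoʳ-≤ (N′ ^ j) cheap ⟩
      N′ ^ j * ((E * E * S + H) * ∑ (λ i → x i ^ j * a i)) ≡⟨ lem′ (N′ ^ j) (E * E * S + H) _ ⟩
      (E * E * S + H) * (N′ ^ j * ∑ (λ i → x i ^ j * a i)) ≡⟨ cong ((E * E * S + H) *_) (sym (scale a)) ⟩
      (E * E * S + H) * A ∎
      where
      lem : ∀ E N z y → E * E * (N * (z * y)) ≡ z * (E * E * (N * y))
      lem = solve-∀
      lem′ : ∀ z b y → z * (b * y) ≡ b * (z * y)
      lem′ = solve-∀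

    -- Converts an error proportional to `A` into a relative one: a single factor `Y` is at least
    -- N′N, hence at least D `a`.
    DA≤Φ : D * A ≤ Φ
    DA≤Φ = subst (_≤ Φ) (∑-*ˡ D (λ i → Y i ^ j * a i)) (∑-mono (λ i → begin
      D * (Y i ^ j * a i) ≡⟨ lem D (Y i ^ j) (a i) ⟩
      D * a i * Y i ^ j ≤⟨ *-monoˡ-≤ (Y i ^ j) (≤-trans (*-mono-≤ D≤N′ (a≤N i)) (NN≤Y i)) ⟩
      Y i ^ M ∎))
      where
      lem : ∀ D y a → D * (y * a) ≡ D * a * y
      lem = solve-∀

    -- The gain from the shrinking of `U` is E² · E²S and the charge is (E+1)² (E²S + H). `W` is the
    -- difference, in which only the errors survive.
    growth : B * Φ′ ≤ B * Φ + M * W * A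
    growth = +-cancelʳ-≤ (M * (E * E) * S * A * (E * E)) _ _ (begin
      B * Φ′ + M * (E * E) * S * A * (E * E) ≡⟨ lem₁ E Φ′ (M * (E * E) * S * A) ⟩
      E * E * (E * suc E * Φ′ + M * (E * E) * S * A) ≤⟨ *-monoʳ-≤ (E * E) summed ⟩
      E * E * (E * suc E * Φ + M * (suc E * suc E) * N * L) ≡⟨ lem₂ E Φ M N L ⟩
      B * Φ + M * (suc E * suc E) * (E * E * (N * L)) ≤⟨ +-monoʳ-≤ (B * Φ) (*-monoʳ-≤ (M * (suc E * suc E)) cheap-Y) ⟩
      B * Φ + M * (suc E * suc E) * ((E * E * S + H) * A) ≡⟨ lem₃ E Φ M S H A ⟩
      B * Φ + M * W * A + M * (E * E) * S * A * (E * E) ∎)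
      where
      lem₁ : ∀ E f y → E * E * (E * suc E) * f + y * (E * E) ≡ E * E * (E * suc E * f + y)
      lem₁ = solve-∀
      lem₂ : ∀ E f M N L → E * E * (E * suc E * f + M * (suc E * suc E) * N * L) ≡ E * E * (E * suc E) * f + M * (suc E * suc E) * (E * E * (N * L))
      lem₂ = solve-∀
      lem₃ : ∀ E f M S H A → E * E * (E * suc E) * f + M * (suc E * suc E) * ((E * E * S + H) * A)
        ≡ E * E * (E * suc E) * f + M * ((2 * E + 1) * (E * E * S) + suc E * suc E * H) * A + M * (E * E) * S * A * (E * E)
      lem₃ = solve-∀

    -- Bernoulli moves the factor M under the M-th power. The M-th root of the normalised moment
    -- thus grows by 1 + W/(BD), a rate in which M does not occur.
    potential-step : (B * D) ^ M * (N ^ M * ∑ (λ i → x′ i ^ M)) ≤ (B * D + W) ^ M * (N′ ^ M * ∑ (λ i → x i ^ M))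
    potential-step = subst₂ _≤_ (cong ((B * D) ^ M *_) (powers N x′)) (cong ((B * D + W) ^ M *_) (powers N′ x)) (begin
      (B * D) ^ M * Φ′ ≡⟨ lem₁ B D ((B * D) ^ j) Φ′ ⟩
      (B * D) ^ j * (D * (B * Φ′)) ≤⟨ *-monoʳ-≤ ((B * D) ^ j) (*-monoʳ-≤ D growth) ⟩
      (B * D) ^ j * (D * (B * Φ + M * W * A)) ≡⟨ lem₂ ((B * D) ^ j) D B Φ (M * W) A ⟩
      (B * D) ^ j * (B * D * Φ + M * W * (D * A)) ≤⟨ *-monoʳ-≤ ((B * D) ^ j) (+-monoʳ-≤ (B * D * Φ) (*-monoʳ-≤ (M * W) DA≤Φ)) ⟩
      (B * D) ^ j * (B * D * Φ + M * W * Φ) ≡⟨ lem₃ ((B * D) ^ j) (B * D) Φ (M * W) ⟩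
      (B * D) ^ j * (B * D + M * W) * Φ ≤⟨ *-monoˡ-≤ Φ (bernoulli (B * D) W j) ⟩
      (B * D + W) ^ M * Φ ∎)
      where
      powers : ∀ c (f : Fin I → ℕ) → ∑ (λ i → (c * f i) ^ M) ≡ c ^ M * ∑ (λ i → f i ^ M)
      powers c f = trans (sum-cong-≗ (λ i → ^-distrib c (f i) M)) (∑-*ˡ (c ^ M) (λ i → f i ^ M))
      lem₁ : ∀ B D z f → B * D * z * f ≡ z * (D * (B * f))
      lem₁ = solve-∀
      lem₂ : ∀ z D B f w A → z * (D * (B * f + w * A)) ≡ z * (B * D * f + w * (D * A))
      lem₂ = solve-∀
      lem₃ : ∀ z b f w → z * (b * f + w * f) ≡ z * (b + w) * f
      lem₃ = solve-∀

  -- Removing used vertices; test sets and prices.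

  mult⇒∈ : ∀ {n} {u : Fin n} (L : List (Fin n)) → 1 ≤ mult L u → u ∈ L
  mult⇒∈ {u = u} (l ∷ L) le with l F.≟ u
  ... | yes refl = here refl
  ... | no _ = there (mult⇒∈ L le)

  mult-unique : ∀ {n} {u : Fin n} (L : List (Fin n)) → Unique L → mult L u ≤ 1
  mult-unique [] _ = z≤n
  mult-unique {u = u} (l ∷ L) (l∉ ∷ un) with l F.≟ u
  ... | no _ = mult-unique L un
  ... | yes refl with mult L u in eq
  ...   | zero = ≤-refl
  ...   | suc _ = contradiction (mult⇒∈ L (subst (1 ≤_) (sym eq) (s≤s z≤n))) (AllP.All¬⇒¬Any l∉)

  infixl 6 _∖_
  _∖_ : ∀ {n} → (Fin n → Bool) → List (Fin n) → Fin n → Bool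
  (U ∖ L) u = U u ∧ (mult L u <ᵇ 1)

  ∖-split : ∀ {n} (U : Fin n → Bool) (L : List (Fin n)) → Unique L → (∀ {u} → u ∈ L → U u ≡ true) →
    ∀ u → ⟦ U u ⟧ ≡ ⟦ (U ∖ L) u ⟧ + mult L u
  ∖-split U L un L⊆U u with mult L u in eq | mult-unique {u = u} L un
  ... | zero | _ = sym (trans (+-identityʳ _) (cong ⟦_⟧ (∧-t (U u))))
    where
    ∧-t : ∀ b → b ∧ true ≡ b
    ∧-t true = refl
    ∧-t false = refl
  ... | suc zero | _ rewrite L⊆U (mult⇒∈ L (subst (1 ≤_) (sym eq) ≤-refl)) = refl
  ... | suc (suc _) | s≤s ()

  ∖-sub : ∀ {n} {U : Fin n → Bool} {L u} → (U ∖ L) u ≡ true → U u ≡ true × u ∉ L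
  ∖-sub {U = U} {L} {u} e = proj₁ p , λ u∈ → <⇒≱ (<ᵇ-true {mult L u} (proj₂ p)) (∈⇒mult L u∈)
    where p = ∧-true {U u} e

  floor-bounds : ∀ q N → 1 ≤ q → q ≤ N → ∃ λ k → 1 ≤ k × q * k ≤ N × N ≤ 2 * q * k
  floor-bounds q@(suc _) N _ q≤N = N / q , m≥n⇒m/n>0 q≤N , ≤-trans (≤-reflexive (*-comm q _)) (m/n*n≤m N q) , (begin
    N ≡⟨ m≡m%n+[m/n]*n N q ⟩
    N % q + N / q * q ≤⟨ +-mono-≤ (≤-trans (<⇒≤ (m%n<n N q)) (≤-trans (≤-reflexive (sym (*-identityˡ q))) (*-monoˡ-≤ q (m≥n⇒m/n>0 q≤N)))) ≤-refl ⟩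
    N / q * q + N / q * q ≡⟨ lem (N / q) q ⟩
    2 * q * (N / q) ∎)
    where
    open ≤-Reasoning
    lem : ∀ k q → k * q + k * q ≡ 2 * q * k
    lem = solve-∀

  ^-cancel-≤ : ∀ a b j → a ^ suc j ≤ b ^ suc j → a ≤ b
  ^-cancel-≤ a b j le = ≮⇒≥ (λ b<a → <⇒≱ (^-monoˡ-< (suc j) b<a) le)

  module Test-sets {n : ℕ} (Nb : Bool → Fin n → Fin n → Bool) where

    test : Fin (n + n) → Fin n → Bool
    test i = [ Nb true , Nb false ]′ (splitAt n i)

    index-of : Bool → Fin n → Fin (n + n)
    index-of true u = u ↑ˡ n
    index-of false u = n ↑ʳ u

    test-index : ∀ d u → test (index-of d u) ≡ Nb d u
    test-index true u rewrite splitAt-↑ˡ n u n = refl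
    test-index false u rewrite splitAt-↑ʳ n n u = refl

    a x : (Fin n → Bool) → Fin (n + n) → ℕ
    a U i = card (λ u → U u ∧ test i u)
    x U i = card U + card (λ u → U u ∧ not (test i u))

    x+a : ∀ U i → x U i + a U i ≡ 2 * card U
    x+a U i = begin
      card U + b + a U i ≡⟨ lem (card U) b (a U i) ⟩
      card U + (a U i + b) ≡⟨ cong (card U +_) (sym (∑-distrib-+ (λ u → ⟦ U u ∧ test i u ⟧) _)) ⟩
      card U + ∑ (λ u → ⟦ U u ∧ test i u ⟧ + ⟦ U u ∧ not (test i u) ⟧) ≡⟨ cong (card U +_) (sum-cong-≗ (λ u → pt (U u) (test i u))) ⟩
      card U + card U ≡⟨ cong (card U +_) (sym (+-identityʳ _)) ⟩
      2 * card U ∎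
      where
      open ≡-Reasoning
      b = card (λ u → U u ∧ not (test i u))
      lem : ∀ N b a → N + b + a ≡ N + (a + b)
      lem = solve-∀
      pt : ∀ p q → ⟦ p ∧ q ⟧ + ⟦ p ∧ not q ⟧ ≡ ⟦ p ⟧
      pt true true = refl
      pt true false = refl
      pt false _ = refl

    a≤N : ∀ U i → a U i ≤ card U
    a≤N U i = ∑-mono (λ u → pt (U u) (test i u))
      where
      pt : ∀ p q → ⟦ p ∧ q ⟧ ≤ ⟦ p ⟧
      pt true q = ⟦⟧≤1 q
      pt false _ = z≤n

    Φ : ℕ → (Fin n → Bool) → ℕ
    Φ M U = ∑ (λ i → x U i ^ M)

    -- Up to the factor M, the first-order cost of using `u`: the derivative of the moment, summed
    -- over the test sets that lose `u`. Vertices in sets that are already scarce are expensive.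
    price : ℕ → (Fin n → Bool) → Fin n → ℕ
    price j U u = ∑ (λ i → x U i ^ j * ⟦ test i u ⟧)

    price-weighted : ∀ j U (μ : Fin n → ℕ) → ∑ (λ u → μ u * price j U u) ≡ ∑ (λ i → x U i ^ j * ∑ (λ u → μ u * ⟦ test i u ⟧))
    price-weighted j U μ = begin
      ∑ (λ u → μ u * price j U u) ≡⟨ sum-cong-≗ (λ u → sym (∑-*ˡ (μ u) (λ i → x U i ^ j * ⟦ test i u ⟧))) ⟩
      ∑ (λ u → ∑ (λ i → μ u * (x U i ^ j * ⟦ test i u ⟧))) ≡⟨ ∑-comm (λ u i → μ u * (x U i ^ j * ⟦ test i u ⟧)) ⟩
      ∑ (λ i → ∑ (λ u → μ u * (x U i ^ j * ⟦ test i u ⟧)))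
        ≡⟨ sum-cong-≗ (λ i → trans (sum-cong-≗ (λ u → lem (μ u) (x U i ^ j) ⟦ test i u ⟧)) (∑-*ˡ (x U i ^ j) (λ u → μ u * ⟦ test i u ⟧))) ⟩
      ∑ (λ i → x U i ^ j * ∑ (λ u → μ u * ⟦ test i u ⟧)) ∎
      where
      open ≡-Reasoning
      lem : ∀ a b c → a * (b * c) ≡ b * (a * c)
      lem = solve-∀

    module Removal (U : Fin n → Bool) (L : List (Fin n)) (un : Unique L) (L⊆U : ∀ {u} → u ∈ L → U u ≡ true) where

      U′ : Fin n → Bool
      U′ = U ∖ L

      l : Fin (n + n) → ℕ
      l i = ∑ (λ u → mult L u * ⟦ test i u ⟧)

      card-split : card U ≡ card U′ + length L
      card-split = trans (sum-cong-≗ (∖-split U L un L⊆U)) (trans (∑-distrib-+ (λ u → ⟦ U′ u ⟧) (mult L)) (cong (card U′ +_) (∑-mult L)))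

      a-split : ∀ i → a U i ≡ a U′ i + l i
      a-split i = begin
        a U i ≡⟨ sum-cong-≗ (λ u → trans (⟦∧⟧ (U u) (test i u)) (trans (cong (_* ⟦ test i u ⟧) (∖-split U L un L⊆U u))
                   (trans (*-distribʳ-+ ⟦ test i u ⟧ ⟦ U′ u ⟧ (mult L u)) (cong (_+ mult L u * ⟦ test i u ⟧) (sym (⟦∧⟧ (U′ u) (test i u))))))) ⟩
        ∑ (λ u → ⟦ U′ u ∧ test i u ⟧ + mult L u * ⟦ test i u ⟧) ≡⟨ ∑-distrib-+ (λ u → ⟦ U′ u ∧ test i u ⟧) _ ⟩
        a U′ i + l i ∎
        where open ≡-Reasoning

      l≤S : ∀ i → l i ≤ length L
      l≤S i = ≤-trans (∑-mono (λ u → ≤-trans (*-monoʳ-≤ (mult L u) (⟦⟧≤1 (test i u))) (≤-reflexive (*-identityʳ _)))) (≤-reflexive (∑-mult L))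

      rel : ∀ i → card U * x U′ i + length L * a U i ≡ card U′ * x U i + card U * l i
      rel i = +-cancelʳ-≡ (N * a′) _ _ (begin
        N * x′ + S * aᵢ + N * a′ ≡⟨ lem₁ N x′ S aᵢ a′ ⟩
        N * (x′ + a′) + S * aᵢ ≡⟨ cong (λ z → N * z + S * aᵢ) (x+a U′ i) ⟩
        N * (2 * N′) + S * aᵢ ≡⟨ cong (_+ S * aᵢ) (lem₂ N N′) ⟩
        N′ * (2 * N) + S * aᵢ ≡⟨ cong (λ z → N′ * z + S * aᵢ) (sym (x+a U i)) ⟩
        N′ * (xᵢ + aᵢ) + S * aᵢ ≡⟨ lem₃ N′ xᵢ aᵢ S ⟩
        N′ * xᵢ + (N′ + S) * aᵢ ≡⟨ cong₂ (λ y z → N′ * xᵢ + y * z) (sym card-split) (a-split i) ⟩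
        N′ * xᵢ + N * (a′ + l i) ≡⟨ lem₄ (N′ * xᵢ) N a′ (l i) ⟩
        N′ * xᵢ + N * l i + N * a′ ∎)
        where
        open ≡-Reasoning
        N = card U
        N′ = card U′
        S = length L
        x′ = x U′ i
        a′ = a U′ i
        xᵢ = x U i
        aᵢ = a U i
        lem₁ : ∀ N x S a a′ → N * x + S * a + N * a′ ≡ N * (x + a′) + S * a
        lem₁ = solve-∀
        lem₂ : ∀ N N′ → N * (2 * N′) ≡ N′ * (2 * N)
        lem₂ = solve-∀
        lem₃ : ∀ N x a S → N * (x + a) + S * a ≡ N * x + (N + S) * a
        lem₃ = solve-∀
        lem₄ : ∀ y N a l → y + N * (a + l) ≡ y + N * l + N * a
        lem₄ = solve-∀

  -- The embedding process and its invariant.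

  module Process {A : Set} {n : ℕ} (Nb : Bool → Fin n → Fin n → Bool)
    (Nb-sym : ∀ d u w → Nb (not d) w u ≡ Nb d u w)
    (p K E j D N₀ x₀ Δ : ℕ) where

    -- p stands for 1/α.
    C θ ρ s M : ℕ
    C = 8 * p
    θ = suc E * suc K
    ρ = 18 * p
    s = suc (suc K * Δ)
    M = suc j

    open Component {A} Nb Nb-sym K Δ E C θ ≤-refl public
    open Test-sets Nb

    -- The error `W` of `Potential-step` is affine in the size of the component: `W₁` per vertex and
    -- `W₂` per component.
    B W₁ W₂ : ℕ
    B = E * E * (E * suc E)
    W₁ = (2 * E + 1) * (E * E) + suc E * suc E * (2 * E + 1)
    W₂ = suc E * suc E * (E * E * C)

    -- Solved for the moment: Φ is at most 2n (x₀/N₀)^M |U|^M (1 + z/(BD))^M, with `z` recording the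
    -- growth so far. `budget` sets aside in advance what all queued vertices and roots can still
    -- add, so that z/(BD) never exceeds 1/ρ.
    record Inv (U : Fin n → Bool) (z : ℕ) (Q : List Item) : Set where
      field
        count : card U ≡ D + sizeᴵ Q
        potential : (B * D * N₀) ^ M * Φ M U ≤ 2 * n * x₀ ^ M * ((B * D + z) * card U) ^ M
        budget : ρ * (z + 2 * (W₁ * sizeᴵ Q + W₂ * cutsᴵ Q)) ≤ B * D

    module _ (1≤p : 1 ≤ p) (1≤E : 1 ≤ E) (1≤N₀ : 1 ≤ N₀)
      (x₀≤ : 2 * p * x₀ + N₀ ≤ 3 * p * N₀)
      (M-large : 2 * n * ρ ^ M ≤ suc ρ ^ M)
      (D-large : 64 * p * suc E * (suc θ * s) ≤ D)
      (M-small : suc E * (M * s) ≤ D) where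

      1≤s : 1 ≤ s
      1≤s = s≤s z≤n

      64pE≤D : 64 * p * suc E ≤ D
      64pE≤D = ≤-trans (≤-trans (≤-reflexive (sym (*-identityʳ _))) (*-monoʳ-≤ (64 * p * suc E) (*-pos {suc θ} (s≤s z≤n) 1≤s))) D-large

      1≤D : 1 ≤ D
      1≤D = ≤-trans (*-mono-≤ {1} {64 * p} (*-pos {64} (s≤s z≤n) 1≤p) (s≤s z≤n)) 64pE≤D

      1≤BD : 1 ≤ B * D
      1≤BD = *-mono-≤ (*-mono-≤ (*-mono-≤ 1≤E 1≤E) (*-mono-≤ 1≤E (s≤s z≤n))) 1≤D

      within-budget : ∀ {U z Q} → Inv U z Q → ρ * z ≤ B * D
      within-budget iv = ≤-trans (*-monoʳ-≤ ρ (m≤m+n _ _)) (Inv.budget iv)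

      -- One term is at most the whole moment. After the M-th root, the number 2n of terms costs a
      -- factor 1 + 1/ρ by `M-large`, and the recorded growth another. The value 18p of `ρ` is large
      -- enough that (1 + 1/ρ)² (3/2 - 1/(2p)) ≤ 3/2 - 1/(4p).
      x-bound : ∀ {U z Q} → Inv U z Q → ∀ i → 4 * p * x U i + card U ≤ 6 * p * card U
      x-bound {U} {z} iv i = *-cancelˡ-≤ N₀ {{>-nonZero 1≤N₀}} (*-cancelˡ-≤ (ρ * ρ) {{>-nonZero (*-mono-≤ 1≤ρ 1≤ρ)}}
        (+-cancelʳ-≤ (2 * (suc ρ * suc ρ) * (N₀ * V)) _ _ (begin
        ρ * ρ * (N₀ * (4 * p * X + V)) + 2 * (suc ρ * suc ρ) * (N₀ * V) ≡⟨ lem₁ p X V N₀ ρ ⟩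
        4 * p * (ρ * ρ * (X * N₀)) + (ρ * ρ * (N₀ * V) + 2 * (suc ρ * suc ρ) * (N₀ * V)) ≤⟨ +-monoˡ-≤ _ (*-monoʳ-≤ (4 * p) ratio) ⟩
        4 * p * (suc ρ * suc ρ * (x₀ * V)) + (ρ * ρ * (N₀ * V) + 2 * (suc ρ * suc ρ) * (N₀ * V)) ≡⟨ lem₂ p x₀ V N₀ ρ ⟩
        2 * (suc ρ * suc ρ) * V * (2 * p * x₀ + N₀) + ρ * ρ * (N₀ * V) ≤⟨ +-monoˡ-≤ _ (*-monoʳ-≤ (2 * (suc ρ * suc ρ) * V) x₀≤) ⟩
        2 * (suc ρ * suc ρ) * V * (3 * p * N₀) + ρ * ρ * (N₀ * V) ≤⟨ m≤m+n _ ((108 * p * p + 66 * p + 2) * (N₀ * V)) ⟩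
        2 * (suc ρ * suc ρ) * V * (3 * p * N₀) + ρ * ρ * (N₀ * V) + (108 * p * p + 66 * p + 2) * (N₀ * V) ≡⟨ lem₃ p V N₀ ⟩
        ρ * ρ * (N₀ * (6 * p * V)) + 2 * (suc ρ * suc ρ) * (N₀ * V) ∎)))
        where
        open ≤-Reasoning
        V = card U
        X = x U i
        1≤ρ : 1 ≤ ρ
        1≤ρ = *-pos {18} (s≤s z≤n) 1≤p
        lem₁ : ∀ p X V N₀ r → r * r * (N₀ * (4 * p * X + V)) + 2 * (suc r * suc r) * (N₀ * V) ≡ 4 * p * (r * r * (X * N₀)) + (r * r * (N₀ * V) + 2 * (suc r * suc r) * (N₀ * V))
        lem₁ = solve-∀
        lem₂ : ∀ p x V N₀ r → 4 * p * (suc r * suc r * (x * V)) + (r * r * (N₀ * V) + 2 * (suc r * suc r) * (N₀ * V)) ≡ 2 * (suc r * suc r) * V * (2 * p * x + N₀) + r * r * (N₀ * V)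
        lem₂ = solve-∀
        lem₃ : ∀ p V N₀ → 2 * (suc (18 * p) * suc (18 * p)) * V * (3 * p * N₀) + 18 * p * (18 * p) * (N₀ * V) + (108 * p * p + 66 * p + 2) * (N₀ * V)
          ≡ 18 * p * (18 * p) * (N₀ * (6 * p * V)) + 2 * (suc (18 * p) * suc (18 * p)) * (N₀ * V)
        lem₃ = solve-∀
        powered : (ρ * (B * D * N₀ * X)) ^ M ≤ (suc ρ * (x₀ * ((B * D + z) * V))) ^ M
        powered = begin
          (ρ * (B * D * N₀ * X)) ^ M ≡⟨ trans (^-distrib ρ (B * D * N₀ * X) M) (cong (ρ ^ M *_) (^-distrib (B * D * N₀) X M)) ⟩
          ρ ^ M * ((B * D * N₀) ^ M * X ^ M) ≤⟨ *-monoʳ-≤ (ρ ^ M) (*-monoʳ-≤ ((B * D * N₀) ^ M) (≤∑ (λ i → x U i ^ M) i)) ⟩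
          ρ ^ M * ((B * D * N₀) ^ M * Φ M U) ≤⟨ *-monoʳ-≤ (ρ ^ M) (Inv.potential iv) ⟩
          ρ ^ M * (2 * n * x₀ ^ M * ((B * D + z) * V) ^ M) ≡⟨ shuffle (ρ ^ M) (2 * n) (x₀ ^ M) (((B * D + z) * V) ^ M) ⟩
          2 * n * ρ ^ M * (x₀ ^ M * ((B * D + z) * V) ^ M) ≤⟨ *-monoˡ-≤ _ M-large ⟩
          suc ρ ^ M * (x₀ ^ M * ((B * D + z) * V) ^ M) ≡⟨ sym (trans (^-distrib (suc ρ) (x₀ * ((B * D + z) * V)) M) (cong (suc ρ ^ M *_) (^-distrib x₀ ((B * D + z) * V) M))) ⟩
          (suc ρ * (x₀ * ((B * D + z) * V))) ^ M ∎
          where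
          shuffle : ∀ a b c e → a * (b * c * e) ≡ b * a * (c * e)
          shuffle = solve-∀
        ratio : ρ * ρ * (X * N₀) ≤ suc ρ * suc ρ * (x₀ * V)
        ratio = *-cancelˡ-≤ (B * D) {{>-nonZero 1≤BD}} (begin
          B * D * (ρ * ρ * (X * N₀)) ≡⟨ l₁ (B * D) ρ X N₀ ⟩
          ρ * (ρ * (B * D * N₀ * X)) ≤⟨ *-monoʳ-≤ ρ (^-cancel-≤ _ _ j powered) ⟩
          ρ * (suc ρ * (x₀ * ((B * D + z) * V))) ≡⟨ l₂ ρ x₀ (B * D) z V ⟩
          suc ρ * (x₀ * V) * (ρ * (B * D) + ρ * z) ≤⟨ *-monoʳ-≤ (suc ρ * (x₀ * V)) (+-monoʳ-≤ (ρ * (B * D)) (within-budget iv)) ⟩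
          suc ρ * (x₀ * V) * (ρ * (B * D) + B * D) ≡⟨ l₃ ρ x₀ V (B * D) ⟩
          B * D * (suc ρ * suc ρ * (x₀ * V)) ∎)
          where
          l₁ : ∀ b r X N₀ → b * (r * r * (X * N₀)) ≡ r * (r * (b * N₀ * X))
          l₁ = solve-∀
          l₂ : ∀ r x b z V → r * (suc r * (x * ((b + z) * V))) ≡ suc r * (x * V) * (r * b + r * z)
          l₂ = solve-∀
          l₃ : ∀ r x V b → suc r * (x * V) * (r * b + b) ≡ b * (suc r * suc r * (x * V))
          l₃ = solve-∀

      degree : ∀ {U z Q r} → Inv U z Q → 4 * p * r ≤ card U → ∀ d u → card U + 2 * r ≤ 2 * card (λ w → U w ∧ Nb d u w)
      degree {U} {z} {Q} {r} iv 4pr d u = subst (λ S → V + 2 * r ≤ 2 * card (λ w → U w ∧ S w)) (test-index d u)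
        (*-cancelˡ-≤ (4 * p) {{>-nonZero (*-pos {4} (s≤s z≤n) 1≤p)}} (+-cancelʳ-≤ (4 * p * (2 * X)) _ _ (begin
          4 * p * (V + 2 * r) + 4 * p * (2 * X) ≡⟨ lem₁ p V r X ⟩
          4 * p * V + 2 * (4 * p * r) + 2 * (4 * p * X) ≤⟨ +-monoˡ-≤ _ (+-monoʳ-≤ (4 * p * V) (*-monoʳ-≤ 2 4pr)) ⟩
          4 * p * V + 2 * V + 2 * (4 * p * X) ≡⟨ lem₂ p V X ⟩
          4 * p * V + 2 * (4 * p * X + V) ≤⟨ +-monoʳ-≤ (4 * p * V) (*-monoʳ-≤ 2 (x-bound iv i)) ⟩
          4 * p * V + 2 * (6 * p * V) ≡⟨ lem₃ p V ⟩
          4 * p * (2 * (2 * V)) ≡⟨ cong (λ y → 4 * p * (2 * y)) (sym (x+a U i)) ⟩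
          4 * p * (2 * (X + a U i)) ≡⟨ lem₄ p X (a U i) ⟩
          4 * p * (2 * a U i) + 4 * p * (2 * X) ∎)))
        where
        open ≤-Reasoning
        i = index-of d u
        V = card U
        X = x U i
        lem₁ : ∀ p V r X → 4 * p * (V + 2 * r) + 4 * p * (2 * X) ≡ 4 * p * V + 2 * (4 * p * r) + 2 * (4 * p * X)
        lem₁ = solve-∀
        lem₂ : ∀ p V X → 4 * p * V + 2 * V + 2 * (4 * p * X) ≡ 4 * p * V + 2 * (4 * p * X + V)
        lem₂ = solve-∀
        lem₃ : ∀ p V → 4 * p * V + 2 * (6 * p * V) ≡ 4 * p * (2 * (2 * V))
        lem₃ = solve-∀
        lem₄ : ∀ p X a → 4 * p * (2 * (X + a)) ≡ 4 * p * (2 * a) + 4 * p * (2 * X)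
        lem₄ = solve-∀

      Embedded : (U : Fin n → Bool) → Item → Set
      Embedded U (item d u w ch) = Σ (Placed K Δ U (br d false w ch ∅) u []) λ q →
        E * E * (card U * sum (map (λ y → price j U (proj₂ y)) (Placed.P q))) ≤
          (E * E * suc (residual ch) + ((2 * E + 1) * suc (residual ch) + E * E * C)) * ∑ (λ u → ⟦ U u ⟧ * price j U u)

      comp-size : ∀ i → Goodᴵ K Δ i → suc (residual (Item.children i)) ≤ s
      comp-size (item d u w ch) (wi , gd) = s≤s (≤-trans (Light-bound ch (Good-Light ch gd)) (*-monoʳ-≤ (suc K) wi))

      -- The sizes, each up to a factor 2 from rounding down: `r` is |U|/(4p), as `degree` permits;
      -- `k` is |U|/(2E+2), so that |U| - 2k is nearly |U|; and `τ` is k/(8p), which gives |U|τ ≤ rk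
      -- because |U| ≤ 8pr. Doubling for the rounding of `k` and `τ` gives |U| ≤ 64p(E+1)τ, the
      -- origin of the constant in `D-large`.
      embed-item : ∀ {U z Q} i → Inv U z Q → Goodᴵ K Δ i → Embedded U i
      embed-item {U} it@(item d u w ch) iv gi@(wi , gd) =
        choose (floor-bounds (4 * p) V (*-pos {4} (s≤s z≤n) 1≤p) (≤-trans (fits 4 (m≤m+n 4 60)) D≤V))
               (floor-bounds (2 * E + 2) V (≤-trans (s≤s z≤n) (m≤n+m 2 (2 * E))) (≤-trans E-fits D≤V))
        where
        open ≤-Reasoning
        V = card U
        D≤V : D ≤ V
        D≤V = ≤-trans (m≤m+n D _) (≤-reflexive (sym (Inv.count iv)))
        fits : ∀ c → c ≤ 64 → c * p ≤ D
        fits c c≤ = ≤-trans (*-monoˡ-≤ p c≤) (≤-trans (m≤m*n (64 * p) (suc E)) 64pE≤D)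
        E-fits : 2 * E + 2 ≤ D
        E-fits = begin
          2 * E + 2 ≡⟨ lem E ⟩
          2 * suc E ≤⟨ *-monoˡ-≤ (suc E) (*-mono-≤ {2} {64} (m≤m+n 2 62) 1≤p) ⟩
          64 * p * suc E ≤⟨ 64pE≤D ⟩
          D ∎
          where
          lem : ∀ E → 2 * E + 2 ≡ 2 * suc E
          lem = solve-∀
        choose : (∃ λ r → 1 ≤ r × 4 * p * r ≤ V × V ≤ 2 * (4 * p) * r) →
                 (∃ λ k → 1 ≤ k × (2 * E + 2) * k ≤ V × V ≤ 2 * (2 * E + 2) * k) → Embedded U it
        choose (r , 1≤r , 4pr , V≤r) (k , 1≤k , ek , V≤k) = choose-τ (floor-bounds (8 * p) k (*-pos {8} (s≤s z≤n) 1≤p) 8p≤k)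
          where
          8p≤k : 8 * p ≤ k
          8p≤k = *-cancelˡ-≤ (4 * suc E) (begin
            4 * suc E * (8 * p) ≤⟨ m≤m+n _ (32 * p * suc E) ⟩
            4 * suc E * (8 * p) + 32 * p * suc E ≡⟨ lem E p ⟩
            64 * p * suc E ≤⟨ ≤-trans 64pE≤D D≤V ⟩
            V ≤⟨ V≤k ⟩
            2 * (2 * E + 2) * k ≡⟨ lem′ E k ⟩
            4 * suc E * k ∎)
            where
            lem : ∀ E p → 4 * suc E * (8 * p) + 32 * p * suc E ≡ 64 * p * suc E
            lem = solve-∀
            lem′ : ∀ E k → 2 * (2 * E + 2) * k ≡ 4 * suc E * k
            lem′ = solve-∀
          V≤Cr : V ≤ C * r
          V≤Cr = ≤-trans V≤r (≤-reflexive (lem p r))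
            where
            lem : ∀ p r → 2 * (4 * p) * r ≡ 8 * p * r
            lem = solve-∀
          choose-τ : (∃ λ τ → 1 ≤ τ × 8 * p * τ ≤ k × k ≤ 2 * (8 * p) * τ) → Embedded U it
          choose-τ (τ , 1≤τ , 8pτ , k≤τ) =
            embed-component U r k τ (V ∸ 2 * k) (price j U) 1≤k 1≤τ τ≤r Vτ≤rk V≡ (≤-trans (≤-reflexive (*-comm k _)) ek) V≤Cr
              (degree iv 4pr) d u w ch gd (≤-trans (*-monoʳ-≤ (suc θ) (comp-size it gi)) θs≤τ)
            where
            2k≤V : 2 * k ≤ V
            2k≤V = ≤-trans (*-monoˡ-≤ k (m≤n+m 2 (2 * E))) ek
            V≡ : V ≡ 2 * k + (V ∸ 2 * k)
            V≡ = sym (m+[n∸m]≡n 2k≤V)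
            8p>0 : NonZero (8 * p)
            8p>0 = >-nonZero (*-pos {8} (s≤s z≤n) 1≤p)
            τ≤r : τ ≤ r
            τ≤r = *-cancelˡ-≤ (8 * p) {{8p>0}} (≤-trans 8pτ (≤-trans (≤-trans (m≤n*m k 2) 2k≤V) V≤Cr))
            Vτ≤rk : V * τ ≤ r * k
            Vτ≤rk = begin
              V * τ ≤⟨ *-monoˡ-≤ τ V≤Cr ⟩
              8 * p * r * τ ≡⟨ lem p r τ ⟩
              r * (8 * p * τ) ≤⟨ *-monoʳ-≤ r 8pτ ⟩
              r * k ∎
              where
              lem : ∀ p r τ → 8 * p * r * τ ≡ r * (8 * p * τ)
              lem = solve-∀
            θs≤τ : suc θ * s ≤ τ
            θs≤τ = *-cancelˡ-≤ (64 * p * suc E) {{>-nonZero (*-mono-≤ {1} {64 * p} (*-pos {64} (s≤s z≤n) 1≤p) (s≤s z≤n))}} (begin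
              64 * p * suc E * (suc θ * s) ≤⟨ ≤-trans D-large D≤V ⟩
              V ≤⟨ V≤k ⟩
              2 * (2 * E + 2) * k ≤⟨ *-monoʳ-≤ (2 * (2 * E + 2)) k≤τ ⟩
              2 * (2 * E + 2) * (2 * (8 * p) * τ) ≡⟨ lem E p τ ⟩
              64 * p * suc E * τ ∎)
              where
              lem : ∀ E p τ → 2 * (2 * E + 2) * (2 * (8 * p) * τ) ≡ 64 * p * suc E * τ
              lem = solve-∀

      Cheap : (U : Fin n → Bool) (res : ℕ) (P : Assignment) → Set
      Cheap U res P = E * E * (card U * sum (map (λ y → price j U (proj₂ y)) P)) ≤
        (E * E * suc res + ((2 * E + 1) * suc res + E * E * C)) * ∑ (λ u → ⟦ U u ⟧ * price j U u)

      -- (BD + z)(BD + W) ≤ BD (BD + z + 2W) as long as z ≤ BD, so z can record the growth additively.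
      step-potential : ∀ {U z Q} (P : Assignment) (un : Unique (locs P)) (P⊆U : ∀ {u} → u ∈ locs P → U u ≡ true) res →
        length P ≡ suc res → suc res ≤ s → D ≤ card (U ∖ locs P) → Cheap U res P → Inv U z Q →
        (B * D * N₀) ^ M * Φ M (U ∖ locs P) ≤
          2 * n * x₀ ^ M * ((B * D + (z + 2 * (W₁ * suc res + W₂))) * card (U ∖ locs P)) ^ M
      step-potential {U} {z} {Q} P un P⊆U res lenP S≤s D≤V′ cheap iv =
        *-cancelˡ-≤ ((B * D) ^ M * V ^ M) {{>-nonZero (*-mono-≤ (m^n>0 (B * D) {{>-nonZero 1≤BD}} M) (m^n>0 V {{>-nonZero 1≤V}} M))}} (begin
          (B * D) ^ M * V ^ M * ((B * D * N₀) ^ M * Φ M U′) ≡⟨ lem₁ ((B * D) ^ M) (V ^ M) ((B * D * N₀) ^ M) (Φ M U′) ⟩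
          (B * D * N₀) ^ M * ((B * D) ^ M * (V ^ M * Φ M U′)) ≤⟨ *-monoʳ-≤ ((B * D * N₀) ^ M) stepped ⟩
          (B * D * N₀) ^ M * ((B * D + W) ^ M * (V′ ^ M * Φ M U)) ≡⟨ lem₂ ((B * D * N₀) ^ M) ((B * D + W) ^ M) (V′ ^ M) (Φ M U) ⟩
          (B * D + W) ^ M * V′ ^ M * ((B * D * N₀) ^ M * Φ M U) ≤⟨ *-monoʳ-≤ ((B * D + W) ^ M * V′ ^ M) (Inv.potential iv) ⟩
          (B * D + W) ^ M * V′ ^ M * (base * ((B * D + z) * V) ^ M) ≡⟨ cong (λ y → (B * D + W) ^ M * V′ ^ M * (base * y)) (^-distrib (B * D + z) V M) ⟩
          (B * D + W) ^ M * V′ ^ M * (base * ((B * D + z) ^ M * V ^ M)) ≡⟨ lem₃ ((B * D + W) ^ M) (V′ ^ M) base ((B * D + z) ^ M) (V ^ M) ⟩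
          base * V ^ M * V′ ^ M * ((B * D + W) ^ M * (B * D + z) ^ M) ≡⟨ cong (base * V ^ M * V′ ^ M *_) (sym (^-distrib (B * D + W) (B * D + z) M)) ⟩
          base * V ^ M * V′ ^ M * ((B * D + W) * (B * D + z)) ^ M ≤⟨ *-monoʳ-≤ (base * V ^ M * V′ ^ M) (^-monoˡ-≤ M absorb) ⟩
          base * V ^ M * V′ ^ M * (B * D * (B * D + (z + 2 * W))) ^ M ≡⟨ cong (base * V ^ M * V′ ^ M *_) (^-distrib (B * D) (B * D + (z + 2 * W)) M) ⟩
          base * V ^ M * V′ ^ M * ((B * D) ^ M * (B * D + (z + 2 * W)) ^ M) ≡⟨ lem₄ base (V ^ M) (V′ ^ M) ((B * D) ^ M) ((B * D + (z + 2 * W)) ^ M) ⟩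
          (B * D) ^ M * V ^ M * (base * ((B * D + (z + 2 * W)) ^ M * V′ ^ M)) ≡⟨ cong (λ y → (B * D) ^ M * V ^ M * (base * y)) (sym (^-distrib (B * D + (z + 2 * W)) V′ M)) ⟩
          (B * D) ^ M * V ^ M * (base * ((B * D + (z + 2 * W)) * V′) ^ M) ∎)
        where
        open ≤-Reasoning
        module R = Removal U (locs P) un P⊆U
        U′ = U ∖ locs P
        V = card U
        V′ = card U′
        S = suc res
        W = W₁ * S + W₂
        base = 2 * n * x₀ ^ M
        H = (2 * E + 1) * S + E * E * C
        lenL : length (locs P) ≡ S
        lenL = trans (length-map proj₂ P) lenP
        V≡ : V ≡ V′ + S
        V≡ = trans R.card-split (cong (V′ +_) lenL)
        1≤V : 1 ≤ V
        1≤V = ≤-trans 1≤D (≤-trans (m≤m+n D _) (≤-reflexive (sym (Inv.count iv))))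
        weights : ∑ (λ i → x U i ^ j * R.l i) ≡ sum (map (λ y → price j U (proj₂ y)) P)
        weights = sym (trans (trans (cong sum (map-∘ {g = price j U} {f = proj₂} P)) (sum-by-∑ (locs P) (price j U))) (price-weighted j U (mult (locs P))))
        averages : ∑ (λ i → x U i ^ j * a U i) ≡ ∑ (λ u → ⟦ U u ⟧ * price j U u)
        averages = sym (trans (price-weighted j U (λ u → ⟦ U u ⟧))
          (sum-cong-≗ (λ i → cong (x U i ^ j *_) (sum-cong-≗ (λ u → sym (⟦∧⟧ (U u) (test i u)))))))
        module St = Potential-step (x U) (a U) R.l (x U′) V V′ S D E C j
          (λ i → subst (λ y → V * x U′ i + y * a U i ≡ V′ * x U i + V * R.l i) lenL (R.rel i))
          (a≤N U) (λ i → m≤m+n V _) (λ i → m≤m+n V′ _) (λ i → ≤-trans (R.l≤S i) (≤-reflexive lenL))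
          D≤V′ 1≤V (≤-trans 1≤D D≤V′) (≤-trans (*-monoʳ-≤ (suc E) (*-monoʳ-≤ M S≤s)) (≤-trans M-small D≤V′)) H
          (subst₂ (λ y w → E * E * (V * y) ≤ (E * E * S + H) * w) (sym weights) (sym averages) cheap)
        W≡ : St.W ≡ W
        W≡ = lem E S C
          where
          lem : ∀ E S C → (2 * E + 1) * (E * E * S) + suc E * suc E * ((2 * E + 1) * S + E * E * C)
            ≡ ((2 * E + 1) * (E * E) + suc E * suc E * (2 * E + 1)) * S + suc E * suc E * (E * E * C)
          lem = solve-∀
        stepped : (B * D) ^ M * (V ^ M * Φ M U′) ≤ (B * D + W) ^ M * (V′ ^ M * Φ M U)
        stepped = subst (λ w → (B * D) ^ M * (V ^ M * Φ M U′) ≤ (B * D + w) ^ M * (V′ ^ M * Φ M U)) W≡ St.potential-step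
        z≤ : z ≤ B * D
        z≤ = ≤-trans (m≤n*m z ρ {{>-nonZero (*-pos {18} (s≤s z≤n) 1≤p)}}) (within-budget iv)
        absorb : (B * D + W) * (B * D + z) ≤ B * D * (B * D + (z + 2 * W))
        absorb = begin
          (B * D + W) * (B * D + z) ≡⟨ lem (B * D) W z ⟩
          B * D * (B * D + (z + W)) + W * z ≤⟨ +-monoʳ-≤ (B * D * (B * D + (z + W))) (*-monoʳ-≤ W z≤) ⟩
          B * D * (B * D + (z + W)) + W * (B * D) ≡⟨ lem′ (B * D) W z ⟩
          B * D * (B * D + (z + 2 * W)) ∎
          where
          lem : ∀ b W z → (b + W) * (b + z) ≡ b * (b + (z + W)) + W * z
          lem = solve-∀
          lem′ : ∀ b W z → b * (b + (z + W)) + W * b ≡ b * (b + (z + 2 * W))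
          lem′ = solve-∀
        lem₁ : ∀ a b c f → a * b * (c * f) ≡ c * (a * (b * f))
        lem₁ = solve-∀
        lem₂ : ∀ c w v f → c * (w * (v * f)) ≡ w * v * (c * f)
        lem₂ = solve-∀
        lem₃ : ∀ w v′ b z v → w * v′ * (b * (z * v)) ≡ b * v * v′ * (w * z)
        lem₃ = solve-∀
        lem₄ : ∀ b v v′ d z → b * v * v′ * (d * z) ≡ d * v * (b * (z * v′))
        lem₄ = solve-∀

      Outcome : (Fin n → Bool) → List Item → Set
      Outcome U Q = Σ Assignment λ P → Unique (locs P) × (∀ {u} → u ∈ locs P → U u ≡ true) × length P ≡ sizeᴵ Q × All (Satᴵ P) Q

      -- An item is replaced by the items cut off below it. What `z` gains, twice the error of the
      -- step, is just what leaves the reserve, because the new queue has `suc res` vertices and one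
      -- root fewer; so `budget` is kept without loss.
      process : ∀ fuel {U z} Q → sizeᴵ Q ≤ fuel → All (Goodᴵ K Δ) Q → Inv U z Q → Outcome U Q
      process _ [] _ _ _ = [] , [] , (λ ()) , refl , []
      process (suc fuel) {U} {z} (it@(item d u w ch) ∷ Q₀) (s≤s le) (gi ∷ gQ) iv = continue (embed-item it iv gi)
        where
        Q = it ∷ Q₀
        continue : Embedded U it → Outcome U Q
        continue (q , cheap) = merge (process fuel Q′ size-le (AllP.++⁺ q.goodQ gQ) iv′)
          where
          module q = Placed q
          res = residual ch
          Q′ = q.Q ++ Q₀
          U′ = U ∖ locs q.P
          P⊆U : ∀ {u} → u ∈ locs q.P → U u ≡ true
          P⊆U u∈ = proj₂ (q.fresh u∈)
          lenP : length q.P ≡ suc res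
          lenP = trans q.lengthP (cong suc (+-identityʳ res))
          sizeQ : sizeᴵ Q ≡ sizeᴵ Q′ + suc res
          sizeQ = begin
            suc (size ch) + sizeᴵ Q₀ ≡⟨ cong (λ y → suc y + sizeᴵ Q₀) (sym (+-identityʳ (size ch))) ⟩
            suc (size ch + 0) + sizeᴵ Q₀ ≡⟨ cong (_+ sizeᴵ Q₀) (sym q.sizeQ) ⟩
            sizeᴵ q.Q + suc (res + 0) + sizeᴵ Q₀ ≡⟨ lem (sizeᴵ q.Q) res (sizeᴵ Q₀) ⟩
            sizeᴵ q.Q + sizeᴵ Q₀ + suc res ≡⟨ cong (_+ suc res) (sym (sizeᴵ-++ q.Q Q₀)) ⟩
            sizeᴵ Q′ + suc res ∎
            where
            open ≡-Reasoning
            lem : ∀ a r b → a + suc (r + 0) + b ≡ a + b + suc r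
            lem = solve-∀
          cutsQ : cutsᴵ Q ≡ suc (cutsᴵ Q′)
          cutsQ = cong suc (trans (cong (_+ cutsᴵ Q₀) (trans (sym (+-identityʳ (cuts ch))) (sym q.cutsQ))) (sym (cutsᴵ-++ q.Q Q₀)))
          size-le : sizeᴵ Q′ ≤ fuel
          size-le = ≤-trans (≤-trans (m≤m+n (sizeᴵ Q′) res) (≤-pred (≤-reflexive (trans (sym (+-suc (sizeᴵ Q′) res)) (sym sizeQ))))) le
          count′ : card U′ ≡ D + sizeᴵ Q′
          count′ = +-cancelʳ-≡ (suc res) _ _ (begin
            card U′ + suc res ≡⟨ cong (card U′ +_) (sym (trans (length-map proj₂ q.P) lenP)) ⟩
            card U′ + length (locs q.P) ≡⟨ sym (Removal.card-split U (locs q.P) q.unique P⊆U) ⟩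
            card U ≡⟨ Inv.count iv ⟩
            D + sizeᴵ Q ≡⟨ cong (D +_) sizeQ ⟩
            D + (sizeᴵ Q′ + suc res) ≡⟨ sym (+-assoc D (sizeᴵ Q′) (suc res)) ⟩
            D + sizeᴵ Q′ + suc res ∎)
            where open ≡-Reasoning
          iv′ : Inv U′ (z + 2 * (W₁ * suc res + W₂)) Q′
          iv′ = record
            { count = count′
            ; potential = step-potential q.P q.unique P⊆U res lenP (comp-size it gi)
                (≤-trans (m≤m+n D _) (≤-reflexive (sym count′))) cheap iv
            ; budget = ≤-trans (*-monoʳ-≤ ρ (≤-reflexive (trans (lem z W₁ W₂ res (sizeᴵ Q′) (cutsᴵ Q′))
                (cong₂ (λ y w → z + 2 * (W₁ * y + W₂ * w)) (sym sizeQ) (sym cutsQ))))) (Inv.budget iv) }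
            where
            lem : ∀ z a b r y w → z + 2 * (a * suc r + b) + 2 * (a * y + b * w) ≡ z + 2 * (a * (y + suc r) + b * suc w)
            lem = solve-∀
          merge : Outcome U′ Q′ → Outcome U Q
          merge (P₂ , un₂ , in₂ , len₂ , sat₂) = q.P ++ P₂
            , subst Unique (sym locs-++) (UniqP.++⁺ q.unique un₂ (λ (x∈₁ , x∈₂) → proj₂ (∖-sub {U = U} {locs q.P} (in₂ x∈₂)) x∈₁))
            , (λ u∈ → inside (∈-++⁻ (locs q.P) (subst (_ ∈_) locs-++ u∈)))
            , trans (length-++ q.P) (trans (cong₂ _+_ lenP len₂) (trans (+-comm (suc res) (sizeᴵ Q′)) (sym sizeQ)))
            , proj₁ (q.sat (q.P ++ P₂) ∈-++⁺ˡ (AllP.++⁻ˡ q.Q all-sat)) ∷ AllP.++⁻ʳ q.Q all-sat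
            where
            locs-++ : locs (q.P ++ P₂) ≡ locs q.P ++ locs P₂
            locs-++ = map-++ proj₂ q.P P₂
            inside : ∀ {u} → u ∈ locs q.P ⊎ u ∈ locs P₂ → U u ≡ true
            inside (inj₁ i) = P⊆U i
            inside (inj₂ i) = proj₁ (∖-sub {U = U} {locs q.P} (in₂ i))
            all-sat : All (Satᴵ (q.P ++ P₂)) Q′
            all-sat = All.map (λ {i} → Satᴵ-mono i (∈-++⁺ʳ q.P)) sat₂

  -- Trees as forests

  module _ {A : Set} where

    mark : ℕ → Forest A → Forest A
    mark K ∅ = ∅
    mark K (br d _ w ch sib) = br d (K <ᵇ residual (mark K ch)) w (mark K ch) (mark K sib)

    mark-size : ∀ K X → size (mark K X) ≡ size X
    mark-size K ∅ = refl
    mark-size K (br d _ w ch sib) = cong suc (cong₂ _+_ (mark-size K ch) (mark-size K sib))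

    mark-width : ∀ K X → width (mark K X) ≡ width X
    mark-width K ∅ = refl
    mark-width K (br d _ w ch sib) = cong suc (mark-width K sib)

    -- Each cut is charged to its vertex and to `K` of the more than `K` uncut vertices below it.
    -- These no longer count as residual further up, so no vertex is charged twice.
    mark-cuts : ∀ K X → suc K * cuts (mark K X) + residual (mark K X) ≤ size X
    mark-cuts K ∅ = ≤-trans (≤-reflexive (trans (+-identityʳ _) (*-zeroʳ (suc K)))) z≤n
    mark-cuts K (br d _ w ch sib) with K <ᵇ residual (mark K ch) in eq
    ... | true = begin
      suc K * suc (c₁ + c₂) + r₂ ≡⟨ lem K c₁ c₂ r₂ ⟩
      suc (K + suc K * c₁ + (suc K * c₂ + r₂)) ≤⟨ s≤s (+-mono-≤ (≤-trans (+-monoˡ-≤ (suc K * c₁) (<⇒≤ (<ᵇ⇒< K r₁ (subst T (sym eq) tt))))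
        (≤-trans (≤-reflexive (+-comm r₁ (suc K * c₁))) (mark-cuts K ch))) (mark-cuts K sib)) ⟩
      suc (size ch + size sib) ∎
      where
      open ≤-Reasoning
      c₁ = cuts (mark K ch)
      c₂ = cuts (mark K sib)
      r₁ = residual (mark K ch)
      r₂ = residual (mark K sib)
      lem : ∀ K a b r → suc K * suc (a + b) + r ≡ suc (K + suc K * a + (suc K * b + r))
      lem = solve-∀
    ... | false = begin
      suc K * (c₁ + c₂) + suc (r₁ + r₂) ≡⟨ lem K c₁ c₂ r₁ r₂ ⟩
      suc ((suc K * c₁ + r₁) + (suc K * c₂ + r₂)) ≤⟨ s≤s (+-mono-≤ (mark-cuts K ch) (mark-cuts K sib)) ⟩
      suc (size ch + size sib) ∎
      where
      open ≤-Reasoning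
      c₁ = cuts (mark K ch)
      c₂ = cuts (mark K sib)
      r₁ = residual (mark K ch)
      r₂ = residual (mark K sib)
      lem : ∀ K a b r s → suc K * (a + b) + suc (r + s) ≡ suc ((suc K * a + r) + (suc K * b + s))
      lem = solve-∀

    Narrow : ℕ → Forest A → Set
    Narrow Δ ∅ = ⊤
    Narrow Δ (br _ _ _ ch sib) = width ch ≤ Δ × Narrow Δ ch × Narrow Δ sib

    mark-Good : ∀ {K Δ} X → Narrow Δ X → Good K Δ (mark K X)
    mark-Good ∅ _ = tt
    mark-Good {K} {Δ} (br d _ w ch sib) (wi , nc , ns) = small , subst (_≤ Δ) (sym (mark-width K ch)) wi , mark-Good ch nc , mark-Good sib ns
      where
      small : (K <ᵇ residual (mark K ch)) ≡ false → residual (mark K ch) ≤ K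
      small e = ≮⇒≥ (λ lt → subst T e (<⇒<ᵇ lt))

    Edge : Set
    Edge = A × Bool × A

    -- (w , d , p) stands for an edge joining p to its child w in direction d.
    EdgeIn : A → Forest A → Edge → Set
    EdgeIn q ∅ e = ⊥
    EdgeIn q (br d _ w ch sib) e = e ≡ (w , d , q) ⊎ EdgeIn w ch e ⊎ EdgeIn q sib e

  module Build {m : ℕ} (G : OrientedGraph m) (tree : IsTree G) where

    open OrientedGraph G

    adj : Fin m → Fin m → Bool
    adj a b = arc a b ∨ arc b a

    UAdj-sym : ∀ {a b} → UAdj G a b → UAdj G b a
    UAdj-sym {a} {b} e with arc a b | arc b a
    ... | true | true = tt
    ... | true | false = tt
    ... | false | true = tt

    Arc : Bool → Fin m → Fin m → Set
    Arc true p w = T (arc p w)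
    Arc false p w = T (arc w p)

    orient : ∀ {p w} → UAdj G p w → ∃ λ d → Arc d p w
    orient {p} {w} e with Equivalence.to (T-∨ {arc p w}) e
    ... | inj₁ a = true , a
    ... | inj₂ a = false , a

    Arc⇒UAdj : ∀ d {p w} → Arc d p w → UAdj G p w
    Arc⇒UAdj true {p} {w} a = Equivalence.from (T-∨ {arc p w}) (inj₁ a)
    Arc⇒UAdj false {p} {w} a = Equivalence.from (T-∨ {arc p w}) (inj₂ a)

    data Path : Fin m → Fin m → List (Fin m) → Set where
      stop : ∀ {a} → Path a a [ a ]
      next : ∀ {a b c xs} → UAdj G a b → Path b c xs → Path a c (a ∷ xs)

    snoc : ∀ {a b c xs} → Path a b xs → UAdj G b c → Path a c (xs ++ [ c ])
    snoc stop e = next e stop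
    snoc (next f p) e = next f (snoc p e)

    close : ∀ {a b c w xs} → UAdj G w a → Path a b xs → UAdj G b c → Linked (UAdj G) (w ∷ xs ++ [ c ])
    close e stop f = e ∷ f ∷ [-]
    close e (next g p) f = e ∷ close g p f

    Path-length : ∀ {a b xs} → Path a b xs → a ≢ b → 2 ≤ length xs
    Path-length stop ne = contradiction refl ne
    Path-length (next _ stop) _ = s≤s (s≤s z≤n)
    Path-length (next _ (next _ _)) _ = s≤s (s≤s z≤n)

    -- Paths are required to be simple and to stay among visited vertices, so that an unvisited
    -- vertex with two visited neighbours closes one of them to a cycle in the sense of `HasCycle`.
    Joined : (Fin m → Bool) → Set
    Joined vis = ∀ a b → vis a ≡ true → vis b ≡ true → ∃ λ xs → Path a b xs × Unique xs × All (λ c → vis c ≡ true) xs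

    unvisited : ∀ {vis : Fin m → Bool} {w xs} → vis w ≡ false → All (λ c → vis c ≡ true) xs → w ∉ xs
    unvisited e al w∈ = true≢false (All.lookup al w∈) e

    -- Two visited neighbours of w, joined by a path of visited vertices, would close a cycle.
    unique-parent : ∀ {vis : Fin m → Bool} {p q w} → Joined vis → vis w ≡ false → vis p ≡ true → UAdj G p w → vis q ≡ true → UAdj G q w → q ≡ p
    unique-parent {vis} {p} {q} {w} jo ¬w vp pw vq qw with p F.≟ q | jo p q vp vq
    ... | yes e | _ = sym e
    ... | no ne | xs , pa , un , al = ⊥-elim (proj₂ tree
          (w , xs , Path-length pa ne , AllP.¬Any⇒All¬ _ (unvisited {vis} ¬w al) ∷ un , close (UAdj-sym {p} {w} pw) pa qw))

    infixl 6 _∪_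
    _∪_ : (Fin m → Bool) → Fin m → Fin m → Bool
    (vis ∪ w) b = vis b ∨ δ w b

    ∪-old : ∀ vis w {b} → vis b ≡ true → (vis ∪ w) b ≡ true
    ∪-old vis w {b} e rewrite e = refl

    ∪-new : ∀ vis w → (vis ∪ w) w ≡ true
    ∪-new vis w rewrite δ-refl w = ∨-zeroʳ (vis w)

    ∪-split : ∀ vis w b → (vis ∪ w) b ≡ true → vis b ≡ true ⊎ w ≡ b
    ∪-split vis w b e with vis b | w F.≟ b
    ... | true | _ = inj₁ refl
    ... | false | yes p = inj₂ p

    ∪-Joined : ∀ {vis : Fin m → Bool} {p w} → Joined vis → vis w ≡ false → vis p ≡ true → UAdj G p w → Joined (vis ∪ w)
    ∪-Joined {vis} {p} {w} jo ¬w vp pw a b va vb with ∪-split vis w a va | ∪-split vis w b vb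
    ... | inj₁ oa | inj₁ ob with jo a b oa ob
    ...   | xs , pa , un , al = xs , pa , un , All.map (∪-old vis w) al
    ∪-Joined {vis} {p} {w} jo ¬w vp pw a b va vb | inj₂ refl | inj₁ ob with jo p b vp ob
    ...   | xs , pa , un , al = w ∷ xs , next (UAdj-sym {p} {w} pw) pa , AllP.¬Any⇒All¬ _ (unvisited {vis} ¬w al) ∷ un
                              , ∪-new vis w ∷ All.map (∪-old vis w) al
    ∪-Joined {vis} {p} {w} jo ¬w vp pw a b va vb | inj₁ oa | inj₂ refl with jo a p oa vp
    ...   | xs , pa , un , al = xs ++ [ w ] , snoc pa pw
                              , UniqP.++⁺ un ([] ∷ []) (λ { (x∈ , here refl) → unvisited {vis} ¬w al x∈ })
                              , AllP.++⁺ (All.map (∪-old vis w) al) (∪-new vis w ∷ [])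
    ∪-Joined {vis} {p} {w} jo ¬w vp pw a b va vb | inj₂ refl | inj₂ refl = [ w ] , stop , [] ∷ [] , ∪-new vis w ∷ []

    -- A search order: every entry attaches an unvisited vertex to its only visited neighbour. That
    -- uniqueness is the form in which acyclicity is handed on to `arcs`.
    data Ext (vis : Fin m → Bool) : List (Edge {Fin m}) → Set where
      done : (∀ b → vis b ≡ true) → Ext vis []
      grow : ∀ {w d p ℓ} → vis p ≡ true → vis w ≡ false → Arc d p w →
        (∀ q → vis q ≡ true → UAdj G q w → q ≡ p) → Ext (vis ∪ w) ℓ → Ext vis ((w , d , p) ∷ ℓ)

    crossing-edge : ∀ {vis : Fin m → Bool} {u w} → Reach G u w → vis u ≡ true → vis w ≡ false →
      ∃ λ p → ∃ λ w′ → vis p ≡ true × vis w′ ≡ false × UAdj G p w′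
    crossing-edge here vu vw = ⊥-elim (true≢false vu vw)
    crossing-edge {vis} (step {v} {w} r e) vu vw with vis v in eq
    ... | true = v , w , eq , vw , e
    ... | false = crossing-edge r vu eq

    ∪-card : ∀ vis w → vis w ≡ false → ∑ (λ b → ⟦ not ((vis ∪ w) b) ⟧) + 1 ≡ ∑ (λ b → ⟦ not (vis b) ⟧)
    ∪-card vis w ¬w = trans (cong (∑ (λ b → ⟦ not ((vis ∪ w) b) ⟧) +_) (sym (∑-δ w (λ _ → 1))))
      (trans (sym (∑-distrib-+ (λ b → ⟦ not ((vis ∪ w) b) ⟧) _)) (sum-cong-≗ pt))
      where
      pt : ∀ b → ⟦ not (vis b ∨ δ w b) ⟧ + ⟦ δ w b ⟧ * 1 ≡ ⟦ not (vis b) ⟧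
      pt b with w F.≟ b
      ... | yes refl rewrite ¬w = refl
      ... | no _ with vis b
      ...   | true = refl
      ...   | false = refl

    all-visited : ∀ {vis : Fin m → Bool} → ¬ (∃ λ b → vis b ≡ false) → ∀ b → vis b ≡ true
    all-visited {vis} none b with vis b in eq
    ... | true = refl
    ... | false = contradiction (b , eq) none

    extend : ∀ fuel vis t → vis t ≡ true → Joined vis → ∑ (λ b → ⟦ not (vis b) ⟧) ≤ fuel → ∃ (Ext vis)
    extend zero vis t vt jo le = [] , done (all-visited {vis} (λ (b , e) →
      contradiction (≤-trans (≤∑ (λ b → ⟦ not (vis b) ⟧) b) le) (subst (λ c → ¬ ⟦ not c ⟧ ≤ 0) (sym e) λ ())))
    extend (suc fuel) vis t vt jo le with any? (λ b → vis b B.≟ false)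
    ... | no none = [] , done (all-visited {vis} none)
    ... | yes (w₀ , ¬w₀) with crossing-edge {vis} (proj₁ tree t w₀) vt ¬w₀
    ...   | p , w , vp , ¬w , pw with extend fuel (vis ∪ w) t (∪-old vis w vt) (∪-Joined jo ¬w vp pw)
              (≤-pred (subst (_≤ suc fuel) (trans (sym (∪-card vis w ¬w)) (+-comm _ 1)) le))
    ...     | ℓ , ext = (w , proj₁ (orient {p} {w} pw) , p) ∷ ℓ
              , grow vp ¬w (proj₂ (orient {p} {w} pw)) (λ q vq qw → unique-parent {vis} jo ¬w vp pw vq qw) ext

    -- In a search order the children of `w` come after the edge attaching `w`, so both recursive
    -- calls can work on the tail. The flag `true` is provisional; `mark` decides the cuts.
    forestOf : Fin m → List (Edge {Fin m}) → Forest (Fin m)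
    forestOf q [] = ∅
    forestOf q ((w , d , p) ∷ ℓ) with p F.≟ q
    ... | yes _ = br d true w (forestOf w ℓ) (forestOf q ℓ)
    ... | no _ = forestOf q ℓ

    size-forestOf : ∀ q w d p ℓ → size (forestOf q ((w , d , p) ∷ ℓ)) ≡ ⟦ δ p q ⟧ * suc (size (forestOf w ℓ)) + size (forestOf q ℓ)
    size-forestOf q w d p ℓ with p F.≟ q
    ... | yes _ = cong (λ y → suc (y + size (forestOf q ℓ))) (sym (+-identityʳ _))
    ... | no _ = refl

    width-forestOf : ∀ q w d p ℓ → width (forestOf q ((w , d , p) ∷ ℓ)) ≡ ⟦ δ p q ⟧ + width (forestOf q ℓ)
    width-forestOf q w d p ℓ with p F.≟ q
    ... | yes _ = refl
    ... | no _ = refl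

    -- Every edge of the list is counted below exactly one visited vertex. Visiting `w` moves its
    -- forest from below `p` to an entry of its own; adding `σ` to both sides expresses this without
    -- subtraction.
    size-sum : ∀ {vis ℓ} → Ext vis ℓ → ∑ (λ q → ⟦ vis q ⟧ * size (forestOf q ℓ)) ≡ length ℓ
    size-sum {vis} (done _) = trans (sum-cong-≗ (λ q → *-zeroʳ ⟦ vis q ⟧)) (∑-zero {m})
    size-sum {vis} (grow {w} {d} {p} {ℓ} vp ¬w _ _ ext) = +-cancelʳ-≡ σ _ _ (begin
      ∑ (λ q → ⟦ vis q ⟧ * size (forestOf q ((w , d , p) ∷ ℓ))) + σ
        ≡⟨ cong (∑ (λ q → ⟦ vis q ⟧ * size (forestOf q ((w , d , p) ∷ ℓ))) +_) (sym (∑-δ w (λ q → size (forestOf q ℓ)))) ⟩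
      ∑ (λ q → ⟦ vis q ⟧ * size (forestOf q ((w , d , p) ∷ ℓ))) + ∑ (λ q → ⟦ δ w q ⟧ * size (forestOf q ℓ))
        ≡⟨ sym (∑-distrib-+ (λ q → ⟦ vis q ⟧ * size (forestOf q ((w , d , p) ∷ ℓ))) _) ⟩
      ∑ (λ q → ⟦ vis q ⟧ * size (forestOf q ((w , d , p) ∷ ℓ)) + ⟦ δ w q ⟧ * size (forestOf q ℓ)) ≡⟨ sum-cong-≗ pt ⟩
      ∑ (λ q → ⟦ δ p q ⟧ * suc σ + ⟦ (vis ∪ w) q ⟧ * size (forestOf q ℓ)) ≡⟨ ∑-distrib-+ (λ q → ⟦ δ p q ⟧ * suc σ) _ ⟩
      ∑ (λ q → ⟦ δ p q ⟧ * suc σ) + ∑ (λ q → ⟦ (vis ∪ w) q ⟧ * size (forestOf q ℓ)) ≡⟨ cong₂ _+_ (∑-δ p (λ _ → suc σ)) (size-sum ext) ⟩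
      suc σ + length ℓ ≡⟨ cong suc (+-comm σ (length ℓ)) ⟩
      suc (length ℓ) + σ ∎)
      where
      open ≡-Reasoning
      σ = size (forestOf w ℓ)
      guard : ∀ q y → ⟦ vis q ⟧ * (⟦ δ p q ⟧ * y) ≡ ⟦ δ p q ⟧ * y
      guard q y with p F.≟ q
      ... | yes refl rewrite vp = +-identityʳ _
      ... | no _ = *-zeroʳ ⟦ vis q ⟧
      merge : ∀ q → ⟦ vis q ⟧ + ⟦ δ w q ⟧ ≡ ⟦ (vis ∪ w) q ⟧
      merge q with w F.≟ q
      ... | yes refl rewrite ¬w = refl
      ... | no _ with vis q
      ...   | true = refl
      ...   | false = refl
      pt : ∀ q → ⟦ vis q ⟧ * size (forestOf q ((w , d , p) ∷ ℓ)) + ⟦ δ w q ⟧ * size (forestOf q ℓ)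
        ≡ ⟦ δ p q ⟧ * suc σ + ⟦ (vis ∪ w) q ⟧ * size (forestOf q ℓ)
      pt q = begin
        ⟦ vis q ⟧ * size (forestOf q ((w , d , p) ∷ ℓ)) + ⟦ δ w q ⟧ * z ≡⟨ cong (λ y → ⟦ vis q ⟧ * y + ⟦ δ w q ⟧ * z) (size-forestOf q w d p ℓ) ⟩
        ⟦ vis q ⟧ * (⟦ δ p q ⟧ * suc σ + z) + ⟦ δ w q ⟧ * z ≡⟨ lem ⟦ vis q ⟧ (⟦ δ p q ⟧ * suc σ) z ⟦ δ w q ⟧ ⟩
        ⟦ vis q ⟧ * (⟦ δ p q ⟧ * suc σ) + (⟦ vis q ⟧ + ⟦ δ w q ⟧) * z ≡⟨ cong₂ (λ a b → a + b * z) (guard q (suc σ)) (merge q) ⟩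
        ⟦ δ p q ⟧ * suc σ + ⟦ (vis ∪ w) q ⟧ * z ∎
        where
        z = size (forestOf q ℓ)
        lem : ∀ v y z e → v * (y + z) + e * z ≡ v * y + (v + e) * z
        lem = solve-∀

    Ext-card : ∀ {vis ℓ} → Ext vis ℓ → ∑ (λ b → ⟦ not (vis b) ⟧) ≡ length ℓ
    Ext-card {vis} (done all) = trans (sum-cong-≗ (λ b → cong (λ c → ⟦ not c ⟧) (all b))) (∑-zero {m})
    Ext-card {vis} (grow {w} vp ¬w _ _ ext) = trans (sym (∪-card vis w ¬w)) (trans (+-comm _ 1) (cong suc (Ext-card ext)))

    -- An attached vertex becomes visited and cannot be attached again, so the children of `q` are
    -- distinct unvisited neighbours of `q`.
    width-bound : ∀ {vis ℓ} → Ext vis ℓ → ∀ q → width (forestOf q ℓ) ≤ ∑ (λ b → ⟦ adj q b ∧ not (vis b) ⟧)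
    width-bound (done _) q = z≤n
    width-bound {vis} (grow {w} {d} {p} {ℓ} vp ¬w a _ ext) q = begin
      width (forestOf q ((w , d , p) ∷ ℓ)) ≡⟨ width-forestOf q w d p ℓ ⟩
      ⟦ δ p q ⟧ + width (forestOf q ℓ) ≤⟨ +-monoʳ-≤ ⟦ δ p q ⟧ (width-bound ext q) ⟩
      ⟦ δ p q ⟧ + ∑ (λ b → ⟦ adj q b ∧ not ((vis ∪ w) b) ⟧) ≡⟨ cong (_+ ∑ (λ b → ⟦ adj q b ∧ not ((vis ∪ w) b) ⟧)) (sym (∑-δ w (λ _ → ⟦ δ p q ⟧))) ⟩
      ∑ (λ b → ⟦ δ w b ⟧ * ⟦ δ p q ⟧) + ∑ (λ b → ⟦ adj q b ∧ not ((vis ∪ w) b) ⟧) ≡⟨ sym (∑-distrib-+ (λ b → ⟦ δ w b ⟧ * ⟦ δ p q ⟧) _) ⟩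
      ∑ (λ b → ⟦ δ w b ⟧ * ⟦ δ p q ⟧ + ⟦ adj q b ∧ not ((vis ∪ w) b) ⟧) ≤⟨ ∑-mono pt ⟩
      ∑ (λ b → ⟦ adj q b ∧ not (vis b) ⟧) ∎
      where
      open ≤-Reasoning
      pt : ∀ b → ⟦ δ w b ⟧ * ⟦ δ p q ⟧ + ⟦ adj q b ∧ not (vis b ∨ δ w b) ⟧ ≤ ⟦ adj q b ∧ not (vis b) ⟧
      pt b with w F.≟ b | p F.≟ q
      ... | yes refl | yes refl rewrite ¬w with adj p w | Arc⇒UAdj d a
      ...   | true | _ = ≤-refl
      pt b | yes refl | no _ rewrite ¬w with adj q w
      ...   | true = z≤n
      ...   | false = z≤n
      pt b | no _ | _ with vis b
      ...   | true = ≤-refl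
      ...   | false = ≤-refl

    width≤udeg : ∀ {vis ℓ} → Ext vis ℓ → ∀ q → width (forestOf q ℓ) ≤ udeg G q
    width≤udeg {vis} ext q = ≤-trans (width-bound ext q) (≤-trans (∑-mono (λ b → pt (adj q b) (vis b))) (≤-reflexive (sym (countTrue≡∑ (adj q)))))
      where
      pt : ∀ x y → ⟦ x ∧ not y ⟧ ≤ ⟦ x ⟧
      pt true y = ⟦⟧≤1 (not y)
      pt false _ = z≤n

    forestOf-Narrow : ∀ {Δ vis ℓ} → (∀ q → udeg G q ≤ Δ) → Ext vis ℓ → ∀ q → Narrow Δ (forestOf q ℓ)
    forestOf-Narrow dg (done _) q = tt
    forestOf-Narrow dg (grow {w} {d} {p} {ℓ} _ _ _ _ ext) q with p F.≟ q
    ... | yes _ = ≤-trans (width≤udeg ext w) (dg w) , forestOf-Narrow dg ext w , forestOf-Narrow dg ext q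
    ... | no _ = forestOf-Narrow dg ext q

    EdgeIn-later : ∀ q e₀ ℓ {e} → EdgeIn q (forestOf q ℓ) e → EdgeIn q (forestOf q (e₀ ∷ ℓ)) e
    EdgeIn-later q (w , d , p) ℓ i with p F.≟ q
    ... | yes _ = inj₂ (inj₂ i)
    ... | no _ = i

    EdgeIn-child : ∀ w d p ℓ {e} → EdgeIn w (forestOf w ℓ) e → EdgeIn p (forestOf p ((w , d , p) ∷ ℓ)) e
    EdgeIn-child w d p ℓ i with p F.≟ p
    ... | yes _ = inj₂ (inj₁ i)
    ... | no ne = contradiction refl ne

    EdgeIn-here : ∀ w d p ℓ → EdgeIn p (forestOf p ((w , d , p) ∷ ℓ)) (w , d , p)
    EdgeIn-here w d p ℓ with p F.≟ p
    ... | yes _ = inj₁ refl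
    ... | no ne = contradiction refl ne

    covered : ∀ {vis ℓ e} → Ext vis ℓ → e ∈ ℓ → ∃ λ q → vis q ≡ true × EdgeIn q (forestOf q ℓ) e
    covered (grow {w} {d} {p} {ℓ} vp _ _ _ _) (here refl) = p , vp , EdgeIn-here w d p ℓ
    covered {vis} (grow {w} {d} {p} {ℓ} vp _ _ _ ext) (there i) with covered ext i
    ... | q , vq , iq with ∪-split vis w q vq
    ...   | inj₁ old = q , old , EdgeIn-later q (w , d , p) ℓ iq
    ...   | inj₂ refl = p , vp , EdgeIn-child w d p ℓ iq

    -- An arc appears when its second end is attached: the first end is then a visited neighbour,
    -- hence the recorded parent, and `antisym` excludes the opposite direction.
    arcs : ∀ {vis ℓ} → Ext vis ℓ → ∀ a b → T (arc a b) →
      (vis a ≡ true × vis b ≡ true) ⊎ ((b , true , a) ∈ ℓ ⊎ (a , false , b) ∈ ℓ)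
    arcs (done all) a b _ = inj₁ (all a , all b)
    arcs {vis} (grow {w} {d} {p} vp ¬w ar only ext) a b ab with arcs ext a b ab
    ... | inj₂ (inj₁ i) = inj₂ (inj₁ (there i))
    ... | inj₂ (inj₂ i) = inj₂ (inj₂ (there i))
    ... | inj₁ (va , vb) with ∪-split vis w a va | ∪-split vis w b vb
    ...   | inj₁ oa | inj₁ ob = inj₁ (oa , ob)
    ...   | inj₂ refl | inj₂ refl = ⊥-elim (subst T (loopless a) ab)
    arcs {vis} (grow {w} {d} {p} vp ¬w ar only ext) a b ab | inj₁ (va , vb) | inj₁ oa | inj₂ refl
      with only a oa (Arc⇒UAdj true ab) | d
    ... | refl | true = inj₂ (inj₁ (here refl))
    ... | refl | false = ⊥-elim (antisym a b ab ar)
    arcs {vis} (grow {w} {d} {p} vp ¬w ar only ext) a b ab | inj₁ (va , vb) | inj₂ refl | inj₁ ob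
      with only b ob (Arc⇒UAdj false ab) | d
    ... | refl | true = ⊥-elim (antisym a b ab ar)
    ... | refl | false = inj₂ (inj₂ (here refl))

    labels : ∀ {vis ℓ} → Ext vis ℓ → ∀ b → vis b ≡ true ⊎ (∃ λ e → (b , e) ∈ ℓ)
    labels (done all) b = inj₁ (all b)
    labels {vis} (grow {w} {d} {p} _ _ _ _ ext) b with labels ext b
    ... | inj₂ (e , i) = inj₂ (e , there i)
    ... | inj₁ vb with ∪-split vis w b vb
    ...   | inj₁ ob = inj₁ ob
    ...   | inj₂ refl = inj₂ (_ , here refl)

    record Unrolled (t : Fin m) : Set where
      field
        X : Forest (Fin m)
        size-X : suc (size X) ≡ m
        width-X : width X ≤ udeg G t
        narrow : ∀ {Δ} → (∀ q → udeg G q ≤ Δ) → Narrow Δ X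
        arc-edge : ∀ a b → T (arc a b) → EdgeIn t X (b , true , a) ⊎ EdgeIn t X (a , false , b)
        label-edge : ∀ b → t ≡ b ⊎ (∃ λ e → EdgeIn t X (b , e))

    unroll : ∀ t → Unrolled t
    unroll t = from (extend _ (δ t) t (δ-refl t) joined ≤-refl)
      where
      δ⇒≡ : ∀ {b} → δ t b ≡ true → t ≡ b
      δ⇒≡ {b} e with t F.≟ b
      ... | yes p = p
      joined : Joined (δ t)
      joined a b va vb with δ⇒≡ va | δ⇒≡ vb
      ... | refl | refl = [ t ] , stop , [] ∷ [] , δ-refl t ∷ []
      from : ∃ (Ext (δ t)) → Unrolled t
      from (ℓ , ext) = record
        { X = forestOf t ℓ
        ; size-X = trans (+-comm 1 _) (trans (cong₂ _+_ (trans (trans (sym (∑-δ t (λ q → size (forestOf q ℓ)))) (size-sum ext)) (sym (Ext-card ext)))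
                     (trans (sym (∑-δ t (λ _ → 1))) (sum-cong-≗ (λ b → *-identityʳ ⟦ δ t b ⟧)))) total)
        ; width-X = width≤udeg ext t
        ; narrow = λ dg → forestOf-Narrow dg ext t
        ; arc-edge = λ a b ab → arc-case a b ab (arcs ext a b ab)
        ; label-edge = λ b → label-case b (labels ext b) }
        where
        total : ∑ (λ b → ⟦ not (δ t b) ⟧) + ∑ (λ b → ⟦ δ t b ⟧) ≡ m
        total = trans (sym (∑-distrib-+ (λ b → ⟦ not (δ t b) ⟧) _)) (trans (sum-cong-≗ (λ b → pt (δ t b))) (trans (∑-const {m} 1) (*-identityʳ m)))
          where
          pt : ∀ x → ⟦ not x ⟧ + ⟦ x ⟧ ≡ 1
          pt true = refl
          pt false = refl
        rooted : ∀ {e} → e ∈ ℓ → EdgeIn t (forestOf t ℓ) e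
        rooted i with covered ext i
        ... | q , vq , iq with δ⇒≡ vq
        ...   | refl = iq
        arc-case : ∀ a b → T (arc a b) → (δ t a ≡ true × δ t b ≡ true) ⊎ ((b , true , a) ∈ ℓ ⊎ (a , false , b) ∈ ℓ) →
          EdgeIn t (forestOf t ℓ) (b , true , a) ⊎ EdgeIn t (forestOf t ℓ) (a , false , b)
        arc-case a b ab (inj₂ (inj₁ i)) = inj₁ (rooted i)
        arc-case a b ab (inj₂ (inj₂ i)) = inj₂ (rooted i)
        arc-case a b ab (inj₁ (va , vb)) with δ⇒≡ va | δ⇒≡ vb
        ... | refl | refl = ⊥-elim (subst T (loopless t) ab)
        label-case : ∀ b → δ t b ≡ true ⊎ (∃ λ e → (b , e) ∈ ℓ) → t ≡ b ⊎ (∃ λ e → EdgeIn t (forestOf t ℓ) (b , e))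
        label-case b (inj₁ v) = inj₁ (δ⇒≡ v)
        label-case b (inj₂ (e , i)) = inj₂ (e , rooted i)

  -- From a finished assignment to an embedding.

  single-location : ∀ {A B : Set} {a a′ : A} {b : B} (P : List (A × B)) → Unique (map proj₂ P) → (a , b) ∈ P → (a′ , b) ∈ P → a ≡ a′
  single-location _ _ (here refl) (here refl) = refl
  single-location (_ ∷ P) (b∉ ∷ _) (here refl) (there j) = contradiction (∈-map⁺ proj₂ j) (AllP.All¬⇒¬Any b∉)
  single-location (_ ∷ P) (b∉ ∷ _) (there i) (here refl) = contradiction (∈-map⁺ proj₂ i) (AllP.All¬⇒¬Any b∉)
  single-location (_ ∷ P) (_ ∷ un) (there i) (there j) = single-location P un i j

  -- Pigeonhole on positions: the pairs (a , φ a) take `m` distinct positions in a list of length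
  -- `m`, so a pair at a further position would give an injection from `suc m` positions into `m`.
  single-valued : ∀ {m} {B : Set} (P : List (Fin m × B)) → length P ≡ m → (φ : Fin m → B) → (∀ a → (a , φ a) ∈ P) →
    ∀ {a b} → (a , b) ∈ P → b ≡ φ a
  single-valued {m} P len φ φ∈ {a} {b} ab∈ with index ab∈ F.≟ index (φ∈ a)
  ... | yes e = cong proj₂ (trans (lookup-index ab∈) (trans (cong (lookup P) e) (sym (lookup-index (φ∈ a)))))
  ... | no ne = contradiction (injective⇒≤ {f = f} f-injective) (subst (λ k → ¬ suc m ≤ k) (sym len) (<-irrefl refl))
    where
    f : Fin (suc m) → Fin (length P)
    f zero = index ab∈
    f (suc c) = index (φ∈ c)
    at : ∀ {x y} {i : Fin (length P)} → x ≡ lookup P i → y ≡ lookup P i → x ≡ y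
    at p q = trans p (sym q)
    first : ∀ {c} → index ab∈ ≡ index (φ∈ c) → a ≡ c
    first {c} e = cong proj₁ (trans (lookup-index ab∈) (trans (cong (lookup P) e) (sym (lookup-index (φ∈ c)))))
    f-injective : ∀ {x y} → f x ≡ f y → x ≡ y
    f-injective {zero} {zero} _ = refl
    f-injective {zero} {suc c} e with first e
    ... | refl = contradiction e ne
    f-injective {suc c} {zero} e with first (sym e)
    ... | refl = contradiction (sym e) ne
    f-injective {suc c} {suc c′} e = cong suc (cong proj₁ (trans (lookup-index (φ∈ c)) (trans (cong (lookup P) e) (sym (lookup-index (φ∈ c′))))))

  module Unfold {A : Set} {n : ℕ} (Adj : Bool → Fin n → Fin n → Set) where

    open Placing {A} Adj

    unmark : ∀ {P} K X {u} → Sat P u (mark K X) → Sat P u X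
    unmark K ∅ _ = tt
    unmark K (br d _ w ch sib) ((u′ , i , a , s) , r) = (u′ , i , a , unmark K ch s) , unmark K sib r

    edge-image : ∀ {P} X {q u w d p} → Sat P u X → (q , u) ∈ P → EdgeIn q X (w , d , p) →
      ∃ λ u₁ → ∃ λ u₂ → (p , u₁) ∈ P × (w , u₂) ∈ P × Adj d u₁ u₂
    edge-image (br d _ w ch sib) ((u′ , i , a , s) , r) qu (inj₁ refl) = _ , u′ , qu , i , a
    edge-image (br d _ w ch sib) ((u′ , i , a , s) , r) qu (inj₂ (inj₁ e)) = edge-image ch s i e
    edge-image (br d _ w ch sib) ((u′ , i , a , s) , r) qu (inj₂ (inj₂ e)) = edge-image sib r qu e

    -- The image of `t` is prescribed and cannot be chosen like the root of a component. So every
    -- child of `t` starts its own component whatever its flag, which costs at most `width X`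
    -- additional roots.
    items : Fin n → Forest A → List Item
    items v ∅ = []
    items v (br d _ w ch sib) = item d v w ch ∷ items v sib

    items-size : ∀ v X → sizeᴵ (items v X) ≡ size X
    items-size v ∅ = refl
    items-size v (br d _ w ch sib) = cong (λ y → suc (size ch + y)) (items-size v sib)

    items-cuts : ∀ v X → cutsᴵ (items v X) ≤ width X + cuts X
    items-cuts v ∅ = z≤n
    items-cuts v (br d c w ch sib) = s≤s (≤-trans (+-monoʳ-≤ (cuts ch) (items-cuts v sib))
      (≤-trans (≤-reflexive (lem (cuts ch) (width sib) (cuts sib))) (+-monoʳ-≤ (width sib) (cut c))))
      where
      lem : ∀ a b c → a + (b + c) ≡ b + (a + c)
      lem = solve-∀
      cut : ∀ c → cuts ch + cuts sib ≤ cuts (br d c w ch sib)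
      cut true = n≤1+n _
      cut false = ≤-refl

    items-Good : ∀ {K Δ} v X → Good K Δ X → All (Goodᴵ K Δ) (items v X)
    items-Good v ∅ _ = []
    items-Good v (br d _ w ch sib) (_ , wi , gc , gs) = (wi , gc) ∷ items-Good v sib gs

    items-Sat : ∀ {P} v X → All (Satᴵ P) (items v X) → Sat P v X
    items-Sat v ∅ _ = tt
    items-Sat v (br d _ w ch sib) (s ∷ al) = s , items-Sat v sib al

  -- e stands for 1/ε.
  module Constants (p e : ℕ) where
    ρ C E K θ Γ : ℕ
    ρ = 18 * p
    C = 8 * p
    E = 60 * ρ * e
    K = 32 * ρ * C * e
    θ = suc E * suc K
    Γ = 64 * e * p * suc E * suc θ * ρ

  -- The initial state and the constants.

  greatest : ∀ c Y → 1 ≤ c → ∃ λ x → c * x ≤ Y × (∀ y → c * y ≤ Y → y ≤ x)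
  greatest c@(suc _) Y _ = Y / c , ≤-trans (≤-reflexive (*-comm c _)) (m/n*n≤m Y c)
    , λ y le → subst (_≤ Y / c) (m*n/n≡m y c) (/-monoˡ-≤ c (subst (_≤ Y) (*-comm c y) le))

  module Core (p e : ℕ) (1≤p : 1 ≤ p) (1≤e : 1 ≤ e) {n m : ℕ} (Dg : Digraph n) (v : Fin n) (Tr : OrientedTree m) (t : Fin m)
    (out : ∀ u → (p + 2) * n ≤ 2 * p * card (λ w → Digraph.adj Dg u w))
    (inn : ∀ u → (p + 2) * n ≤ 2 * p * card (λ w → Digraph.adj Dg w u))
    (room : e * m + n ≤ e * n) (L Δ : ℕ) (n<2^L : n ≤ 2 ^ suc L)
    (deg≤Δ : ∀ a → udeg (OrientedTree.graph Tr) a ≤ Δ)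
    (large : Constants.Γ p e * (suc (suc L) * suc (suc (Constants.K p e) * Δ)) ≤ n)
    where

    open Constants p e
    open OrientedTree Tr
    open Build graph isTree
    open Unrolled (unroll t)

    s N₀ D j : ℕ
    s = suc (suc K * Δ)
    N₀ = pred n
    D = n ∸ m
    j = pred (ρ * suc (suc L))

    Nb : Bool → Fin n → Fin n → Bool
    Nb true u w = Digraph.adj Dg u w
    Nb false u w = Digraph.adj Dg w u

    Nb-sym : ∀ d u w → Nb (not d) w u ≡ Nb d u w
    Nb-sym true u w = refl
    Nb-sym false u w = refl

    open Test-sets Nb

    1≤ρ : 1 ≤ ρ
    1≤ρ = *-pos {18} (s≤s z≤n) 1≤p

    1≤E : 1 ≤ E
    1≤E = *-mono-≤ (*-pos {60} (s≤s z≤n) 1≤ρ) 1≤e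

    1≤n : 1 ≤ n
    1≤n = positive v
      where
      positive : ∀ {n} → Fin n → 1 ≤ n
      positive zero = s≤s z≤n
      positive (suc _) = s≤s z≤n

    n≡ : n ≡ suc N₀
    n≡ = sym (suc-pred n {{>-nonZero 1≤n}})

    M≡ : suc j ≡ ρ * suc (suc L)
    M≡ = suc-pred (ρ * suc (suc L)) {{>-nonZero (*-mono-≤ 1≤ρ (s≤s z≤n))}}

    m≤n : m ≤ n
    m≤n = *-cancelˡ-≤ e {{>-nonZero 1≤e}} (≤-trans (m≤m+n (e * m) n) room)

    n≡m+D : n ≡ m + D
    n≡m+D = sym (m+[n∸m]≡n m≤n)

    n≤eD : n ≤ e * D
    n≤eD = +-cancelˡ-≤ (e * m) n (e * D) (≤-trans room (≤-reflexive (trans (cong (e *_) n≡m+D) (*-distribˡ-+ e m D))))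

    -- `Γ` is a common multiple of the constants in `D-large` and `M-small`, with a further factor
    -- `e` because only D ≥ n/e is known. Hence the single hypothesis `large` yields both.
    Γs : ∀ x → e * x ≤ Γ * (suc (suc L) * s) → x ≤ D
    Γs x le = *-cancelˡ-≤ e {{>-nonZero 1≤e}} (≤-trans le (≤-trans large n≤eD))

    D-large : 64 * p * suc E * (suc θ * s) ≤ D
    D-large = Γs _ (begin
      e * (64 * p * suc E * (suc θ * s)) ≡⟨ lem e p (suc E) (suc θ) s ⟩
      64 * e * p * suc E * suc θ * 1 * (1 * s) ≤⟨ *-mono-≤ (*-monoʳ-≤ (64 * e * p * suc E * suc θ) 1≤ρ) (*-monoˡ-≤ s (s≤s {0} {suc L} z≤n)) ⟩
      Γ * (suc (suc L) * s) ∎)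
      where
      open ≤-Reasoning
      lem : ∀ e p E θ s → e * (64 * p * E * (θ * s)) ≡ 64 * e * p * E * θ * 1 * (1 * s)
      lem = solve-∀

    M-small : suc E * (suc j * s) ≤ D
    M-small = Γs _ (begin
      e * (suc E * (suc j * s)) ≡⟨ cong (λ y → e * (suc E * (y * s))) M≡ ⟩
      e * (suc E * (ρ * suc (suc L) * s)) ≡⟨ lem e (suc E) ρ (suc (suc L)) s ⟩
      1 * e * 1 * suc E * 1 * ρ * (suc (suc L) * s)
        ≤⟨ *-monoˡ-≤ (suc (suc L) * s) (*-monoˡ-≤ ρ (*-mono-≤ (*-monoˡ-≤ (suc E) (*-mono-≤ (*-monoˡ-≤ e {1} {64} (s≤s z≤n)) 1≤p)) (s≤s {0} {θ} z≤n))) ⟩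
      Γ * (suc (suc L) * s) ∎)
      where
      open ≤-Reasoning
      lem : ∀ e E ρ L s → e * (E * (ρ * L * s)) ≡ 1 * e * 1 * E * 1 * ρ * (L * s)
      lem = solve-∀

    -- By Bernoulli (1 + 1/ρ)^ρ is at least 2, so the exponent ρ(L + 2) yields 2^(L+2), which is at
    -- least 2n.
    M-large : 2 * n * ρ ^ suc j ≤ suc ρ ^ suc j
    M-large = subst (λ M → 2 * n * ρ ^ M ≤ suc ρ ^ M) (sym M≡) (begin
      2 * n * ρ ^ (ρ * suc (suc L)) ≡⟨ cong (2 * n *_) (sym (^-*-assoc ρ ρ (suc (suc L)))) ⟩
      2 * n * (ρ ^ ρ) ^ suc (suc L) ≤⟨ *-monoˡ-≤ ((ρ ^ ρ) ^ suc (suc L)) (*-monoʳ-≤ 2 n<2^L) ⟩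
      2 ^ suc (suc L) * (ρ ^ ρ) ^ suc (suc L) ≡⟨ sym (^-distrib 2 (ρ ^ ρ) (suc (suc L))) ⟩
      (2 * ρ ^ ρ) ^ suc (suc L) ≤⟨ ^-monoˡ-≤ (suc (suc L)) (double ρ 1≤ρ) ⟩
      (suc ρ ^ ρ) ^ suc (suc L) ≡⟨ ^-*-assoc (suc ρ) ρ (suc (suc L)) ⟩
      suc ρ ^ (ρ * suc (suc L)) ∎)
      where
      open ≤-Reasoning
      double : ∀ r → 1 ≤ r → 2 * r ^ r ≤ suc r ^ r
      double r@(suc i) _ = begin
        2 * r ^ r ≡⟨ lem r (r ^ i) ⟩
        r ^ i * (r + r * 1) ≤⟨ bernoulli r 1 i ⟩
        (r + 1) ^ r ≡⟨ cong (_^ r) (+-comm r 1) ⟩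
        suc r ^ r ∎
        where
        lem : ∀ r x → 2 * (r * x) ≡ x * (r + r * 1)
        lem = solve-∀

    U₀ : Fin n → Bool
    U₀ u = not (δ v u)

    card-U₀ : card U₀ ≡ N₀
    card-U₀ = +-cancelʳ-≡ 1 _ _ (begin
      card U₀ + 1 ≡⟨ cong (card U₀ +_) (sym (trans (sum-cong-≗ (λ u → sym (*-identityʳ ⟦ δ v u ⟧))) (∑-δ v (λ _ → 1)))) ⟩
      card U₀ + card (δ v) ≡⟨ sym (∑-distrib-+ (λ u → ⟦ U₀ u ⟧) _) ⟩
      ∑ (λ u → ⟦ not (δ v u) ⟧ + ⟦ δ v u ⟧) ≡⟨ sum-cong-≗ (λ u → pt (δ v u)) ⟩
      ∑ {n} (λ _ → 1) ≡⟨ trans (∑-const {n} 1) (*-identityʳ n) ⟩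
      n ≡⟨ trans n≡ (+-comm 1 N₀) ⟩
      N₀ + 1 ∎)
      where
      open ≡-Reasoning
      pt : ∀ b → ⟦ not b ⟧ + ⟦ b ⟧ ≡ 1
      pt true = refl
      pt false = refl

    Nb-degree : ∀ d u → (p + 2) * n ≤ 2 * p * card (Nb d u)
    Nb-degree true = out
    Nb-degree false = inn

    test-degree : ∀ i → (p + 2) * n ≤ 2 * p * card (test i)
    test-degree i with F.splitAt n i
    ... | inj₁ u = Nb-degree true u
    ... | inj₂ u = Nb-degree false u

    p≤n : p ≤ n
    p≤n = ≤-trans (m≤n*m p (64 * 1)) (≤-trans (≤-trans (≤-trans (m≤m*n (64 * p) (suc E)) (m≤m*n (64 * p * suc E) (suc θ * s))) D-large) (m∸n≤m n m))

    -- The degree hypothesis gives 2p x ≤ (3p - 2)N₀ + p - 2. The loss p - 2 comes from giving up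
    -- `v`, and the spare `N₀` absorbs it since p ≤ n.
    x-start : ∀ i → 2 * p * x U₀ i + N₀ ≤ 3 * p * N₀
    x-start i = +-cancelʳ-≤ ((p + 1) * N₀ + 2 + (p + 2) * n) _ _ (begin
      2 * p * x U₀ i + N₀ + ((p + 1) * N₀ + 2 + (p + 2) * n) ≤⟨ +-monoˡ-≤ _ (+-monoˡ-≤ N₀ (*-monoʳ-≤ (2 * p) (+-mono-≤ (≤-reflexive card-U₀) (∑-mono (λ u → pt (U₀ u) (test i u)))))) ⟩
      2 * p * (N₀ + b) + N₀ + ((p + 1) * N₀ + 2 + (p + 2) * n) ≤⟨ +-monoʳ-≤ (2 * p * (N₀ + b) + N₀) (+-monoʳ-≤ ((p + 1) * N₀ + 2) (test-degree i)) ⟩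
      2 * p * (N₀ + b) + N₀ + ((p + 1) * N₀ + 2 + 2 * p * card (test i)) ≡⟨ lem₁ p N₀ b (card (test i)) ⟩
      2 * p * (b + card (test i)) + (3 * p * N₀ + 2 * N₀ + 2) ≡⟨ cong (λ y → 2 * p * y + (3 * p * N₀ + 2 * N₀ + 2)) co-card ⟩
      2 * p * n + (3 * p * N₀ + 2 * N₀ + 2) ≡⟨ cong (λ y → 2 * p * y + (3 * p * N₀ + 2 * N₀ + 2)) n≡ ⟩
      2 * p * suc N₀ + (3 * p * N₀ + 2 * N₀ + 2) ≡⟨ lem₂ p N₀ ⟩
      p + (5 * p * N₀ + 2 * N₀ + p + 2) ≤⟨ +-monoˡ-≤ _ (≤-trans p≤n (≤-reflexive n≡)) ⟩
      suc N₀ + (5 * p * N₀ + 2 * N₀ + p + 2) ≤⟨ m≤m+n _ 1 ⟩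
      suc N₀ + (5 * p * N₀ + 2 * N₀ + p + 2) + 1 ≡⟨ lem₃ p N₀ ⟩
      3 * p * N₀ + ((p + 1) * N₀ + 2 + (p + 2) * suc N₀) ≡⟨ cong (λ y → 3 * p * N₀ + ((p + 1) * N₀ + 2 + (p + 2) * y)) (sym n≡) ⟩
      3 * p * N₀ + ((p + 1) * N₀ + 2 + (p + 2) * n) ∎)
      where
      open ≤-Reasoning
      b = card (λ u → not (test i u))
      pt : ∀ x y → ⟦ x ∧ not y ⟧ ≤ ⟦ not y ⟧
      pt true _ = ≤-refl
      pt false _ = z≤n
      co-card : b + card (test i) ≡ n
      co-card = trans (sym (∑-distrib-+ (λ u → ⟦ not (test i u) ⟧) _)) (trans (sum-cong-≗ (λ u → qt (test i u))) (trans (∑-const {n} 1) (*-identityʳ n)))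
        where
        qt : ∀ x → ⟦ not x ⟧ + ⟦ x ⟧ ≡ 1
        qt true = refl
        qt false = refl
      lem₁ : ∀ p N b c → 2 * p * (N + b) + N + ((p + 1) * N + 2 + 2 * p * c) ≡ 2 * p * (b + c) + (3 * p * N + 2 * N + 2)
      lem₁ = solve-∀
      lem₂ : ∀ p N → 2 * p * suc N + (3 * p * N + 2 * N + 2) ≡ p + (5 * p * N + 2 * N + p + 2)
      lem₂ = solve-∀
      lem₃ : ∀ p N → suc N + (5 * p * N + 2 * N + p + 2) + 1 ≡ 3 * p * N + ((p + 1) * N + 2 + (p + 2) * suc N)
      lem₃ = solve-∀

    1≤D : 1 ≤ D
    1≤D = ≤-trans (*-mono-≤ {1} {64 * p * suc E} (*-mono-≤ {1} {64 * p} (*-pos {64} (s≤s z≤n) 1≤p) (s≤s z≤n)) (*-pos {suc θ} (s≤s z≤n) (s≤s z≤n))) D-large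

    -- x₀ is the integer part of (3/2 - α/2)(n - 1).
    module Start (x₀ : ℕ) (x₀≤ : 2 * p * x₀ + N₀ ≤ 3 * p * N₀) (≤x₀ : ∀ i → x U₀ i ≤ x₀) (1≤N₀ : 1 ≤ N₀) where

      open Process {Fin m} Nb Nb-sym p K E j D N₀ x₀ Δ hiding (C; ρ; θ; s)
      open Unfold {Fin m} Adj

      Q₀ : List Item
      Q₀ = items v (mark K X)

      size-Q₀ : sizeᴵ Q₀ ≡ size X
      size-Q₀ = trans (items-size v (mark K X)) (mark-size K X)

      size≤ : sizeᴵ Q₀ ≤ e * D
      size≤ = begin
        sizeᴵ Q₀ ≡⟨ size-Q₀ ⟩
        size X ≤⟨ n≤1+n _ ⟩
        suc (size X) ≡⟨ size-X ⟩
        m ≤⟨ m≤n ⟩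
        n ≤⟨ n≤eD ⟩
        e * D ∎
        where open ≤-Reasoning

      -- `K` is 2e times 16ρC: the children of `t` and the cuts made by `mark` each contribute at
      -- most eD to the product of `K` with the number of roots.
      cuts≤ : 16 * ρ * C * cutsᴵ Q₀ ≤ D
      cuts≤ = *-cancelˡ-≤ (2 * e) {{>-nonZero (*-pos {2} (s≤s z≤n) 1≤e)}} (begin
        2 * e * (16 * ρ * C * cutsᴵ Q₀) ≡⟨ lem e ρ C (cutsᴵ Q₀) ⟩
        K * cutsᴵ Q₀ ≤⟨ *-monoʳ-≤ K (items-cuts v (mark K X)) ⟩
        K * (width (mark K X) + cuts (mark K X)) ≡⟨ cong (λ y → K * (y + cuts (mark K X))) (mark-width K X) ⟩
        K * (width X + cuts (mark K X)) ≡⟨ *-distribˡ-+ K (width X) _ ⟩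
        K * width X + K * cuts (mark K X) ≤⟨ +-mono-≤ (≤-trans widths n≤eD) (≤-trans few size≤) ⟩
        e * D + e * D ≡⟨ lem′ e D ⟩
        2 * e * D ∎)
        where
        open ≤-Reasoning
        lem : ∀ e r c x → 2 * e * (16 * r * c * x) ≡ 32 * r * c * e * x
        lem = solve-∀
        lem′ : ∀ e D → e * D + e * D ≡ 2 * e * D
        lem′ = solve-∀
        widths : K * width X ≤ n
        widths = begin
          K * width X ≤⟨ *-mono-≤ (n≤1+n K) (≤-trans width-X (deg≤Δ t)) ⟩
          suc K * Δ ≤⟨ n≤1+n _ ⟩
          s ≤⟨ m≤n*m s (suc (suc L)) ⟩
          suc (suc L) * s ≤⟨ m≤n*m (suc (suc L) * s) Γ {{>-nonZero 1≤Γ}} ⟩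
          Γ * (suc (suc L) * s) ≤⟨ large ⟩
          n ∎
          where
          1≤Γ : 1 ≤ Γ
          1≤Γ = *-mono-≤ (*-mono-≤ (*-mono-≤ (*-mono-≤ (*-pos {64} (s≤s z≤n) 1≤e) 1≤p) (s≤s {0} {E} z≤n)) (s≤s {0} {θ} z≤n)) 1≤ρ
        few : K * cuts (mark K X) ≤ sizeᴵ Q₀
        few = ≤-trans (≤-trans (*-monoˡ-≤ (cuts (mark K X)) (n≤1+n K)) (m≤m+n _ (residual (mark K X)))) (≤-trans (mark-cuts K X) (≤-reflexive (sym size-Q₀)))

      -- Vertices and roots each take at most one half. W₁ ≤ 15E³ and at most eD vertices explain
      -- the 60ρe in `E`; W₂ ≤ 4E⁴C explains the 16ρC in `cuts≤`.
      budget₀ : ρ * (0 + 2 * (W₁ * sizeᴵ Q₀ + W₂ * cutsᴵ Q₀)) ≤ B * D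
      budget₀ = *-cancelˡ-≤ 2 (begin
        2 * (ρ * (2 * (W₁ * y + W₂ * c))) ≤⟨ *-monoʳ-≤ 2 (*-monoʳ-≤ ρ (*-monoʳ-≤ 2 (+-mono-≤ (*-mono-≤ W₁≤ size≤) (*-monoˡ-≤ c W₂≤)))) ⟩
        2 * (ρ * (2 * (15 * (E * E * E) * (e * D) + 4 * (E * E * E * E) * C * c))) ≡⟨ lem₁ ρ e D (E * E * E) (E * E * E * E) C c ⟩
        E * E * E * (60 * ρ * e) * D + E * E * E * E * (16 * ρ * C * c) ≤⟨ +-monoʳ-≤ (E * E * E * E * D) (*-monoʳ-≤ (E * E * E * E) cuts≤) ⟩
        E * E * E * E * D + E * E * E * E * D ≤⟨ m≤m+n _ (2 * (E * E * E) * D) ⟩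
        E * E * E * E * D + E * E * E * E * D + 2 * (E * E * E) * D ≡⟨ lem₂ E D ⟩
        2 * (B * D) ∎)
        where
        open ≤-Reasoning
        y = sizeᴵ Q₀
        c = cutsᴵ Q₀
        lem₁ : ∀ r e D E₃ E₄ C c → 2 * (r * (2 * (15 * E₃ * (e * D) + 4 * E₄ * C * c))) ≡ E₃ * (60 * r * e) * D + E₄ * (16 * r * C * c)
        lem₁ = solve-∀
        lem₂ : ∀ E D → E * E * E * E * D + E * E * E * E * D + 2 * (E * E * E) * D ≡ 2 * (E * E * (E * suc E) * D)
        lem₂ = solve-∀
        W₁≤ : W₁ ≤ 15 * (E * E * E)
        W₁≤ = poly E 1≤E
          where
          poly : ∀ E → 1 ≤ E → (2 * E + 1) * (E * E) + suc E * suc E * (2 * E + 1) ≤ 15 * (E * E * E)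
          poly (suc i) _ = ≤-trans (m≤m+n _ (11 * (i * i * i) + 27 * (i * i) + 17 * i)) (≤-reflexive (l i))
            where
            l : ∀ i → (2 * suc i + 1) * (suc i * suc i) + suc (suc i) * suc (suc i) * (2 * suc i + 1) + (11 * (i * i * i) + 27 * (i * i) + 17 * i) ≡ 15 * (suc i * suc i * suc i)
            l = solve-∀
        W₂≤ : W₂ ≤ 4 * (E * E * E * E) * C
        W₂≤ = ≤-trans (≤-reflexive (l E C)) (*-monoˡ-≤ C (poly E 1≤E))
          where
          l : ∀ E C → suc E * suc E * (E * E * C) ≡ suc E * suc E * (E * E) * C
          l = solve-∀
          poly : ∀ E → 1 ≤ E → suc E * suc E * (E * E) ≤ 4 * (E * E * E * E)
          poly E 1≤E = ≤-trans (*-monoˡ-≤ (E * E) (*-mono-≤ (twice 1≤E) (twice 1≤E))) (≤-reflexive (l′ E))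
            where
            twice : 1 ≤ E → suc E ≤ 2 * E
            twice h = ≤-trans (+-monoˡ-≤ E h) (≤-reflexive (cong (E +_) (sym (+-identityʳ E))))
            l′ : ∀ E → 2 * E * (2 * E) * (E * E) ≡ 4 * (E * E * E * E)
            l′ = solve-∀

      inv₀ : Inv U₀ 0 Q₀
      inv₀ = record
        { count = begin-equality
            card U₀ ≡⟨ card-U₀ ⟩
            N₀ ≡⟨ suc-injective′ (trans (sym n≡) (trans n≡m+D (trans (cong (_+ D) (sym size-X)) (cong suc (+-comm (size X) D))))) ⟩
            D + size X ≡⟨ cong (D +_) (sym size-Q₀) ⟩
            D + sizeᴵ Q₀ ∎
        ; potential = begin
            (B * D * N₀) ^ M * Φ M U₀ ≤⟨ *-monoʳ-≤ ((B * D * N₀) ^ M) (∑-mono (λ i → ^-monoˡ-≤ M (≤x₀ i))) ⟩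
            (B * D * N₀) ^ M * ∑ {n + n} (λ _ → x₀ ^ M) ≡⟨ cong ((B * D * N₀) ^ M *_) (∑-const {n + n} (x₀ ^ M)) ⟩
            (B * D * N₀) ^ M * ((n + n) * x₀ ^ M) ≡⟨ cong (λ y → y ^ M * ((n + n) * x₀ ^ M)) (cong₂ _*_ (sym (+-identityʳ (B * D))) (sym card-U₀)) ⟩
            ((B * D + 0) * card U₀) ^ M * ((n + n) * x₀ ^ M) ≡⟨ lem (((B * D + 0) * card U₀) ^ M) n (x₀ ^ M) ⟩
            2 * n * x₀ ^ M * ((B * D + 0) * card U₀) ^ M ∎
        ; budget = budget₀ }
        where
        open ≤-Reasoning
        suc-injective′ : ∀ {a b} → suc a ≡ suc b → a ≡ b
        suc-injective′ refl = refl
        lem : ∀ a n b → a * ((n + n) * b) ≡ 2 * n * b * a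
        lem = solve-∀

      outcome : Outcome 1≤p 1≤E 1≤N₀ x₀≤ M-large D-large M-small U₀ Q₀
      outcome = process 1≤p 1≤E 1≤N₀ x₀≤ M-large D-large M-small (sizeᴵ Q₀) Q₀ ≤-refl (items-Good v (mark K X) (mark-Good X (narrow deg≤Δ))) inv₀

      copy : CopyWith Tr t Dg v
      copy = from outcome
        where
        from : Outcome 1≤p 1≤E 1≤N₀ x₀≤ M-large D-large M-small U₀ Q₀ → CopyWith Tr t Dg v
        from (P , un , in₀ , len , sat) = φ , φ-injective , φ-arcs , sym (located (here refl))
          where
          P⁺ : Assignment
          P⁺ = (t , v) ∷ P
          v∉ : v ∉ locs P
          v∉ i = true≢false (in₀ i) (cong not (δ-refl v))
          un⁺ : Unique (locs P⁺)
          un⁺ = AllP.¬Any⇒All¬ _ v∉ ∷ un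
          sat⁺ : Sat P⁺ v X
          sat⁺ = Sat-mono X there (unmark K X (items-Sat v (mark K X) sat))
          located-label : ∀ a → ∃ λ u → (a , u) ∈ P⁺
          located-label a with label-edge a
          ... | inj₁ refl = v , here refl
          ... | inj₂ (_ , ed) with edge-image X sat⁺ (here refl) ed
          ...   | _ , u , _ , i , _ = u , i
          φ : Fin m → Fin n
          φ a = proj₁ (located-label a)
          located : ∀ {a u} → (a , u) ∈ P⁺ → u ≡ φ a
          located = single-valued P⁺ (trans (cong suc (trans len size-Q₀)) size-X) φ (λ a → proj₂ (located-label a))
          φ-injective : ∀ {a b} → φ a ≡ φ b → a ≡ b
          φ-injective {a} {b} eq = single-location P⁺ un⁺ (proj₂ (located-label a)) (subst (λ u → (b , u) ∈ P⁺) (sym eq) (proj₂ (located-label b)))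
          φ-arcs : ∀ a b → T (OrientedGraph.arc graph a b) → T (Digraph.adj Dg (φ a) (φ b))
          φ-arcs a b ab with arc-edge a b ab
          ... | inj₁ ed with edge-image X sat⁺ (here refl) ed
          ...   | u₁ , u₂ , i , j , ad rewrite located i | located j = Equivalence.from T-≡ ad
          φ-arcs a b ab | inj₂ ed with edge-image X sat⁺ (here refl) ed
          ...   | u₁ , u₂ , i , j , ad rewrite located i | located j = Equivalence.from T-≡ ad

    1≤N₀ : 1 ≤ N₀
    1≤N₀ = ≤-pred (≤-trans (≤-trans 2≤D (m∸n≤m n m)) (≤-reflexive n≡))
      where
      2≤D : 2 ≤ D
      2≤D = ≤-trans (*-mono-≤ {2} {64 * p * suc E} (*-mono-≤ {2} {64 * p} (*-mono-≤ {2} {64} (s≤s (s≤s z≤n)) 1≤p) (s≤s z≤n)) (*-pos {suc θ} (s≤s z≤n) (s≤s z≤n))) D-large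

    tree-copy : CopyWith Tr t Dg v
    tree-copy = from (greatest (2 * p) (3 * p * N₀ ∸ N₀) (*-pos {2} (s≤s z≤n) 1≤p))
      where
      N₀≤ : N₀ ≤ 3 * p * N₀
      N₀≤ = m≤n*m N₀ (3 * p) {{>-nonZero (*-pos {3} (s≤s z≤n) 1≤p)}}
      from : (∃ λ x₀ → 2 * p * x₀ ≤ 3 * p * N₀ ∸ N₀ × (∀ y → 2 * p * y ≤ 3 * p * N₀ ∸ N₀ → y ≤ x₀)) → CopyWith Tr t Dg v
      from (x₀ , le , max) = Start.copy x₀
        (≤-trans (+-monoˡ-≤ N₀ le) (≤-reflexive (m∸n+n≡m N₀≤)))
        (λ i → max (x U₀ i) (m+n≤o⇒m≤o∸n (2 * p * x U₀ i) (x-start i)))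
        1≤N₀

  -- Rational parameters

  ratio : ℕ → ℕ → ℚᵘ
  ratio a d = mkℚᵘ (ℤ.+ a) d

  ratio-≤ : ∀ {a d b e} → ratio a d ℚᵘ.≤ ratio b e → a * suc e ≤ b * suc d
  ratio-≤ {a} {d} {b} {e} (ℚᵘ.*≤* le) = ℤₚ.drop‿+≤+ (subst₂ ℤ._≤_ (sym (ℤₚ.pos-* a (suc e))) (sym (ℤₚ.pos-* b (suc d))) le)

  ratio-+ : ∀ a d b e → ratio a d ℚᵘ.+ ratio b e ℚᵘ.≃ ratio (a * suc e + b * suc d) (e + d * suc e)
  ratio-+ a d b e = ℚᵘ.*≡* (cong (ℤ._* (ℤ.+ suc (e + d * suc e)))
    (sym (trans (ℤₚ.pos-+ (a * suc e) (b * suc d)) (cong₂ ℤ._+_ (ℤₚ.pos-* a (suc e)) (ℤₚ.pos-* b (suc d))))))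

  ratio-* : ∀ a d b e → ratio a d ℚᵘ.* ratio b e ℚᵘ.≃ ratio (a * b) (e + d * suc e)
  ratio-* a d b e = ℚᵘ.*≡* (cong (ℤ._* (ℤ.+ suc (e + d * suc e))) (sym (ℤₚ.pos-* a b)))

  toℚᵘ-ℕ : ∀ n → toℚᵘ (ℕtoℚ n) ℚᵘ.≃ ratio n 0
  toℚᵘ-ℕ n = ℚₚ.toℚᵘ-fromℚᵘ (mkℚᵘ (ℤ.+ n) 0)

  record Fraction (x : ℚ) : Set where
    constructor fraction
    field
      num den : ℕ
      num≥1 : 1 ≤ num
      is-ratio : toℚᵘ x ≡ ratio num den
      is-num : ℤ.∣ ℚ.↥ x ∣ ≡ num
      is-den : ↧ₙ x ≡ suc den

  positive-fraction : ∀ x → 0ℚ ℚ.< x → Fraction x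
  positive-fraction (mkℚ +[1+ a ] d _) _ = fraction (suc a) d (s≤s z≤n) refl refl refl
  positive-fraction (mkℚ +0 d _) (ℚ.*<* (ℤ.+<+ ()))
  positive-fraction (mkℚ -[1+ a ] d _) (ℚ.*<* ())

  -- A positive fraction is at least 1 over its denominator. The hypothesis is weakened accordingly,
  -- and the denominator serves as `p`.
  degree-in-ℕ : ∀ {α} (f : Fraction α) n k → (½ ℚ.+ α) ℚ.* ℕtoℚ n ℚ.≤ ℕtoℚ k →
    (suc (Fraction.den f) + 2) * n ≤ 2 * suc (Fraction.den f) * k
  degree-in-ℕ {α} (fraction a d 1≤a eq _ _) n k le = begin
    (suc d + 2) * n ≤⟨ *-monoˡ-≤ n (+-monoʳ-≤ (suc d) (*-monoˡ-≤ 2 1≤a)) ⟩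
    (suc d + a * 2) * n ≡⟨ lem₁ d a n ⟩
    (1 * suc d + a * 2) * n * 1 ≤⟨ ratio-≤ converted ⟩
    k * suc (0 + (d + 1 * suc d) * 1) ≡⟨ lem₂ k d ⟩
    2 * suc d * k ∎
    where
    open ≤-Reasoning
    lem₁ : ∀ d a n → (suc d + a * 2) * n ≡ (1 * suc d + a * 2) * n * 1
    lem₁ = solve-∀
    lem₂ : ∀ k d → k * suc (0 + (d + 1 * suc d) * 1) ≡ 2 * suc d * k
    lem₂ = solve-∀
    lhs : toℚᵘ ((½ ℚ.+ α) ℚ.* ℕtoℚ n) ℚᵘ.≃ ratio ((1 * suc d + a * 2) * n) (0 + (d + 1 * suc d) * 1)
    lhs = ℚᵘₚ.≃-trans (ℚₚ.toℚᵘ-homo-* (½ ℚ.+ α) (ℕtoℚ n)) (ℚᵘₚ.≃-trans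
      (ℚᵘₚ.*-cong (ℚᵘₚ.≃-trans (ℚₚ.toℚᵘ-homo-+ ½ α) (ℚᵘₚ.≃-trans (ℚᵘₚ.+-congʳ (toℚᵘ ½) (ℚᵘₚ.≃-reflexive eq)) (ratio-+ 1 1 a d))) (toℚᵘ-ℕ n))
      (ratio-* (1 * suc d + a * 2) (d + 1 * suc d) n 0))
    converted : ratio ((1 * suc d + a * 2) * n) (0 + (d + 1 * suc d) * 1) ℚᵘ.≤ ratio k 0
    converted = ℚᵘₚ.≤-respˡ-≃ lhs (ℚᵘₚ.≤-respʳ-≃ (toℚᵘ-ℕ k) (ℚₚ.toℚᵘ-mono-≤ le))

  size-in-ℕ : ∀ {ε} (f : Fraction ε) m n → ℕtoℚ m ℚ.≤ (1ℚ ℚ.- ε) ℚ.* ℕtoℚ n →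
    suc (Fraction.den f) * m + n ≤ suc (Fraction.den f) * n
  size-in-ℕ {ε} (fraction a d 1≤a eq _ _) m n le = begin
    suc d * m + n ≤⟨ +-monoʳ-≤ (suc d * m) (≤-trans (≤-reflexive (sym (*-identityˡ n))) (*-monoˡ-≤ n 1≤a)) ⟩
    suc d * m + a * n ≡⟨ lem₁ d m a n ⟩
    (m * suc (0 + d * 1) + a * n * 1) * 1 ≤⟨ ratio-≤ converted ⟩
    n * suc ((0 + d * 1) + 0 * suc (0 + d * 1)) ≡⟨ lem₂ n d ⟩
    suc d * n ∎
    where
    open ≤-Reasoning
    lem₁ : ∀ d m a n → suc d * m + a * n ≡ (m * suc (0 + d * 1) + a * n * 1) * 1
    lem₁ = solve-∀
    lem₂ : ∀ n d → n * suc ((0 + d * 1) + 0 * suc (0 + d * 1)) ≡ suc d * n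
    lem₂ = solve-∀
    added : ℕtoℚ m ℚ.+ ε ℚ.* ℕtoℚ n ℚ.≤ ℕtoℚ n
    added = ℚₚ.≤-trans (ℚₚ.+-monoˡ-≤ (ε ℚ.* ℕtoℚ n) le) (ℚₚ.≤-reflexive
      (trans (sym (ℚₚ.*-distribʳ-+ (ℕtoℚ n) (1ℚ ℚ.- ε) ε)) (trans (cong (ℚ._* ℕtoℚ n) whole) (ℚₚ.*-identityˡ (ℕtoℚ n)))))
      where
      whole : (1ℚ ℚ.- ε) ℚ.+ ε ≡ 1ℚ
      whole = trans (ℚₚ.+-assoc 1ℚ (ℚ.- ε) ε) (trans (cong (1ℚ ℚ.+_) (ℚₚ.+-inverseˡ ε)) (ℚₚ.+-identityʳ 1ℚ))
    lhs : toℚᵘ (ℕtoℚ m ℚ.+ ε ℚ.* ℕtoℚ n) ℚᵘ.≃ ratio (m * suc (0 + d * 1) + a * n * 1) ((0 + d * 1) + 0 * suc (0 + d * 1))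
    lhs = ℚᵘₚ.≃-trans (ℚₚ.toℚᵘ-homo-+ (ℕtoℚ m) (ε ℚ.* ℕtoℚ n)) (ℚᵘₚ.≃-trans
      (ℚᵘₚ.+-cong (toℚᵘ-ℕ m) (ℚᵘₚ.≃-trans (ℚₚ.toℚᵘ-homo-* ε (ℕtoℚ n)) (ℚᵘₚ.≃-trans (ℚᵘₚ.*-cong (ℚᵘₚ.≃-reflexive eq) (toℚᵘ-ℕ n)) (ratio-* a d n 0))))
      (ratio-+ m 0 (a * n) (0 + d * 1)))
    converted : ratio (m * suc (0 + d * 1) + a * n * 1) ((0 + d * 1) + 0 * suc (0 + d * 1)) ℚᵘ.≤ ratio n 0
    converted = ℚᵘₚ.≤-respˡ-≃ lhs (ℚᵘₚ.≤-respʳ-≃ (toℚᵘ-ℕ n) (ℚₚ.toℚᵘ-mono-≤ added))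

  unit-fraction : ℕ → ℚ
  unit-fraction k = fromℚᵘ (ratio 1 k)

  unit-fraction>0 : ∀ k → 0ℚ ℚ.< unit-fraction k
  unit-fraction>0 k = ℚₚ.toℚᵘ-cancel-< (ℚᵘₚ.<-respʳ-≃ (ℚᵘₚ.≃-sym (ℚₚ.toℚᵘ-fromℚᵘ (ratio 1 k))) (ℚᵘ.*<* (ℤ.+<+ (s≤s z≤n))))

  ≤unit-fraction : ∀ {c k} (f : Fraction c) → c ℚ.≤ unit-fraction k → Fraction.num f * suc k ≤ suc (Fraction.den f)
  ≤unit-fraction {c} {k} (fraction a d _ eq _ _) le = ≤-trans (ratio-≤ (ℚᵘₚ.≤-respˡ-≃ (ℚᵘₚ.≃-reflexive eq)
    (ℚᵘₚ.≤-respʳ-≃ (ℚₚ.toℚᵘ-fromℚᵘ (ratio 1 k)) (ℚₚ.toℚᵘ-mono-≤ le)))) (≤-reflexive (+-identityʳ (suc d)))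

  -- Binary logarithms.

  binary-length : ∀ n → 1 ≤ n → ∃ λ L → 2 ^ L ≤ n × n < 2 ^ suc L
  binary-length (suc zero) _ = 0 , ≤-refl , ≤-refl
  binary-length (suc n@(suc _)) _ with binary-length n (s≤s z≤n)
  ... | L , lo , hi with suc n <? 2 ^ suc L
  ...   | yes lt = L , ≤-trans lo (n≤1+n n) , lt
  ...   | no ≮ = suc L , ≮⇒≥ ≮ , <-≤-trans (s≤s hi) (≤-trans (+-monoˡ-≤ (2 ^ suc L) (m^n>0 2 (suc L))) (≤-reflexive (cong (λ y → 2 ^ suc L + y) (sym (+-identityʳ _)))))

  L<2^L : ∀ L → suc L ≤ 2 ^ L
  L<2^L zero = ≤-refl
  L<2^L (suc L) = ≤-trans (+-mono-≤ (m^n>0 2 L) (L<2^L L)) (≤-reflexive (cong (λ y → 2 ^ L + y) (sym (+-identityʳ _))))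

  L²≤2^ : ∀ L → L * L ≤ 2 * 2 ^ L
  L²≤2^ zero = z≤n
  L²≤2^ (suc L) = begin
    suc L * suc L ≤⟨ m≤m+n _ 1 ⟩
    suc L * suc L + 1 ≡⟨ lem L ⟩
    L * L + 2 * suc L ≤⟨ +-mono-≤ (L²≤2^ L) (*-monoʳ-≤ 2 (L<2^L L)) ⟩
    2 * 2 ^ L + 2 * 2 ^ L ≡⟨ lem′ (2 ^ L) ⟩
    2 * 2 ^ suc L ∎
    where
    open ≤-Reasoning
    lem : ∀ L → suc L * suc L + 1 ≡ L * L + 2 * suc L
    lem = solve-∀
    lem′ : ∀ x → 2 * x + 2 * x ≡ 2 * (2 * x)
    lem′ = solve-∀

  -- If L ≤ 2c, the bound is c · 2c ≤ n. Otherwise c is below L/2, and cL is at most L²/2 ≤ 2^L.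
  log-small : ∀ c n L → 2 ^ L ≤ n → c * (2 * c) ≤ n → c * L ≤ n
  log-small c n L le big with L ≤? 2 * c
  ... | yes small = ≤-trans (*-monoʳ-≤ c small) big
  ... | no ≰ = ≤-trans (*-cancelˡ-≤ 2 (≤-trans (≤-trans (≤-reflexive (sym (*-assoc 2 c L))) (*-monoˡ-≤ L (<⇒≤ (≰⇒> ≰)))) (L²≤2^ L))) le

  -- Replacing n by 2^L on the left of `LogBound` makes both sides powers of 2, so the exponents can
  -- be compared: LΔq ≤ an, where c = a/q is at most 1/(k+1).
  LogBound-in-ℕ : ∀ {c k n L Δ} (f : Fraction c) → c ℚ.≤ unit-fraction k → 2 ^ L ≤ n → LogBound Δ c n → suc k * L * Δ ≤ n
  LogBound-in-ℕ {c} {k} {n} {L} {Δ} f c≤ 2^L≤n lb = *-cancelˡ-≤ q (begin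
    q * (suc k * L * Δ) ≡⟨ lem q (suc k) L Δ ⟩
    suc k * (L * (Δ * q)) ≤⟨ *-monoʳ-≤ (suc k) exponents ⟩
    suc k * (a * n) ≡⟨ lem′ (suc k) a n ⟩
    a * suc k * n ≤⟨ *-monoˡ-≤ n (≤unit-fraction f c≤) ⟩
    q * n ∎)
    where
    open ≤-Reasoning
    open Fraction f renaming (num to a)
    q = suc den
    lem : ∀ q k L Δ → q * (k * L * Δ) ≡ k * (L * (Δ * q))
    lem = solve-∀
    lem′ : ∀ k a n → k * (a * n) ≡ a * k * n
    lem′ = solve-∀
    exponents : L * (Δ * q) ≤ a * n
    exponents = ≮⇒≥ (λ lt → <⇒≱ (^-monoʳ-< 2 (s≤s (s≤s z≤n)) lt) (begin
      2 ^ (L * (Δ * q)) ≡⟨ sym (^-*-assoc 2 L (Δ * q)) ⟩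
      (2 ^ L) ^ (Δ * q) ≤⟨ ^-monoˡ-≤ (Δ * q) 2^L≤n ⟩
      n ^ (Δ * q) ≤⟨ subst₂ (λ y z → n ^ (Δ * y) ≤ 2 ^ (z * n)) is-den is-num lb ⟩
      2 ^ (a * n) ∎))

  module Parameters (α ε : ℚ) (fα : Fraction α) (fε : Fraction ε) where

    p e : ℕ
    p = suc (Fraction.den fα)
    e = suc (Fraction.den fε)

    open Constants p e

    -- The largest admissible c is 1/C₀, and `k` is the predecessor because `unit-fraction` adds
    -- one. In `n₀` the summand 2 makes the binary length positive, which the division by C₀L needs;
    -- the product serves `log-small`.
    C₀ k n₀ : ℕ
    C₀ = 6 * Γ * suc K
    k = pred C₀
    n₀ = 2 + 6 * Γ * (2 * (6 * Γ))

    1≤Γ : 1 ≤ Γ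
    1≤Γ = *-mono-≤ (*-mono-≤ (*-mono-≤ (*-mono-≤ (*-pos {64} (s≤s z≤n) (s≤s {0} {Fraction.den fε} z≤n)) (s≤s {0} {Fraction.den fα} z≤n)) (s≤s {0} {E} z≤n)) (s≤s {0} {θ} z≤n)) (*-pos {18} (s≤s z≤n) (s≤s {0} {Fraction.den fα} z≤n))

    C₀≡ : suc k ≡ C₀
    C₀≡ = suc-pred C₀ {{>-nonZero (*-mono-≤ (*-pos {6} (s≤s z≤n) 1≤Γ) (s≤s {0} {K} z≤n))}}

    copy : ∀ c → 0ℚ ℚ.< c → c ℚ.≤ unit-fraction k → ∀ n → n ≥ n₀ → (Dg : Digraph n) →
      MinSemiDegreeAtLeast Dg ((½ ℚ.+ α) ℚ.* ℕtoℚ n) → (v : Fin n) → ∀ m (Tr : OrientedTree m) →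
      ℕtoℚ m ℚ.≤ (1ℚ ℚ.- ε) ℚ.* ℕtoℚ n → MaxDegBound Tr c n → (t : Fin m) → CopyWith Tr t Dg v
    copy c 0<c c≤ n n≥ Dg semi v m Tr room degs t = with-L (binary-length n (≤-trans (s≤s z≤n) n≥))
      where
      with-L : (∃ λ L → 2 ^ L ≤ n × n < 2 ^ suc L) → CopyWith Tr t Dg v
      with-L (zero , _ , s≤s n≤1) = contradiction (≤-trans n≥ n≤1) λ { (s≤s ()) }
      -- Δ is taken as the greatest integer allowed by the degree hypothesis. It bounds every degree
      -- of the tree and satisfies C₀LΔ ≤ n.
      with-L (suc l , lo , hi) = with-Δ (greatest (C₀ * L) n (*-mono-≤ (subst (1 ≤_) C₀≡ (s≤s z≤n)) (s≤s z≤n)))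
        where
        L = suc l
        with-Δ : (∃ λ Δ → C₀ * L * Δ ≤ n × (∀ y → C₀ * L * y ≤ n → y ≤ Δ)) → CopyWith Tr t Dg v
        with-Δ (Δ , le , max) = Core.tree-copy p e (s≤s z≤n) (s≤s z≤n) Dg v Tr t
          (λ u → subst (λ y → (p + 2) * n ≤ 2 * p * y) (countTrue≡∑ (Digraph.adj Dg u)) (degree-in-ℕ fα n _ (proj₁ (semi u))))
          (λ u → subst (λ y → (p + 2) * n ≤ 2 * p * y) (countTrue≡∑ (λ w → Digraph.adj Dg w u)) (degree-in-ℕ fα n _ (proj₂ (semi u))))
          (size-in-ℕ fε m n room) L Δ (<⇒≤ hi)
          (λ a → max _ (subst (λ y → y * L * udeg (OrientedTree.graph Tr) a ≤ n) C₀≡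
            (LogBound-in-ℕ {c} {k} {n} {L} {udeg (OrientedTree.graph Tr) a} (positive-fraction c 0<c) c≤ lo (degs a))))
          large
          where
          open ≤-Reasoning
          large : Γ * (suc (suc L) * suc (suc K * Δ)) ≤ n
          large = *-cancelˡ-≤ 2 (begin
            2 * (Γ * (suc (suc L) * suc (suc K * Δ))) ≤⟨ *-monoʳ-≤ 2 (*-monoʳ-≤ Γ (*-monoˡ-≤ (suc (suc K * Δ)) (L+2≤ l))) ⟩
            2 * (Γ * (3 * L * suc (suc K * Δ))) ≡⟨ lem Γ L K Δ ⟩
            6 * Γ * L + C₀ * L * Δ ≤⟨ +-mono-≤ (log-small (6 * Γ) n L lo (≤-trans (m≤n+m _ 2) n≥)) le ⟩
            n + n ≡⟨ cong (λ y → n + y) (sym (+-identityʳ n)) ⟩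
            2 * n ∎)
            where
            lem : ∀ g L K Δ → 2 * (g * (3 * L * suc (suc K * Δ))) ≡ 6 * g * L + 6 * g * suc K * L * Δ
            lem = solve-∀
            L+2≤ : ∀ l → suc (suc (suc l)) ≤ 3 * suc l
            L+2≤ l = ≤-trans (m≤m+n _ (2 * l)) (≤-reflexive (lem′ l))
              where
              lem′ : ∀ l → suc (suc (suc l)) + 2 * l ≡ 3 * suc l
              lem′ = solve-∀

open import Data.Nat using (ℕ; _≥_)
open import Data.Fin using (Fin)
open import Data.Rational using (ℚ; _<_; _≤_; _+_; _-_; _*_; 0ℚ; 1ℚ; ½)
open Embedding using (positive-fraction; unit-fraction; unit-fraction>0; module Parameters)

theorem2p2 : (ε α : ℚ) → 0ℚ < ε → ε ≤ 1ℚ → 0ℚ < α → α ≤ 1ℚ →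
    Σ ℚ λ c₀ → (0ℚ < c₀) × ((c : ℚ) → 0ℚ < c → c ≤ c₀ →
    Σ ℕ λ n₀ → (n : ℕ) → n ≥ n₀ →
    (D : Digraph n) → MinSemiDegreeAtLeast D ((½ + α) * ℕtoℚ n) → (v : Fin n) →
    (m : ℕ) → (Tr : OrientedTree m) → ℕtoℚ m ≤ (1ℚ - ε) * ℕtoℚ n →
    MaxDegBound Tr c n → (t : Fin m) →
    CopyWith Tr t D v)
theorem2p2 ε α 0<ε _ 0<α _ = unit-fraction P.k , unit-fraction>0 P.k , λ c 0<c c≤ → P.n₀ , P.copy c 0<c c≤
  where module P = Parameters α ε (positive-fraction α 0<α) (positive-fraction ε 0<ε)
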